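{- Let $\Gamma\subset\mathbb{P}^3$ be the 1-skeleton of the hemi-hypercube $\{4,3,3\}/2$ in real projective 3-space, let $c$ be a chiral colouring of $\Gamma$ with four colours, and let $\mathcal{Q}$ be the 4-polytope of type $\{4,3,3\}$ in $\mathbb{P}^3$ whose vertices and edges are those of $\Gamma$, whose 2-faces are the connected components of the subgraphs of $\Gamma$ formed by the edges of exactly two given colours, and whose facets (3-faces) are the connected components of the subgraphs formed by the edges of exactly three given colours. Then: (i) $\mathcal{Q}$ is combinatorially isomorphic to the hemi-hypercube $\{4,3,3\}/2$ (that is, their face posets are isomorphic); (ii) $\mathcal{Q}$ is geometrically chiral in $\mathbb{P}^3$; (iii) every facet of $\mathcal{Q}$ is geometrically chiral in $\mathbb{P}^3$.
   Context: **Projective space.** $\mathbb{P}^3$ is the set of lines through the origin of $\mathbb{R}^4$, i.e. the quotient of the unit sphere $\mathbb{S}^3$ by the antipodal map, with the induced metric. Its isometries are those induced by the orthogonal group, i.e. the group $O(4)/\{\pm I\}$. **The hemi-hypercube and its graph.** The hypercube $\{4,3,3\}$ is the 4-cube with vertex set $\{\pm1\}^4\subset\mathbb{R}^4$. The hemi-hypercube $\{4,3,3\}/2$ is its quotient by the central inversion $x\mapsto -x$: its face poset is the face poset of the 4-cube with each proper face identified with its antipodal face (so there are 8 vertices, 16 edges, 12 square 2-faces and 4 cubical facets, together with a least and a greatest face). It lives in $\mathbb{P}^3$. Its vertices are the 8 points $[x]$ with $x\in\{\pm1\}^4$, where $[x]=[-x]$. Its edges are the 16 shortest geodesic segments joining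 $[x]$ and $[y]$, where $y$ is obtained from $x$ by changing the sign of exactly one coordinate $i\in\{1,2,3,4\}$; this $i$ is called the direction of the edge. The resulting graph $\Gamma$ (the 1-skeleton) is isomorphic to the complete bipartite graph $K_{4,4}$. **Chiral colourings.** A chiral colouring of $\Gamma$ is an assignment of one of four colours to each edge of $\Gamma$ such that each colour class is a perfect matching of $\Gamma$ (four pairwise disjoint edges covering all vertices) and each colour class contains exactly one edge in each of the four directions. Up to renaming the colours there are exactly two chiral colourings; the polytopes they give are the two enantiomorphic (mirror image) forms. **Face poset of $\mathcal{Q}$.** The faces of $\mathcal{Q}$ are: a least face of rank $-1$; the vertices (rank 0) and edges (rank 1) of $\Gamma$; the 2-faces and 3-faces described in the claim, regarded as subgraphs of $\Gamma$; and a greatest face of rank 4 (all of $\Gamma$). They are ordered by inclusion. A flag is a maximal chain of faces. Two flags are adjacent if they differ in exactly one face. Each facet $F$ of $\mathcal{Q}$ is itself regarded as a polytope of rank 3 in $\mathbb{P}^3$, whose faces are the faces of $\mathcal{Q}$ contained in $F$. **Geometric chirality.** Let the polytope be either $\mathcal{Q}$ or one of its facets, realised in $\mathbb{P}^3$ with its vertices being points $[x]$, its edges being geodesic segments of $\Gamma$, and its faces of higher rank being subgraphs of $\Gamma\subset\mathbb{P}^3$. A symmetry of the polytope is an isometry of $\mathbb{P}^3$ that maps the set of faces of each rank of the polytope onto itself. The polytope is geometrically chiral if the action of its symmetry group on its set of flags has exactly two orbits and any two adjacent flags lie in different orbits. -}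

module Defs where

open import Data.Bool.Base using (Bool; T)
open import Data.Empty using (⊥)
open import Data.Fin.Base using (Fin)
open import Data.Fin.Properties using (_≟_)
open import Data.Fin.Subset using (Subset; ∣_∣) renaming (_∈_ to _∈ˢ_)
open import Data.Integer.Base using (ℤ; +_; -[1+_])
open import Data.List.Base using (List)
open import Data.List.Relation.Unary.Any using (Any)
open import Data.Maybe.Base as Maybe using (Maybe; just; nothing)
open import Data.Nat.Base as ℕ using (ℕ)
import Data.Nat.Properties as ℕ
open import Data.Product using (∃; ∃₂; ∃!; _×_; _,_; proj₁; proj₂)
open import Data.Rational.Base as ℚ using (ℚ; 0ℚ; 1ℚ; ½)
import Data.Rational.Properties as ℚ
open import Data.Rational.Solver using (module +-*-Solver)
open import Data.Sign.Base as Sign using (Sign; opposite)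
open import Data.Sum.Base using (_⊎_)
open import Data.Vec.Base as Vec using (Vec; []; _∷_; lookup; updateAt)
open import Data.Vec.Functional using (Vector; foldr)
open import Relation.Binary.Construct.Closure.ReflexiveTransitive using (Star)
open import Relation.Binary.Core using (Rel)
open import Relation.Binary.Morphism.Structures using (IsOrderIsomorphism)
open import Relation.Binary.PropositionalEquality
  using (_≡_; refl; sym; trans; cong; subst)
open import Relation.Nullary.Decidable.Core using (yes; no)
open import Relation.Nullary.Negation.Core using (¬_)
open import Relation.Unary using (Pred; _≐_; ∅; U)
import Level

-- The real numbers are Cauchy sequences of rationals, with the setoid equality _≈_.

IsCauchy : (ℕ → ℚ) → Set
IsCauchy u = ∀ ε → 0ℚ ℚ.< ε →
  ∃ λ N → ∀ m n → N ℕ.≤ m → N ℕ.≤ n → ℚ.∣ u m ℚ.- u n ∣ ℚ.< ε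

record ℝ : Set where
  constructor mkℝ
  field
    seq    : ℕ → ℚ
    cauchy : IsCauchy seq

open ℝ public

infix  4 _≈_ _≤_
infixl 6 _+_
infixl 7 _*_
infix  8 -_

_≈_ : Rel ℝ Level.zero
x ≈ y = ∀ ε → 0ℚ ℚ.< ε →
  ∃ λ N → ∀ n → N ℕ.≤ n → ℚ.∣ seq x n ℚ.- seq y n ∣ ℚ.< ε

_≤_ : Rel ℝ Level.zero
x ≤ y = ∀ ε → 0ℚ ℚ.< ε → ∃ λ N → ∀ n → N ℕ.≤ n → seq x n ℚ.< seq y n ℚ.+ ε

half-pos : ∀ {ε} → 0ℚ ℚ.< ε → 0ℚ ℚ.< ½ ℚ.* ε
half-pos {ε} ε>0 = subst (ℚ._< ½ ℚ.* ε) (ℚ.*-zeroʳ ½) (ℚ.*-monoʳ-<-pos ½ ε>0)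

half+half : ∀ ε → ½ ℚ.* ε ℚ.+ ½ ℚ.* ε ≡ ε
half+half ε = trans (sym (ℚ.*-distribʳ-+ ε ½ ½)) (ℚ.*-identityˡ ε)

∣p-p∣<ε : ∀ p {ε} → 0ℚ ℚ.< ε → ℚ.∣ p ℚ.- p ∣ ℚ.< ε
∣p-p∣<ε p {ε} ε>0 = subst (λ q → ℚ.∣ q ∣ ℚ.< ε) (sym (ℚ.+-inverseʳ p)) ε>0

-- (1/2 ε) / B
module _ (B : ℚ) (B>0 : 0ℚ ℚ.< B) (ε : ℚ) (ε>0 : 0ℚ ℚ.< ε) where
  private instance
    B-pos : ℚ.Positive B
    B-pos = ℚ.positive B>0
    B-nz : ℚ.NonZero B
    B-nz = ℚ.pos⇒nonZero B
    1/B-pos : ℚ.Positive (ℚ.1/ B)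
    1/B-pos = ℚ.1/pos⇒pos B

  share : ℚ
  share = ℚ.1/ B ℚ.* (½ ℚ.* ε)

  share>0 : 0ℚ ℚ.< share
  share>0 = subst (ℚ._< share) (ℚ.*-zeroʳ (ℚ.1/ B))
              (ℚ.*-monoʳ-<-pos (ℚ.1/ B) (half-pos ε>0))

  B*share : B ℚ.* share ≡ ½ ℚ.* ε
  B*share = trans (sym (ℚ.*-assoc B (ℚ.1/ B) (½ ℚ.* ε)))
              (trans (cong (ℚ._* (½ ℚ.* ε)) (ℚ.*-inverseʳ B))
                (ℚ.*-identityˡ (½ ℚ.* ε)))

module _ (u : ℕ → ℚ) (u-cauchy : IsCauchy u) where
  private
    N : ℕ
    N = proj₁ (u-cauchy 1ℚ (ℚ.positive⁻¹ 1ℚ))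

  bound : ℚ
  bound = 1ℚ ℚ.+ ℚ.∣ u N ∣

  bound>0 : 0ℚ ℚ.< bound
  bound>0 = ℚ.+-mono-<-≤ (ℚ.positive⁻¹ 1ℚ) (ℚ.0≤∣p∣ (u N))

  boundedFrom : ℕ
  boundedFrom = N

  bounded : ∀ n → N ℕ.≤ n → ℚ.∣ u n ∣ ℚ.≤ bound
  bounded n N≤n = begin
    ℚ.∣ u n ∣                         ≡⟨ cong ℚ.∣_∣ (rearrange (u n) (u N)) ⟩
    ℚ.∣ (u n ℚ.- u N) ℚ.+ u N ∣       ≤⟨ ℚ.∣p+q∣≤∣p∣+∣q∣ (u n ℚ.- u N) (u N) ⟩
    ℚ.∣ u n ℚ.- u N ∣ ℚ.+ ℚ.∣ u N ∣   ≤⟨ ℚ.+-monoˡ-≤ ℚ.∣ u N ∣ (ℚ.<⇒≤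
                                          (proj₂ (u-cauchy 1ℚ (ℚ.positive⁻¹ 1ℚ))
                                            n N N≤n ℕ.≤-refl)) ⟩
    bound                             ∎
    where
    open ℚ.≤-Reasoning
    rearrange : ∀ a b → a ≡ (a ℚ.- b) ℚ.+ b
    rearrange = solve 2 (λ a b → a := (a :- b) :+ b) refl
      where open +-*-Solver

+-cauchy : ∀ {u v} → IsCauchy u → IsCauchy v → IsCauchy (λ n → u n ℚ.+ v n)
+-cauchy {u} {v} cu cv ε ε>0 = M ℕ.⊔ N , λ m n M⊔N≤m M⊔N≤n → begin-strict
    ℚ.∣ (u m ℚ.+ v m) ℚ.- (u n ℚ.+ v n) ∣
      ≡⟨ cong ℚ.∣_∣ (rearrange (u m) (v m) (u n) (v n)) ⟩
    ℚ.∣ (u m ℚ.- u n) ℚ.+ (v m ℚ.- v n) ∣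
      ≤⟨ ℚ.∣p+q∣≤∣p∣+∣q∣ (u m ℚ.- u n) (v m ℚ.- v n) ⟩
    ℚ.∣ u m ℚ.- u n ∣ ℚ.+ ℚ.∣ v m ℚ.- v n ∣
      <⟨ ℚ.+-mono-< (Mp m n (ℕ.m⊔n≤o⇒m≤o M N M⊔N≤m) (ℕ.m⊔n≤o⇒m≤o M N M⊔N≤n))
                    (Np m n (ℕ.m⊔n≤o⇒n≤o M N M⊔N≤m) (ℕ.m⊔n≤o⇒n≤o M N M⊔N≤n)) ⟩
    ½ ℚ.* ε ℚ.+ ½ ℚ.* ε
      ≡⟨ half+half ε ⟩
    ε ∎
  where
  open ℚ.≤-Reasoning
  M  = proj₁ (cu (½ ℚ.* ε) (half-pos ε>0))
  Mp = proj₂ (cu (½ ℚ.* ε) (half-pos ε>0))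
  N  = proj₁ (cv (½ ℚ.* ε) (half-pos ε>0))
  Np = proj₂ (cv (½ ℚ.* ε) (half-pos ε>0))
  rearrange : ∀ a b c d → (a ℚ.+ b) ℚ.- (c ℚ.+ d) ≡ (a ℚ.- c) ℚ.+ (b ℚ.- d)
  rearrange = solve 4 (λ a b c d → (a :+ b) :- (c :+ d) := (a :- c) :+ (b :- d)) refl
    where open +-*-Solver

neg-cauchy : ∀ {u} → IsCauchy u → IsCauchy (λ n → ℚ.- u n)
neg-cauchy {u} cu ε ε>0 = proj₁ (cu ε ε>0) , λ m n N≤m N≤n →
  subst (ℚ._< ε)
    (trans (sym (ℚ.∣-p∣≡∣p∣ (u m ℚ.- u n))) (cong ℚ.∣_∣ (rearrange (u m) (u n))))
    (proj₂ (cu ε ε>0) m n N≤m N≤n)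
  where
  rearrange : ∀ a b → ℚ.- (a ℚ.- b) ≡ (ℚ.- a) ℚ.- (ℚ.- b)
  rearrange = solve 2 (λ a b → :- (a :- b) := (:- a) :- (:- b)) refl
    where open +-*-Solver

*-cauchy : ∀ {u v} → IsCauchy u → IsCauchy v → IsCauchy (λ n → u n ℚ.* v n)
*-cauchy {u} {v} cu cv ε ε>0 = K , λ m n K≤m K≤n → begin-strict
    ℚ.∣ u m ℚ.* v m ℚ.- u n ℚ.* v n ∣
      ≡⟨ cong ℚ.∣_∣ (rearrange (u m) (v m) (u n) (v n)) ⟩
    ℚ.∣ u m ℚ.* (v m ℚ.- v n) ℚ.+ v n ℚ.* (u m ℚ.- u n) ∣
      ≤⟨ ℚ.∣p+q∣≤∣p∣+∣q∣ (u m ℚ.* (v m ℚ.- v n)) (v n ℚ.* (u m ℚ.- u n)) ⟩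
    ℚ.∣ u m ℚ.* (v m ℚ.- v n) ∣ ℚ.+ ℚ.∣ v n ℚ.* (u m ℚ.- u n) ∣
      <⟨ ℚ.+-mono-<
           (small Bu Bu>0 (u m) (v m ℚ.- v n)
             (bounded u cu m (a≤ K≤m)) (Np m n (d≤ K≤m) (d≤ K≤n)))
           (small Bv Bv>0 (v n) (u m ℚ.- u n)
             (bounded v cv n (b≤ K≤n)) (Mp m n (c≤ K≤m) (c≤ K≤n))) ⟩
    ½ ℚ.* ε ℚ.+ ½ ℚ.* ε
      ≡⟨ half+half ε ⟩
    ε ∎
  where
  open ℚ.≤-Reasoning
  Bu   = bound u cu
  Bu>0 = bound>0 u cu
  Bv   = bound v cv
  Bv>0 = bound>0 v cv
  M    = proj₁ (cu (share Bv Bv>0 ε ε>0) (share>0 Bv Bv>0 ε ε>0))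
  Mp   = proj₂ (cu (share Bv Bv>0 ε ε>0) (share>0 Bv Bv>0 ε ε>0))
  N    = proj₁ (cv (share Bu Bu>0 ε ε>0) (share>0 Bu Bu>0 ε ε>0))
  Np   = proj₂ (cv (share Bu Bu>0 ε ε>0) (share>0 Bu Bu>0 ε ε>0))
  a    = boundedFrom u cu
  b    = boundedFrom v cv
  K    = (a ℕ.⊔ b) ℕ.⊔ (M ℕ.⊔ N)
  a≤ : ∀ {n} → K ℕ.≤ n → a ℕ.≤ n
  a≤ p = ℕ.m⊔n≤o⇒m≤o a b (ℕ.m⊔n≤o⇒m≤o (a ℕ.⊔ b) (M ℕ.⊔ N) p)
  b≤ : ∀ {n} → K ℕ.≤ n → b ℕ.≤ n
  b≤ p = ℕ.m⊔n≤o⇒n≤o a b (ℕ.m⊔n≤o⇒m≤o (a ℕ.⊔ b) (M ℕ.⊔ N) p)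
  c≤ : ∀ {n} → K ℕ.≤ n → M ℕ.≤ n
  c≤ p = ℕ.m⊔n≤o⇒m≤o M N (ℕ.m⊔n≤o⇒n≤o (a ℕ.⊔ b) (M ℕ.⊔ N) p)
  d≤ : ∀ {n} → K ℕ.≤ n → N ℕ.≤ n
  d≤ p = ℕ.m⊔n≤o⇒n≤o M N (ℕ.m⊔n≤o⇒n≤o (a ℕ.⊔ b) (M ℕ.⊔ N) p)
  rearrange : ∀ a b c d → a ℚ.* b ℚ.- c ℚ.* d ≡ a ℚ.* (b ℚ.- d) ℚ.+ d ℚ.* (a ℚ.- c)
  rearrange = solve 4 (λ a b c d →
    a :* b :- c :* d := a :* (b :- d) :+ d :* (a :- c)) refl
    where open +-*-Solver
  small : ∀ B (B>0 : 0ℚ ℚ.< B) p q → ℚ.∣ p ∣ ℚ.≤ B → ℚ.∣ q ∣ ℚ.< share B B>0 ε ε>0 →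
          ℚ.∣ p ℚ.* q ∣ ℚ.< ½ ℚ.* ε
  small B B>0 p q p≤B q<δ = begin-strict
    ℚ.∣ p ℚ.* q ∣            ≡⟨ ℚ.∣p*q∣≡∣p∣*∣q∣ p q ⟩
    ℚ.∣ p ∣ ℚ.* ℚ.∣ q ∣      ≤⟨ ℚ.*-monoʳ-≤-nonNeg ℚ.∣ q ∣ {{ℚ.∣-∣-nonNeg q}} p≤B ⟩
    B ℚ.* ℚ.∣ q ∣            <⟨ ℚ.*-monoʳ-<-pos B {{ℚ.positive B>0}} q<δ ⟩
    B ℚ.* share B B>0 ε ε>0  ≡⟨ B*share B B>0 ε ε>0 ⟩
    ½ ℚ.* ε                  ∎

fromℚ : ℚ → ℝ
fromℚ p = mkℝ (λ _ → p) λ ε ε>0 → 0 , λ _ _ _ _ → ∣p-p∣<ε p ε>0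

0ℝ 1ℝ : ℝ
0ℝ = fromℚ 0ℚ
1ℝ = fromℚ 1ℚ

_+_ _*_ : ℝ → ℝ → ℝ
x + y = mkℝ (λ n → seq x n ℚ.+ seq y n) (+-cauchy {seq x} {seq y} (cauchy x) (cauchy y))
x * y = mkℝ (λ n → seq x n ℚ.* seq y n) (*-cauchy {seq x} {seq y} (cauchy x) (cauchy y))

-_ : ℝ → ℝ
- x = mkℝ (λ n → ℚ.- seq x n) (neg-cauchy {seq x} (cauchy x))

ℝ⁴ : Set
ℝ⁴ = Vector ℝ 4

∑ : ℝ⁴ → ℝ
∑ = foldr _+_ 0ℝ

-- Points of ℙ³ are unit vectors of ℝ⁴, considered up to _≈±_.
infix 4 _≈±_

_≈±_ : Rel ℝ⁴ Level.zero
u ≈± v = (∀ i → u i ≈ v i) ⊎ (∀ i → u i ≈ - v i)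

record ℙ³ : Set where
  field
    coords : ℝ⁴
    unit   : ∑ (λ i → coords i * coords i) ≈ 1ℝ

open ℙ³ public

PointSet : Set₁
PointSet = Pred ℙ³ Level.zero

Matrix : Set
Matrix = Fin 4 → Fin 4 → ℝ

identity : Matrix
identity i j with i ≟ j
... | yes _ = 1ℝ
... | no  _ = 0ℝ

-- An element of O(4) stands for the isometry of ℙ³ that it induces; ±g induce the same one.
record Isometry : Set where
  field
    matrix     : Matrix
    orthogonal : ∀ i j → ∑ (λ k → matrix k i * matrix k j) ≈ identity i j

  apply : ℝ⁴ → ℝ⁴
  apply v i = ∑ (λ k → matrix i k * v k)

open Isometry public

Sends : Isometry → ℙ³ → ℙ³ → Set
Sends g p q = coords q ≈± apply g (coords p)

MapsOnto : Isometry → PointSet → PointSet → Set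
MapsOnto g A B = (∀ p → A p → ∃ λ q → B q × Sends g p q)
               × (∀ q → B q → ∃ λ p → A p × Sends g p q)

-- An element x of {±1}⁴ stands for the vertex [x] of Γ.
Vertex : Set
Vertex = Vec Sign 4

antipode : Vertex → Vertex
antipode = Vec.map opposite

flip : Fin 4 → Vertex → Vertex
flip i x = updateAt x i opposite

infix 4 _∼_ _∼ᴱ_

_∼_ : Rel Vertex Level.zero
x ∼ y = x ≡ y ⊎ x ≡ antipode y

-- (x , i) stands for the edge joining [x] and [flip i x].
Edge : Set
Edge = Vertex × Fin 4

direction : Edge → Fin 4
direction = proj₂

Endpoint : Edge → Pred Vertex Level.zero
Endpoint (x , i) y = y ∼ x ⊎ y ∼ flip i x

_∼ᴱ_ : Rel Edge Level.zero
(x , i) ∼ᴱ (y , j) = i ≡ j × Endpoint (y , j) x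

record Subgraph : Set where
  field
    vertex?      : Vertex → Bool
    edge?        : Edge → Bool
    vertex?-cong : ∀ {x y} → x ∼ y → vertex? x ≡ vertex? y
    edge?-cong   : ∀ {e f} → e ∼ᴱ f → edge? e ≡ edge? f
    endpoints    : ∀ {e x} → T (edge? e) → Endpoint e x → T (vertex? x)

  Vertices : Pred Vertex Level.zero
  Vertices x = T (vertex? x)

  Edges : Pred Edge Level.zero
  Edges e = T (edge? e)

open Subgraph public

infix 4 _⊑_

_⊑_ : Rel Subgraph Level.zero
S ⊑ S′ = (∀ x → Vertices S x → Vertices S′ x) × (∀ e → Edges S e → Edges S′ e)

±½ : Sign → ℚ
±½ Sign.+ = ½
±½ Sign.- = ℚ.- ½

±½-square : ∀ s → ±½ s ℚ.* ±½ s ≡ ½ ℚ.* ½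
±½-square Sign.+ = refl
±½-square Sign.- = refl

vertexCoords : Vertex → ℝ⁴
vertexCoords x i = fromℚ (±½ (lookup x i))

vertexPoint : Vertex → ℙ³
vertexPoint x = record
  { coords = vertexCoords x
  ; unit   = λ ε ε>0 → 0 , λ n _ →
      subst (λ q → ℚ.∣ q ℚ.- 1ℚ ∣ ℚ.< ε) (sym (norm x n)) (∣p-p∣<ε 1ℚ ε>0)
  }
  where
  norm : ∀ x n → seq (∑ (λ i → vertexCoords x i * vertexCoords x i)) n ≡ 1ℚ
  norm (a ∷ b ∷ c ∷ d ∷ []) n
    rewrite ±½-square a | ±½-square b | ±½-square c | ±½-square d = refl

-- For unit vectors u and v with positive inner product, this is the shortest geodesic
-- segment joining [u] and [v]. For x and flip i x the inner product is 1/2.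
Segment : ℙ³ → ℙ³ → PointSet
Segment u v p = ∃₂ λ s t → 0ℝ ≤ s × 0ℝ ≤ t ×
  coords p ≈± (λ i → s * coords u i + t * coords v i)

edgeSegment : Edge → PointSet
edgeSegment (x , i) = Segment (vertexPoint x) (vertexPoint (flip i x))

Realisation : Subgraph → PointSet
Realisation S p = (∃ λ x → Vertices S x × coords p ≈± coords (vertexPoint x))
                ⊎ (∃ λ e → Edges S e × edgeSegment e p)

-- P r S means that S is a face of rank r.
Polytope : Set₁
Polytope = ℤ → Pred Subgraph Level.zero

record Face (P : Polytope) : Set where
  field
    rank   : ℤ
    graph  : Subgraph
    isFace : P rank graph

open Face public

module _ (P : Polytope) where

  FaceLeq FaceEq Comparable : Rel (Face P) Level.zero
  FaceLeq F G = graph F ⊑ graph G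
  FaceEq F G = FaceLeq F G × FaceLeq G F
  Comparable F G = FaceLeq F G ⊎ FaceLeq G F

  infix 4 _∈_ _∉_

  _∈_ _∉_ : Face P → List (Face P) → Set
  F ∈ Φ = Any (FaceEq F) Φ
  F ∉ Φ = ¬ F ∈ Φ

  -- The order and repetitions of the list are irrelevant: only membership is used.
  record Flag : Set where
    field
      faces   : List (Face P)
      chain   : ∀ F G → F ∈ faces → G ∈ faces → Comparable F G
      maximal : ∀ F → (∀ G → G ∈ faces → Comparable F G) → F ∈ faces

  open Flag

  Adjacent : Rel Flag Level.zero
  Adjacent Φ Ψ = ∃₂ λ F G →
      (F ∈ faces Φ × F ∉ faces Ψ)
    × (G ∈ faces Ψ × G ∉ faces Φ)
    × (∀ H → H ∈ faces Φ → FaceEq H F ⊎ H ∈ faces Ψ)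
    × (∀ H → H ∈ faces Ψ → FaceEq H G ⊎ H ∈ faces Φ)

  MapsFace : Isometry → Rel (Face P) Level.zero
  MapsFace g F G = MapsOnto g (Realisation (graph F)) (Realisation (graph G))

  IsSymmetry : Isometry → Set
  IsSymmetry g =
      (∀ F → ∃ λ G → rank G ≡ rank F × MapsFace g F G)
    × (∀ G → ∃ λ F → rank F ≡ rank G × MapsFace g F G)

  MapsFlag : Isometry → Rel Flag Level.zero
  MapsFlag g Φ Ψ =
      (∀ F → F ∈ faces Φ → ∃ λ G → G ∈ faces Ψ × MapsFace g F G)
    × (∀ G → G ∈ faces Ψ → ∃ λ F → F ∈ faces Φ × MapsFace g F G)

  SameOrbit : Rel Flag Level.zero
  SameOrbit Φ Ψ = ∃ λ g → IsSymmetry g × MapsFlag g Φ Ψ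

  ExactlyTwoOrbits : Set
  ExactlyTwoOrbits = ∃₂ λ Φ Ψ →
    ¬ SameOrbit Φ Ψ × (∀ Ω → SameOrbit Φ Ω ⊎ SameOrbit Ψ Ω)

  GeometricallyChiral : Set
  GeometricallyChiral = ExactlyTwoOrbits × (∀ Φ Ψ → Adjacent Φ Ψ → ¬ SameOrbit Φ Ψ)

Colour : Set
Colour = Fin 4

record ChiralColouring : Set where
  field
    colour       : Edge → Colour
    colour-cong  : ∀ {e f} → e ∼ᴱ f → colour e ≡ colour f
    matching     : ∀ a x → ∃! _∼ᴱ_ (λ e → colour e ≡ a × Endpoint e x)
    oneDirection : ∀ a i → ∃! _∼ᴱ_ (λ e → colour e ≡ a × direction e ≡ i)

module _ (c : ChiralColouring) where
  open ChiralColouring c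

  Connected : Subset 4 → Rel Vertex Level.zero
  Connected K = Star λ x y →
    x ∼ y ⊎ ∃ λ i → colour (x , i) ∈ˢ K × y ≡ flip i x

  IsComponent : Subset 4 → Pred Subgraph Level.zero
  IsComponent K S = ∃ λ x →
      Vertices S ≐ Connected K x
    × Edges S ≐ (λ e → colour e ∈ˢ K × Connected K x (proj₁ e))

  data 𝒬 : Polytope where
    least    : ∀ {S} → Vertices S ≐ ∅ → Edges S ≐ ∅ → 𝒬 -[1+ 0 ] S
    vertex   : ∀ {S} x → Vertices S ≐ (_∼ x) → Edges S ≐ ∅ → 𝒬 (+ 0) S
    edge     : ∀ {S} e → Vertices S ≐ Endpoint e → Edges S ≐ (_∼ᴱ e) → 𝒬 (+ 1) S
    twoFace  : ∀ {S} K → ∣ K ∣ ≡ 2 → IsComponent K S → 𝒬 (+ 2) S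
    facet    : ∀ {S} K → ∣ K ∣ ≡ 3 → IsComponent K S → 𝒬 (+ 3) S
    greatest : ∀ {S} → Vertices S ≐ U → Edges S ≐ U → 𝒬 (+ 4) S

facetPolytope : Polytope → Subgraph → Polytope
facetPolytope P F r S = P r S × S ⊑ F

-- nothing is the empty face; just w is the face of the 4-cube on which coordinate i has
-- the sign in w i, or is free if there is none.
CubeFace : Set
CubeFace = Maybe (Vec (Maybe Sign) 4)

VertexOf : CubeFace → Pred Vertex Level.zero
VertexOf nothing  x = ⊥
VertexOf (just w) x = ∀ i → lookup w i ≡ nothing ⊎ lookup w i ≡ just (lookup x i)

CubeLeq : Rel CubeFace Level.zero
CubeLeq F G = ∀ x → VertexOf F x → VertexOf G x

antipodalFace : CubeFace → CubeFace
antipodalFace = Maybe.map (Vec.map (Maybe.map opposite))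

HemiEq HemiLeq : Rel CubeFace Level.zero
HemiEq F G = F ≡ G ⊎ F ≡ antipodalFace G
HemiLeq F G = CubeLeq F G ⊎ CubeLeq F (antipodalFace G)

IsomorphicToHemiHypercube : Polytope → Set
IsomorphicToHemiHypercube P = ∃ λ (f : Face P → CubeFace) →
  IsOrderIsomorphism (FaceEq P) HemiEq (FaceLeq P) HemiLeq f

{-# OPTIONS --safe #-}

-- Let φ permute the last three coordinates of the vertices with an even number of minus signs
-- cyclically and fix the other vertices.  Up to renaming the colours, a chiral colouring gives
-- to each edge the direction of its image under φ or under φ⁻¹.  Hence φ carries the components
-- of the subgraph with colours K to the faces of the 4-cube with free coordinates K, which
-- yields the isomorphism with the hemi-hypercube.
--
-- An isometry permuting the points [x] is given by a signed permutation matrix, because its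
-- columns are differences of two vertex vectors.  A finite check shows that a signed
-- permutation mapping one colour class onto a colour class permutes all colour classes, and
-- that the sign of this permutation ρ of the colours is the product of the signs of the matrix.
-- A flag amounts to a vertex x and the order σ in which the colours enter its faces; by the
-- above, symmetries preserve the product of the coordinates of x and the sign of σ, whereas
-- adjacent flags have opposite products.  Conversely, whenever the signs agree, a second finite
-- check provides a symmetry with prescribed image of the vertex and permutation of the colours.
-- A facet omits one colour, so that its flags are those of 𝒬 whose order ends with that colour,
-- and its symmetries preserve the omitted class; hence the same argument applies to it.

module Submission where

open import Defs
open import Data.Bool.Base using (Bool; true; false; not; T; if_then_else_)
import Data.Bool.Properties as Bool
open import Data.Empty using (⊥-elim)
open import Data.Fin.Base as Fin using (Fin; zero; suc)
open import Data.Fin.Patterns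
open import Data.Fin.Permutation using (permutation)
open import Data.Fin.Properties as Fin using (all?; any?; _≟_)
open import Data.Fin.Subset as Subset using (Subset; ∣_∣; ⁅_⁆; _⊆_) renaming (_∈_ to _∈ˢ_)
open import Data.Fin.Subset.Properties
  using ( ∉⊥; ∈⊤; x∈⁅x⁆; x∈⁅y⁆⇒x≡y; ∣⁅x⁆∣≡1; ⊆-antisym; ⊆⊤; ⊥⊆
        ; x∈∁p⇒x∉p; x∉p⇒x∈∁p; _⊆?_)
  renaming (_∈?_ to _∈ˢ?_)
open import Data.Integer.Base using (+_; -[1+_])
import Data.Integer.Properties as ℤ
open import Data.List.Base as List using (List; []; _∷_)
import Data.List.Membership.Propositional as ∈ˡ
import Data.List.Membership.Propositional.Properties as List
open import Data.List.Relation.Unary.Any as Any using (here; there)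
import Data.List.Relation.Unary.Any.Properties as Any
open import Data.Maybe.Base as Maybe using (Maybe; just; nothing)
open import Data.Maybe.Properties using (just-injective)
open import Data.Nat.Base as ℕ using (ℕ)
import Data.Nat.Properties as ℕ
open import Data.Product using (∃; ∃₂; _×_; _,_; proj₁; proj₂) renaming (map₂ to map₂′)
open import Data.Rational.Base as ℚ using (ℚ; 0ℚ; 1ℚ; ½)
import Data.Rational.Properties as ℚ
open import Algebra.Properties.CommutativeMonoid.Sum ℚ.+-0-commutativeMonoid using (sum-permute)
open import Algebra.Properties.Group (ℚ.+-0-group) using (x∙y⁻¹≈ε⇒x≈y)
open import Data.Rational.Solver using (module +-*-Solver)
open import Data.Sign.Base as Sign using (Sign)
import Data.Sign.Properties as Sign
open import Data.Sum.Base as Sum using (_⊎_; inj₁; inj₂; [_,_]′; map₁; map₂)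
open import Data.Unit.Base using (tt)
open import Data.Vec.Base as Vec using (Vec; []; _∷_; lookup; tabulate; zipWith)
import Data.Vec.Properties as Vec
open import Function.Base using (_∘_)
open import Function.Bundles using (mk⇔)
open import Level using (0ℓ)
open import Relation.Binary.Bundles using (Setoid)
open import Relation.Binary.Construct.Closure.ReflexiveTransitive as Star
  using (Star; _◅_; _◅◅_)
open import Relation.Binary.Definitions using (tri<; tri≈; tri>)
open import Relation.Binary.PropositionalEquality
import Relation.Binary.Reasoning.Setoid as SetoidReasoning
open import Relation.Nullary.Decidable hiding (⌊_⌋)
open import Relation.Nullary.Negation using (¬_; contradiction)
open import Relation.Unary using (Pred; Decidable; _≐_; ∅; U)

-- Exhaustive search

-- Any permutation of the even vertices alone is an automorphism of `K_{4,4}`, and `φ α` is one of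
-- the two 3-cycles of the four even points [x] that fix [`x₀`]. It respects all incidences, whence
-- the isomorphism, but it is not induced by an isometry; so a combinatorial symmetry of 𝒬 need not
-- be geometric, and only half of them are. Equality and order of Cauchy reals are undecidable, so
-- no case distinction is made on the value of a real number. Isometries are brought down to finite
-- data through rational test points, namely the vertex points and one interior point of each edge,
-- where equality of limits becomes equality of rationals. What remains concerns finitely many
-- signs, permutations and colour sets and is decided by exhaustive search. The costly functions
-- evaluated there and the results are opaque, so that they are unfolded only inside the checks. 𝒬
-- and its facets are treated at once, as polytopes whose faces other than the least one are the
-- components for all colour sets below a fixed set `top`.

Exhaustible : Set → Set₁
Exhaustible A = ∀ {P : Pred A 0ℓ} → Decidable P → Dec (∀ a → P a)

bools? : Exhaustible Bool
bools? P? = map′ (λ { (p , q) true → p ; (p , q) false → q }) (λ f → f true , f false)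
                 (P? true ×-dec P? false)

signs? : Exhaustible Sign
signs? P? = map′ (λ { (p , q) Sign.+ → p ; (p , q) Sign.- → q })
                 (λ f → f Sign.+ , f Sign.-) (P? Sign.+ ×-dec P? Sign.-)

vecs? : ∀ {A n} → Exhaustible A → Exhaustible (Vec A n)
vecs? {n = ℕ.zero}  A? P? = map′ (λ { p [] → p }) (λ f → f []) (P? [])
vecs? {n = ℕ.suc n} A? P? =
  map′ (λ { f (a ∷ v) → f a v }) (λ f a v → f (a ∷ v))
       (A? λ a → vecs? A? λ v → P? (a ∷ v))

vertices? : Exhaustible Vertex
vertices? = vecs? signs?

_≟ⱽ_ : (x y : Vertex) → Dec (x ≡ y)
_≟ⱽ_ = Vec.≡-dec Sign._≟_

_∼?_ : (x y : Vertex) → Dec (x ∼ y)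
x ∼? y = (x ≟ⱽ y) ⊎-dec (x ≟ⱽ antipode y)

-- The two model colourings

parity : Vertex → Sign
parity = Vec.foldr′ Sign._*_ Sign.+

rotate : Bool → Vertex → Vertex
rotate true  (a ∷ b ∷ c ∷ d ∷ []) = a ∷ c ∷ d ∷ b ∷ []
rotate false (a ∷ b ∷ c ∷ d ∷ []) = a ∷ d ∷ b ∷ c ∷ []

opaque
  -- The two values of α correspond to the two chiral colourings; the edges coloured a are
  -- those that φ α maps to edges of direction a.
  φ : Bool → Vertex → Vertex
  φ α x with parity x
  ... | Sign.+ = rotate α x
  ... | Sign.- = x

  -- The i for which the vertex is ∼ flip i of (+ , + , + , +); arbitrary on even vertices.
  oddOneOut : Vertex → Fin 4
  oddOneOut (a ∷ b ∷ c ∷ d ∷ []) with a Sign.* b | a Sign.* c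
  ... | Sign.+ | Sign.+ = 3F
  ... | Sign.+ | Sign.- = 2F
  ... | Sign.- | Sign.+ = 1F
  ... | Sign.- | Sign.- = 0F

  -- Up to antipode the two images differ in one coordinate `j`; their coordinatewise product is
  -- then `∼ flip j x₀`, from which `oddOneOut` reads off `j`.
  model : Bool → Edge → Fin 4
  model α (x , i) = oddOneOut (zipWith Sign._*_ (φ α x) (φ α (flip i x)))

  -- As `φ (not α)` inverts `φ α`, this is the direction of the edge at `x` whose image is the edge
  -- at `φ α x` in direction `a`.
  dir : Bool → Vertex → Fin 4 → Fin 4
  dir α x a = oddOneOut (zipWith Sign._*_ x (φ (not α) (flip a (φ α x))))

  φ-flip : ∀ α x i → φ α (flip i x) ∼ flip (model α (x , i)) (φ α x)
  φ-flip = toWitness {a? = bools? λ α → vertices? λ x → all? λ i → _ ∼? _} tt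

  φ-φ : ∀ α x → φ α (φ (not α) x) ≡ x
  φ-φ = toWitness {a? = bools? λ α → vertices? λ x → _ ≟ⱽ _} tt

  φ-antipode : ∀ α x → φ α (antipode x) ≡ antipode (φ α x)
  φ-antipode = toWitness {a? = bools? λ α → vertices? λ x → _ ≟ⱽ _} tt

  parity-φ : ∀ α x → parity (φ α x) ≡ parity x
  parity-φ = toWitness {a? = bools? λ α → vertices? λ x → _ Sign.≟ _} tt

  model-antipode : ∀ α x i → model α (antipode x , i) ≡ model α (x , i)
  model-antipode = toWitness {a? = bools? λ α → vertices? λ x → all? λ i → _ ≟ _} tt

  model-flip : ∀ α x i → model α (flip i x , i) ≡ model α (x , i)
  model-flip = toWitness {a? = bools? λ α → vertices? λ x → all? λ i → _ ≟ _} tt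

  model-dir : ∀ α x a → model α (x , dir α x a) ≡ a
  model-dir = toWitness {a? = bools? λ α → vertices? λ x → all? λ i → _ ≟ _} tt

  dir-model : ∀ α x i → dir α x (model α (x , i)) ≡ i
  dir-model = toWitness {a? = bools? λ α → vertices? λ x → all? λ i → _ ≟ _} tt

-- Permutations of four elements

Map : Set
Map = Vec (Fin 4) 4

maps? : Exhaustible Map
maps? = vecs? all?

_≟ᴹ_ : (σ τ : Map) → Dec (σ ≡ τ)
_≟ᴹ_ = Vec.≡-dec _≟_

_⊙_ : Map → Map → Map
σ ⊙ τ = Vec.map (lookup σ) τ

ι : Map
ι = Vec.allFin 4

opaque
  position : ∀ {n} → Vec (Fin 4) n → Fin 4 → Fin (ℕ.suc n)
  position []      a = zero
  position (b ∷ v) a with a ≟ b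
  ... | yes _ = zero
  ... | no  _ = suc (position v a)

  -- The last value of σ is attained exactly where the first three are not.
  inverse : Map → Map
  inverse (a ∷ b ∷ c ∷ _ ∷ []) = tabulate (position (a ∷ b ∷ c ∷ []))

-- A single equation between vectors, cheap to decide in each of the many searches over
-- permutations; it amounts to injectivity.
IsPerm : Map → Set
IsPerm σ = σ ⊙ inverse σ ≡ ι

isPerm? : Decidable IsPerm
isPerm? σ = (σ ⊙ inverse σ) ≟ᴹ ι

perms? : ∀ {P : Pred Map 0ℓ} → Decidable P → Dec (∀ σ → IsPerm σ → P σ)
perms? P? = maps? λ σ → isPerm? σ →-dec P? σ

Injective : Map → Set
Injective σ = ∀ i j → lookup σ i ≡ lookup σ j → i ≡ j

injective? : Decidable Injective
injective? σ = all? λ i → all? λ j → (_ ≟ _) →-dec (_ ≟ _)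

opaque
  unfolding inverse

  injective⇒perm : ∀ σ → Injective σ → IsPerm σ
  injective⇒perm = toWitness {a? = maps? λ σ → injective? σ →-dec isPerm? σ} tt

opaque
  unfolding inverse

  perm⇒injective : ∀ σ → IsPerm σ → Injective σ
  perm⇒injective = toWitness {a? = perms? injective?} tt

opaque
  unfolding inverse

  inverse-left : ∀ σ → IsPerm σ → inverse σ ⊙ σ ≡ ι
  inverse-left = toWitness {a? = perms? λ σ → _ ≟ᴹ _} tt

opaque
  pairSign : Fin 4 → Fin 4 → Sign
  pairSign i j with i Fin.<? j
  ... | yes _ = Sign.+
  ... | no  _ = Sign.-

  -- The usual sign of a permutation, computed from its inversions.
  sgn : Map → Sign
  sgn (a ∷ b ∷ c ∷ d ∷ []) =
    pairSign a b Sign.* pairSign a c Sign.* pairSign a d Sign.*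
    pairSign b c Sign.* pairSign b d Sign.* pairSign c d

opaque
  unfolding sgn inverse

  sgn-⊙ : ∀ σ → IsPerm σ → ∀ τ → IsPerm τ → sgn (σ ⊙ τ) ≡ sgn σ Sign.* sgn τ
  sgn-⊙ = toWitness {a? = perms? λ σ → perms? λ τ → _ Sign.≟ _} tt

lookup-⊙ : ∀ σ τ i → lookup (σ ⊙ τ) i ≡ lookup σ (lookup τ i)
lookup-⊙ σ τ i = Vec.lookup-map i (lookup σ) τ

⊙-perm : ∀ σ → IsPerm σ → ∀ τ → IsPerm τ → IsPerm (σ ⊙ τ)
⊙-perm σ pσ τ pτ = injective⇒perm (σ ⊙ τ) λ i j eq →
  perm⇒injective τ pτ i j (perm⇒injective σ pσ _ _
    (trans (sym (lookup-⊙ σ τ i)) (trans eq (lookup-⊙ σ τ j))))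

-- Signed permutations acting on the model colourings

x₀ : Vertex
x₀ = Sign.+ ∷ Sign.+ ∷ Sign.+ ∷ Sign.+ ∷ []

even : Fin 4 → Vertex
even 0F = x₀
even 1F = Sign.+ ∷ Sign.+ ∷ Sign.- ∷ Sign.- ∷ []
even 2F = Sign.+ ∷ Sign.- ∷ Sign.+ ∷ Sign.- ∷ []
even 3F = Sign.+ ∷ Sign.- ∷ Sign.- ∷ Sign.+ ∷ []

opaque
  act : Vertex → Map → Vertex → Vertex
  act y τ x = zipWith Sign._*_ y (tabulate λ i → lookup x (lookup (inverse τ) i))

induced : Bool → Vertex → Map → Map
induced α y τ = tabulate λ i → model α (y , lookup τ i)

-- Every edge has an even endpoint, so the sixteen pairs (`even k` , `i`) represent all edges of Γ.
Preserves : Bool → Vertex → Map → Map → Set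
Preserves α y τ σ = ∀ k i → model α (act y τ (even k) , lookup τ i) ≡ lookup σ (model α (even k , i))

PreservesClass : Bool → Vertex → Map → Map → Fin 4 → Set
PreservesClass α y τ σ a = ∀ k → model α (act y τ (even k) , lookup τ (dir α (even k) a)) ≡ lookup σ a

-- The edges at x₀ have colours 0F, …, 3F, so that induced is the only candidate for the
-- permutation of the colours.
opaque
  unfolding model inverse sgn act

  rigid : ∀ τ → IsPerm τ → ∀ y α →
      sgn (induced α y τ) ≡ parity y × Preserves α y τ (induced α y τ)
    ⊎ ∀ a → ¬ PreservesClass α y τ (induced α y τ) a
  rigid = toWitness {a? = perms? λ τ → vertices? λ y → bools? λ α →
    ((sgn (induced α y τ) Sign.≟ parity y) ×-dec all? λ k → all? λ i → _ ≟ _)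
    ⊎-dec all? λ a → ¬? (all? λ k → _ ≟ _)} tt

directions : Bool → Vertex → Map → Map
directions α y ρ = tabulate λ i → dir α y (lookup ρ i)

opaque
  unfolding model inverse sgn act

  realisable : ∀ ρ → IsPerm ρ → ∀ y α → parity y ≡ sgn ρ → Preserves α y (directions α y ρ) ρ
  realisable = toWitness {a? = perms? λ ρ → vertices? λ y → bools? λ α → (_ Sign.≟ _) →-dec
     (all? λ k → all? λ i → _ ≟ _)} tt

-- The edge at even l that leads to the other endpoint of the edge (even k , i).
meet : Fin 4 → Fin 4 → Fin 4 → Fin 4
meet k l i = oddOneOut (zipWith Sign._*_ (even l) (flip i (even k)))

-- `r` and `s` list the colours at `even k` and `even l` by direction. Edges in the same direction
-- have different colours because a class has one edge per direction, and edges with a common odd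
-- endpoint because classes are matchings.
Compatible : Fin 4 → Map → Fin 4 → Map → Set
Compatible k r l s = ∀ i → lookup r i ≢ lookup s i × lookup r i ≢ lookup s (meet k l i)

compatible? : ∀ k r l s → Dec (Compatible k r l s)
compatible? k r l s = all? λ i → ¬? (_ ≟ _) ×-dec ¬? (_ ≟ _)

row : Bool → Fin 4 → Map
row α k = tabulate λ i → model α (even k , i)

IsModel : Map → Map → Map → Bool → Set
IsModel r s t α = r ≡ row α 1F × s ≡ row α 2F × t ≡ row α 3F

opaque
  unfolding model

  -- Renaming the colours turns row `0F` into `ι`. Hypotheses alternate with quantifiers so that the
  -- search drops a row at its first conflict instead of visiting all `256 ^ 3` triples of rows.
  two-models : ∀ r → Compatible 0F ι 1F r → ∀ s → Compatible 0F ι 2F s → Compatible 1F r 2F s →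
    ∀ t → Compatible 0F ι 3F t → Compatible 1F r 3F t → Compatible 2F s 3F t →
    IsModel r s t true ⊎ IsModel r s t false
  two-models = toWitness {a? =
    maps? λ r → compatible? 0F ι 1F r →-dec
    maps? λ s → compatible? 0F ι 2F s →-dec (compatible? 1F r 2F s →-dec
    maps? λ t → compatible? 0F ι 3F t →-dec (compatible? 1F r 3F t →-dec (compatible? 2F s 3F t →-dec
    (isModel? r s t true ⊎-dec isModel? r s t false))))} tt
    where
    isModel? : ∀ r s t α → Dec (IsModel r s t α)
    isModel? r s t α = (_ ≟ᴹ _) ×-dec (_ ≟ᴹ _) ×-dec (_ ≟ᴹ _)

opaque
  unfolding model

  meet-flip : ∀ k l i → k ≢ l → flip i (even k) ∼ flip (meet k l i) (even l)
  meet-flip = toWitness {a? = all? λ k → all? λ l → all? λ i → ¬? (k ≟ l) →-dec (_ ∼? _)} tt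

opaque
  unfolding model

  -- One endpoint of every edge is even, and `even` lists the even vertices up to antipode.
  even-cover : ∀ x i → ∃ λ k → (x , i) ∼ᴱ (even k , i)
  even-cover = toWitness {a? = vertices? λ x → all? λ i → any? λ k → (i ≟ i) ×-dec
     ((x ∼? even k) ⊎-dec (x ∼? flip i (even k)))} tt

-- Classification of the chiral colourings

opaque
  antipode-antipode : ∀ x → antipode (antipode x) ≡ x
  antipode-antipode = toWitness {a? = vertices? λ x → _ ≟ⱽ _} tt

opaque
  flip-flip : ∀ i x → flip i (flip i x) ≡ x
  flip-flip = toWitness {a? = all? λ i → vertices? λ x → _ ≟ⱽ _} tt

opaque
  flip-antipode : ∀ i x → flip i (antipode x) ≡ antipode (flip i x)
  flip-antipode = toWitness {a? = all? λ i → vertices? λ x → _ ≟ⱽ _} tt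

∼-refl : ∀ {x} → x ∼ x
∼-refl = inj₁ refl

∼-sym : ∀ {x y} → x ∼ y → y ∼ x
∼-sym (inj₁ refl) = inj₁ refl
∼-sym {y = y} (inj₂ refl) = inj₂ (sym (antipode-antipode y))

∼-trans : ∀ {x y z} → x ∼ y → y ∼ z → x ∼ z
∼-trans (inj₁ refl) q = q
∼-trans (inj₂ refl) (inj₁ refl) = inj₂ refl
∼-trans {z = z} (inj₂ refl) (inj₂ refl) = inj₁ (antipode-antipode z)

flip-cong : ∀ i {x y} → x ∼ y → flip i x ∼ flip i y
flip-cong i (inj₁ refl) = inj₁ refl
flip-cong i {y = y} (inj₂ refl) = inj₂ (flip-antipode i y)

flip-sym : ∀ i {x y} → x ∼ flip i y → y ∼ flip i x
flip-sym i {x} {y} p = ∼-sym (subst (flip i x ∼_) (flip-flip i y) (flip-cong i p))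

∼ᴱ-sym : ∀ {e f} → e ∼ᴱ f → f ∼ᴱ e
∼ᴱ-sym (refl , inj₁ p) = refl , inj₁ (∼-sym p)
∼ᴱ-sym {_ , i} (refl , inj₂ p) = refl , inj₂ (flip-sym i p)

∼ᴱ-trans : ∀ {e f g} → e ∼ᴱ f → f ∼ᴱ g → e ∼ᴱ g
∼ᴱ-trans (refl , inj₁ p) (refl , inj₁ q) = refl , inj₁ (∼-trans p q)
∼ᴱ-trans (refl , inj₁ p) (refl , inj₂ q) = refl , inj₂ (∼-trans p q)
∼ᴱ-trans {_ , i} (refl , inj₂ p) (refl , inj₁ q) = refl , inj₂ (∼-trans p (flip-cong i q))
∼ᴱ-trans {x , i} {y , _} {z , _} (refl , inj₂ p) (refl , inj₂ q) =
  refl , inj₁ (∼-trans p (∼-sym (flip-sym i q)))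

model-cong : ∀ α {e f} → e ∼ᴱ f → model α e ≡ model α f
model-cong α (refl , inj₁ (inj₁ refl)) = refl
model-cong α {_ , i} {y , _} (refl , inj₁ (inj₂ refl)) = model-antipode α y i
model-cong α {_ , i} {y , _} (refl , inj₂ (inj₁ refl)) = model-flip α y i
model-cong α {_ , i} {y , _} (refl , inj₂ (inj₂ refl)) =
  trans (model-antipode α (flip i y) i) (model-flip α y i)

φ-cong : ∀ α {x y} → x ∼ y → φ α x ∼ φ α y
φ-cong α (inj₁ refl) = inj₁ refl
φ-cong α {y = y} (inj₂ refl) = inj₂ (φ-antipode α y)

opaque
  unfolding model

  model-x₀ : ∀ α i → model α (x₀ , i) ≡ i
  model-x₀ = toWitness {a? = bools? λ α → all? λ i → _ ≟ _} tt

opaque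
  even-apart : ∀ k l j → k ≢ l → ¬ Endpoint (even l , j) (even k)
  even-apart = toWitness {a? = all? λ k → all? λ l → all? λ j → ¬? (k ≟ l) →-dec
    ¬? ((even k ∼? even l) ⊎-dec (even k ∼? flip j (even l)))} tt

record IsModelled (c : ChiralColouring) : Set where
  open ChiralColouring c
  field
    α     : Bool
    π π⁻¹ : Fin 4 → Fin 4
    π-π⁻¹ : ∀ a → π (π⁻¹ a) ≡ a
    π⁻¹-π : ∀ a → π⁻¹ (π a) ≡ a
    colour-model : ∀ e → colour e ≡ π (model α e)

module Classification (c : ChiralColouring) where
  open ChiralColouring c

  private
    same-direction : ∀ {e f} → colour e ≡ colour f → direction e ≡ direction f → e ∼ᴱ f
    same-direction {e} {f} p q with oneDirection (colour f) (direction f)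
    ... | _ , _ , unique = ∼ᴱ-trans (∼ᴱ-sym (unique (p , q))) (unique (refl , refl))

    same-endpoint : ∀ {e f} x → colour e ≡ colour f → Endpoint e x → Endpoint f x → e ∼ᴱ f
    same-endpoint {e} {f} x p q r with matching (colour f) x
    ... | _ , _ , unique = ∼ᴱ-trans (∼ᴱ-sym (unique (p , q))) (unique (refl , r))

    π : Fin 4 → Fin 4
    π i = colour (x₀ , i)

    π⁻¹ : Fin 4 → Fin 4
    π⁻¹ a = direction (proj₁ (matching a x₀))

    π-π⁻¹ : ∀ a → π (π⁻¹ a) ≡ a
    π-π⁻¹ a with matching a x₀
    ... | e , (p , q) , _ = trans (colour-cong (refl , q)) p

    π-injective : ∀ i j → π i ≡ π j → i ≡ j
    π-injective i j p =
      proj₁ (same-endpoint {x₀ , i} {x₀ , j} x₀ p (inj₁ ∼-refl) (inj₁ ∼-refl))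

    -- The colours renamed so that the edge at `x₀` in direction `i` receives `i`, as it does in
    -- both models.
    D : Edge → Fin 4
    D e = π⁻¹ (colour e)

    D-colour : ∀ e f → D e ≡ D f → colour e ≡ colour f
    D-colour e f p = trans (sym (π-π⁻¹ (colour e))) (trans (cong π p) (π-π⁻¹ (colour f)))

    D-x₀ : ∀ i → D (x₀ , i) ≡ i
    D-x₀ i = π-injective _ _ (π-π⁻¹ (π i))

    rowᴰ : Fin 4 → Map
    rowᴰ k = tabulate λ i → D (even k , i)

    row₀ : rowᴰ 0F ≡ ι
    row₀ = Vec.tabulate-cong D-x₀

    compatible : ∀ k l → k ≢ l → Compatible k (rowᴰ k) l (rowᴰ l)
    compatible k l k≢l i =
        (λ p → even-apart k l i k≢l (proj₂ (same-direction
          (D-colour (even k , i) (even l , i) (unrow i i p)) refl)))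
      , (λ p → even-apart k l (meet k l i) k≢l (proj₂ (same-endpoint (flip i (even k))
          (D-colour (even k , i) (even l , meet k l i) (unrow i (meet k l i) p))
          (inj₂ ∼-refl) (inj₂ (meet-flip k l i k≢l)))))
      where
      unrow : ∀ i j → lookup (rowᴰ k) i ≡ lookup (rowᴰ l) j → D (even k , i) ≡ D (even l , j)
      unrow i j p = trans (sym (Vec.lookup∘tabulate (λ i → D (even k , i)) i))
                          (trans p (Vec.lookup∘tabulate (λ i → D (even l , i)) j))

    Modelled : Bool → Set
    Modelled α = ∀ e → colour e ≡ π (model α e)

    modelled : ∀ α → IsModel (rowᴰ 1F) (rowᴰ 2F) (rowᴰ 3F) α → Modelled α
    modelled α (r , s , t) e@(x , i) with even-cover x i
    ... | k , e∼ = begin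
      colour e            ≡⟨ π-π⁻¹ (colour e) ⟨
      π (D e)             ≡⟨ cong (λ a → π (π⁻¹ a)) (colour-cong e∼) ⟩
      π (D (even k , i))  ≡⟨ cong π (entry k) ⟩
      π (model α (even k , i)) ≡⟨ cong π (model-cong α e∼) ⟨
      π (model α e)           ∎
      where
      open ≡-Reasoning
      read : ∀ k → rowᴰ k ≡ row α k → D (even k , i) ≡ model α (even k , i)
      read k p = trans (sym (Vec.lookup∘tabulate (λ i → D (even k , i)) i))
        (trans (cong (λ v → lookup v i) p) (Vec.lookup∘tabulate (λ i → model α (even k , i)) i))
      entry : ∀ k → D (even k , i) ≡ model α (even k , i)
      entry 0F = trans (D-x₀ i) (sym (model-x₀ α i))
      entry 1F = read 1F r
      entry 2F = read 2F s
      entry 3F = read 3F t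

    classified : Modelled true ⊎ Modelled false
    classified = Sum.map (modelled true) (modelled false)
      (two-models (rowᴰ 1F) (from₀ 1F λ ()) (rowᴰ 2F) (from₀ 2F λ ()) (compatible 1F 2F λ ())
        (rowᴰ 3F) (from₀ 3F λ ()) (compatible 1F 3F λ ()) (compatible 2F 3F λ ()))
      where
      from₀ : ∀ l → 0F ≢ l → Compatible 0F ι l (rowᴰ l)
      from₀ l p = subst (λ r → Compatible 0F r l (rowᴰ l)) row₀ (compatible 0F l p)

  isModelled : IsModelled c
  isModelled with classified
  ... | inj₁ m = record { α = true ; π = π ; π⁻¹ = π⁻¹ ; π-π⁻¹ = π-π⁻¹ ; π⁻¹-π = D-x₀
                        ; colour-model = m }
  ... | inj₂ m = record { α = false ; π = π ; π⁻¹ = π⁻¹ ; π-π⁻¹ = π-π⁻¹ ; π⁻¹-π = D-x₀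
                        ; colour-model = m }

-- Components of coloured subgraphs

ext : ∀ {A : Set} {n} {v w : Vec A n} → (∀ i → lookup v i ≡ lookup w i) → v ≡ w
ext {v = v} {w} p =
  trans (sym (Vec.tabulate∘lookup v)) (trans (Vec.tabulate-cong p) (Vec.tabulate∘lookup w))

lookup-antipode : ∀ a x → lookup (antipode x) a ≡ Sign.opposite (lookup x a)
lookup-antipode a x = Vec.lookup-map a Sign.opposite x

φ-injective : ∀ α {x y} → φ α x ∼ φ α y → x ∼ y
φ-injective α {x} {y} p = subst₂ _∼_ (inv x) (inv y) (φ-cong (not α) p)
  where
  inv : ∀ z → φ (not α) (φ α z) ≡ z
  inv z = subst (λ β → φ (not α) (φ β z) ≡ z) (Bool.not-involutive α) (φ-φ (not α) z)

-- `z` and `w` lie on a common face of the 4-cube with free coordinates `K`; `Joined` is the same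
-- relation in the quotient by the central inversion.
record Agree (K : Subset 4) (z w : Vertex) : Set where
  constructor agree
  field at : ∀ a → a ∈ˢ K ⊎ lookup z a ≡ lookup w a

open Agree public

data Joined (K : Subset 4) (z w : Vertex) : Set where
  same     : Agree K z w → Joined K z w
  opposite : Agree K z (antipode w) → Joined K z w

joined? : ∀ K z w → Dec (Joined K z w)
joined? K z w = map′ [ same , opposite ]′
  (λ { (same p) → inj₁ p ; (opposite p) → inj₂ p }) (agree? w ⊎-dec agree? (antipode w))
  where
  agree? : ∀ w → Dec (Agree K z w)
  agree? w = map′ agree at (all? λ a → (a ∈ˢ? K) ⊎-dec (lookup z a Sign.≟ lookup w a))

agree-refl : ∀ {K z} → Agree K z z
agree-refl .at a = inj₂ refl

agree-sym : ∀ {K z w} → Agree K z w → Agree K w z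
agree-sym p .at a = map₂ sym (at p a)

agree-trans : ∀ {K z w v} → Agree K z w → Agree K w v → Agree K z v
agree-trans p q .at a with at p a | at q a
... | inj₁ r | _      = inj₁ r
... | inj₂ _ | inj₁ s = inj₁ s
... | inj₂ r | inj₂ s = inj₂ (trans r s)

agree-antipode : ∀ {K z w} → Agree K z w → Agree K (antipode z) (antipode w)
agree-antipode {z = z} {w} p .at a = map₂
  (λ q → trans (lookup-antipode a z) (trans (cong Sign.opposite q) (sym (lookup-antipode a w))))
  (at p a)

antipode-swap : ∀ {K z w} → Agree K z (antipode w) → Agree K (antipode z) w
antipode-swap {K} {z} {w} p =
  subst (Agree K (antipode z)) (antipode-antipode w) (agree-antipode p)

joined-refl : ∀ {K z} → Joined K z z
joined-refl = same agree-refl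

joined-sym : ∀ {K z w} → Joined K z w → Joined K w z
joined-sym (same p)     = same (agree-sym p)
joined-sym (opposite p) = opposite (agree-sym (antipode-swap p))

joined-trans : ∀ {K z w v} → Joined K z w → Joined K w v → Joined K z v
joined-trans (same p)     (same q)     = same (agree-trans p q)
joined-trans (same p)     (opposite q) = opposite (agree-trans p q)
joined-trans (opposite p) (same q)     = opposite (agree-trans p (agree-antipode q))
joined-trans (opposite p) (opposite q) = same (agree-trans p (antipode-swap q))

agree-mono : ∀ {K L z w} → K ⊆ L → Agree K z w → Agree L z w
agree-mono K⊆L p .at a = map₁ K⊆L (at p a)

joined-mono : ∀ {K L z w} → K ⊆ L → Joined K z w → Joined L z w
joined-mono K⊆L (same p)     = same (agree-mono K⊆L p)
joined-mono K⊆L (opposite p) = opposite (agree-mono K⊆L p)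

∼⇒joined : ∀ {K z w} → z ∼ w → Joined K z w
∼⇒joined (inj₁ refl) = same agree-refl
∼⇒joined (inj₂ refl) = opposite agree-refl

agree-⊥ : ∀ {z w} → Agree Subset.⊥ z w → z ≡ w
agree-⊥ p = ext λ a → [ (λ q → contradiction q ∉⊥) , (λ q → q) ]′ (at p a)

joined-⊥⇒∼ : ∀ {z w} → Joined Subset.⊥ z w → z ∼ w
joined-⊥⇒∼ (same p)     = inj₁ (agree-⊥ p)
joined-⊥⇒∼ (opposite p) = inj₂ (agree-⊥ p)

joined-⊤ : ∀ {z w} → Joined Subset.⊤ z w
joined-⊤ = same (agree λ _ → inj₁ ∈⊤)

agree-flip : ∀ {K} a z → a ∈ˢ K → Agree K z (flip a z)
agree-flip a z a∈K .at b with b ≟ a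
... | yes refl = inj₁ a∈K
... | no b≢a   = inj₂ (sym (Vec.lookup∘updateAt′ b a b≢a z))

agree-⁅⁆ : ∀ {a z w} → Agree ⁅ a ⁆ z w → w ≡ z ⊎ w ≡ flip a z
agree-⁅⁆ {a} {z} {w} p = decide a z w λ b → map₁ (x∈⁅y⁆⇒x≡y a) (at p b)
  where
  opaque
    decide : ∀ a z w → (∀ b → b ≡ a ⊎ lookup z b ≡ lookup w b) → w ≡ z ⊎ w ≡ flip a z
    decide = toWitness {a? = all? λ a → vertices? λ z → vertices? λ w →
      (all? λ b → (b ≟ a) ⊎-dec (_ Sign.≟ _)) →-dec ((w ≟ⱽ z) ⊎-dec (w ≟ⱽ flip a z))} tt

joined-⁅⁆ : ∀ {a z w} → Joined ⁅ a ⁆ z w → w ∼ z ⊎ w ∼ flip a z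
joined-⁅⁆ (same p) with agree-⁅⁆ p
... | inj₁ q = inj₁ (inj₁ q)
... | inj₂ q = inj₂ (inj₁ q)
joined-⁅⁆ {a} {z} {w} (opposite p) with agree-⁅⁆ p
... | inj₁ q = inj₁ (∼-sym (inj₂ (sym q)))
... | inj₂ q = inj₂ (∼-sym (inj₂ (sym q)))

module Coloured (α : Bool) where

  Conn : Subset 4 → Vertex → Vertex → Set
  Conn K = Star λ x y → x ∼ y ⊎ ∃ λ i → model α (x , i) ∈ˢ K × y ≡ flip i x

  Near : Subset 4 → Vertex → Vertex → Set
  Near K x y = Joined K (φ α x) (φ α y)

  near-flip : ∀ {K} x i → model α (x , i) ∈ˢ K → Near K x (flip i x)
  near-flip x i m =
    joined-trans (same (agree-flip _ (φ α x) m)) (∼⇒joined (∼-sym (φ-flip α x i)))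

  ∼⇒near : ∀ {K x y} → x ∼ y → Near K x y
  ∼⇒near p = ∼⇒joined (φ-cong α p)

  conn⇒near : ∀ {K x y} → Conn K x y → Near K x y
  conn⇒near Star.ε = joined-refl
  conn⇒near (inj₁ p ◅ ps) = joined-trans (∼⇒near p) (conn⇒near ps)
  conn⇒near (_◅_ {i = x} (inj₂ (i , m , refl)) ps) =
    joined-trans (near-flip x i m) (conn⇒near ps)

  ψ : Vertex → Vertex
  ψ = φ (not α)

  φ-ψ : ∀ z → φ α (ψ z) ≡ z
  φ-ψ = φ-φ α

  ψ-φ : ∀ x → ψ (φ α x) ≡ x
  ψ-φ x = subst (λ β → ψ (φ β x) ≡ x) (Bool.not-involutive α) (φ-φ (not α) x)

  φ-dir : ∀ x a → φ α (flip (dir α x a) x) ∼ flip a (φ α x)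
  φ-dir x a = subst (λ b → φ α (flip (dir α x a) x) ∼ flip b (φ α x)) (model-dir α x a)
                    (φ-flip α x (dir α x a))

  -- From `φ α x` to `φ α y` one coordinate is corrected at a time. A coordinate that changes lies
  -- in `K`, and under `ψ` its change becomes an edge of that colour.
  near⇒conn : ∀ {K x y} → Near K x y → Conn K x y
  near⇒conn {K} {x} {y} = λ
    { (same p) → subst₂ (Conn K) (ψ-φ x) (ψ-φ y) (walk _ _ p)
    ; (opposite p) → subst₂ (Conn K) (ψ-φ x) refl (walk _ _ p)
                 ◅◅ inj₁ (φ-injective α (inj₂ (φ-ψ (antipode (φ α y))))) ◅ Star.ε }
    where
    Walk : Vertex → Vertex → Set
    Walk z w = Conn K (ψ z) (ψ w)
    along : ∀ a z → a ∈ˢ K → Walk z (flip a z)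
    along a z m =
      inj₂ (dir α (ψ z) a , subst (_∈ˢ K) (sym (model-dir α (ψ z) a)) m , refl) ◅
      -- The edge of colour `a` at `ψ z` ends in `ψ (flip a z)` only up to antipode, so a step
      -- identifying the two follows.
      inj₁ (φ-injective α (subst (φ α (flip (dir α (ψ z) a) (ψ z)) ∼_)
        (trans (cong (flip a) (φ-ψ z)) (sym (φ-ψ (flip a z)))) (φ-dir (ψ z) a))) ◅ Star.ε
    opaque
      assign : ∀ a z s → z Vec.[ a ]≔ s ≡ z ⊎ z Vec.[ a ]≔ s ≡ flip a z
      assign = toWitness {a? = all? λ a → vertices? λ z → signs? λ s →
        (_ ≟ⱽ _) ⊎-dec (_ ≟ⱽ _)} tt
    step : ∀ a z s → a ∈ˢ K ⊎ lookup z a ≡ s → Walk z (z Vec.[ a ]≔ s)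
    step a z s (inj₁ m) with assign a z s
    ... | inj₁ q = subst (Walk z) (sym q) Star.ε
    ... | inj₂ q = subst (Walk z) (sym q) (along a z m)
    step a z s (inj₂ refl) = subst (Walk z) (sym (Vec.[]≔-lookup z a)) Star.ε
    walk : ∀ z w → Agree K z w → Walk z w
    walk z@(a ∷ b ∷ c ∷ d ∷ []) w@(a′ ∷ b′ ∷ c′ ∷ d′ ∷ []) p =
      step 0F z a′ (at p 0F) ◅◅
      step 1F (a′ ∷ b ∷ c ∷ d ∷ []) b′ (at p 1F) ◅◅
      step 2F (a′ ∷ b′ ∷ c ∷ d ∷ []) c′ (at p 2F) ◅◅
      step 3F (a′ ∷ b′ ∷ c′ ∷ d ∷ []) d′ (at p 3F)

  record IsLeast (S : Subgraph) : Set where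
    constructor isLeast
    field
      vertices : Vertices S ≐ ∅
      edges    : Edges S ≐ ∅

  record IsComp (x : Vertex) (K : Subset 4) (S : Subgraph) : Set where
    constructor isComp
    field
      vertices : Vertices S ≐ Near K x
      edges    : Edges S ≐ (λ e → model α e ∈ˢ K × Near K x (proj₁ e))

  private
    T-does : ∀ {A : Set} (a? : Dec A) → T (does a?) → A
    T-does (yes a) _ = a

    does-T : ∀ {A : Set} (a? : Dec A) → A → T (does a?)
    does-T (yes _) _ = tt
    does-T (no ¬a) a = ¬a a

  near-∼ : ∀ {K x y z} → y ∼ z → Near K x y → Near K x z
  near-∼ p q = joined-trans q (∼⇒near p)

  edge-near : ∀ {K x e y} → model α e ∈ˢ K → Near K x (proj₁ e) → Endpoint e y → Near K x y
  edge-near m n (inj₁ p) = near-∼ (∼-sym p) n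
  edge-near {e = y , i} m n (inj₂ p) = near-∼ (∼-sym p) (joined-trans n (near-flip y i m))

  comp : Vertex → Subset 4 → Subgraph
  comp x K = record
    { vertex?      = λ y → does (v? y)
    ; edge?        = λ e → does (e? e)
    ; vertex?-cong = λ {y} {z} p → does-⇔ (mk⇔ (near-∼ p) (near-∼ (∼-sym p))) (v? y) (v? z)
    ; edge?-cong   = λ {e} {f} p → does-⇔ (mk⇔ (to p) (to (∼ᴱ-sym p))) (e? e) (e? f)
    ; endpoints    = λ {e} {y} t p → does-T (v? y)
                       (edge-near (proj₁ (T-does (e? e) t)) (proj₂ (T-does (e? e) t)) p)
    }
    where
    v? : ∀ y → Dec (Near K x y)
    v? y = joined? K (φ α x) (φ α y)
    e? : ∀ e → Dec (model α e ∈ˢ K × Near K x (proj₁ e))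
    e? e = (model α e ∈ˢ? K) ×-dec v? (proj₁ e)
    to : ∀ {e f} → e ∼ᴱ f → model α e ∈ˢ K × Near K x (proj₁ e) → model α f ∈ˢ K × Near K x (proj₁ f)
    to p (m , n) = subst (_∈ˢ K) (model-cong α p) m , edge-near m n (proj₂ (∼ᴱ-sym p))

  comp-isComp : ∀ x K → IsComp x K (comp x K)
  comp-isComp x K = isComp
    ((λ {y} → T-does (joined? K (φ α x) (φ α y))) , λ {y} → does-T (joined? K (φ α x) (φ α y)))
    ( (λ {e} → T-does ((model α e ∈ˢ? K) ×-dec joined? K (φ α x) (φ α (proj₁ e))))
    , λ {e} → does-T ((model α e ∈ˢ? K) ×-dec joined? K (φ α x) (φ α (proj₁ e))))

  empty : Subgraph
  empty = record
    { vertex? = λ _ → false ; edge? = λ _ → false ; vertex?-cong = λ _ → refl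
    ; edge?-cong = λ _ → refl ; endpoints = λ () }

  empty-isLeast : IsLeast empty
  empty-isLeast = isLeast ((λ ()) , λ ()) ((λ ()) , λ ())

  dir-∈ : ∀ {K a} x → a ∈ˢ K → model α (x , dir α x a) ∈ˢ K
  dir-∈ {K} {a} x = subst (_∈ˢ K) (sym (model-dir α x a))

  comp-⊑ : ∀ {x K S y L S′} → IsComp x K S → IsComp y L S′ → K ⊆ L → Near L y x → S ⊑ S′
  comp-⊑ (isComp (v , _) (e , _)) (isComp (_ , v′) (_ , e′)) K⊆L n =
      (λ z t → v′ (joined-trans n (joined-mono K⊆L (v t))))
    , (λ f t → e′ (K⊆L (proj₁ (e t)) , joined-trans n (joined-mono K⊆L (proj₂ (e t)))))

  -- The component at `x` has an edge of every colour of `K` at `x` itself, so its edges determine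
  -- `K`.
  ⊑-comp : ∀ {x K S y L S′} → IsComp x K S → IsComp y L S′ → S ⊑ S′ → K ⊆ L × Near L y x
  ⊑-comp {x} {K} {L = L} (isComp (_ , v) (_ , e)) (isComp (v′ , _) (e′ , _)) (p , q) =
      (λ {a} m → subst (_∈ˢ L) (model-dir α x a) (proj₁ (e′ (q (x , dir α x a) (e (dir-∈ x m , joined-refl))))))
    , v′ (p x (v joined-refl))

  least-⊑ : ∀ {S S′} → IsLeast S → S ⊑ S′
  least-⊑ (isLeast (v , _) (e , _)) = (λ _ t → ⊥-elim (v t)) , (λ _ t → ⊥-elim (e t))

  comp-⋢-least : ∀ {x K S S′} → IsComp x K S → IsLeast S′ → ¬ S ⊑ S′
  comp-⋢-least {x} (isComp (_ , v) _) (isLeast (v′ , _) _) (p , _) = v′ (p x (v joined-refl))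

subsets? : ∀ {n} → Exhaustible (Subset n)
subsets? = vecs? bools?

_≟ˢ_ : (K L : Subset 4) → Dec (K ≡ L)
_≟ˢ_ = Vec.≡-dec Bool._≟_

module Labelling (α : Bool) where
  open Coloured α

  -- Faces of all ranks become components: vertices for the empty colour set, edges for singletons,
  -- Γ for all colours. For 𝒬 the set `top` consists of all colours; for a facet one colour is
  -- missing.
  record Labelled (P : Polytope) (top : Subset 4) : Set where
    field
      classify : ∀ {r S} → P r S → (r ≡ -[1+ 0 ] × IsLeast S)
                   ⊎ ∃₂ λ x K → K ⊆ top × r ≡ + ∣ K ∣ × IsComp x K S
      least-face : ∀ {S} → IsLeast S → P -[1+ 0 ] S
      comp-face  : ∀ {x K S} → K ⊆ top → IsComp x K S → P (+ ∣ K ∣) S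

  vertex-comp : ∀ {x S} → Vertices S ≐ (_∼ x) → Edges S ≐ ∅ → IsComp x Subset.⊥ S
  vertex-comp (v , v′) (e , _) = isComp
    ((λ t → ∼⇒near (∼-sym (v t))) , λ n → v′ (∼-sym (φ-injective α (joined-⊥⇒∼ n))))
    ((λ t → ⊥-elim (e t)) , λ { (m , _) → contradiction m ∉⊥ })

  comp-vertex : ∀ {x S} → IsComp x Subset.⊥ S → Vertices S ≐ (_∼ x) × Edges S ≐ ∅
  comp-vertex (isComp (v , v′) (e , _)) =
      ((λ t → ∼-sym (φ-injective α (joined-⊥⇒∼ (v t)))) , λ p → v′ (∼⇒near (∼-sym p)))
    , ((λ t → ∉⊥ (proj₁ (e t))) , λ ())

  near-endpoint : ∀ {x i y} → Near ⁅ model α (x , i) ⁆ x y → Endpoint (x , i) y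
  near-endpoint {x} {i} n with joined-⁅⁆ n
  ... | inj₁ p = inj₁ (φ-injective α p)
  ... | inj₂ p = inj₂ (φ-injective α (∼-trans p (∼-sym (φ-flip α x i))))

  endpoint-near : ∀ {x i y} → Endpoint (x , i) y → Near ⁅ model α (x , i) ⁆ x y
  endpoint-near {x} {i} p = edge-near {e = x , i} (x∈⁅x⁆ (model α (x , i))) joined-refl p

  near-edge : ∀ {x i e} → model α e ∈ˢ ⁅ model α (x , i) ⁆ × Near ⁅ model α (x , i) ⁆ x (proj₁ e) → e ∼ᴱ (x , i)
  near-edge {x} {i} {y , j} (m , n) = i≡j , near-endpoint n
    where
    -- `y` is an endpoint of (`x` , `i`), so the edge at `y` in direction `i` has that same colour,
    -- and the edges at `y` have distinct colours.
    i≡j : j ≡ i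
    i≡j = begin
      j                         ≡⟨ dir-model α y j ⟨
      dir α y (model α (y , j))     ≡⟨ cong (dir α y) (x∈⁅y⁆⇒x≡y (model α (x , i)) m) ⟩
      dir α y (model α (x , i))     ≡⟨ cong (dir α y) (model-cong α {y , i} {x , i} (refl , near-endpoint n)) ⟨
      dir α y (model α (y , i))     ≡⟨ dir-model α y i ⟩
      i                         ∎
      where open ≡-Reasoning

  edge-comp : ∀ {x i S} → Vertices S ≐ Endpoint (x , i) → Edges S ≐ (_∼ᴱ (x , i)) →
              IsComp x ⁅ model α (x , i) ⁆ S
  edge-comp {x} {i} (v , v′) (e , e′) = isComp
    ((λ t → endpoint-near (v t)) , λ n → v′ (near-endpoint n))
    ((λ {f} t → subst (_∈ˢ ⁅ model α (x , i) ⁆) (sym (model-cong α (e t))) (x∈⁅x⁆ (model α (x , i)))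
                  , endpoint-near (proj₂ (e t)))
      , λ p → e′ (near-edge p))

  comp-edge : ∀ {x i S} → IsComp x ⁅ model α (x , i) ⁆ S →
              Vertices S ≐ Endpoint (x , i) × Edges S ≐ (_∼ᴱ (x , i))
  comp-edge {x} {i} (isComp (v , v′) (e , e′)) =
      ((λ t → near-endpoint (v t)) , λ p → v′ (endpoint-near p))
    , ((λ t → near-edge (e t))
      , λ {f} p → e′ (subst (_∈ˢ ⁅ model α (x , i) ⁆) (sym (model-cong α p)) (x∈⁅x⁆ (model α (x , i)))
                     , endpoint-near (proj₂ p)))

  whole-comp : ∀ {S} → Vertices S ≐ U → Edges S ≐ U → IsComp x₀ Subset.⊤ S
  whole-comp (_ , v) (_ , e) = isComp
    ((λ _ → joined-⊤) , λ _ → v _) ((λ _ → ∈⊤ , joined-⊤) , λ _ → e _)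

  comp-whole : ∀ {x S} → IsComp x Subset.⊤ S → Vertices S ≐ U × Edges S ≐ U
  comp-whole (isComp (_ , v) (_ , e)) =
    ((λ _ → _) , λ _ → v joined-⊤) , ((λ _ → _) , λ _ → e (∈⊤ , joined-⊤))

opaque
  -- Splits off the ranks 0, 1 and 4, whose faces `𝒬` does not define as components.
  sizes : ∀ (K : Subset 4) → K ≡ Subset.⊥ ⊎ (∃ λ a → K ≡ ⁅ a ⁆) ⊎ ∣ K ∣ ≡ 2 ⊎ ∣ K ∣ ≡ 3 ⊎ K ≡ Subset.⊤
  sizes = toWitness {a? = subsets? λ K → (K ≟ˢ _) ⊎-dec (any? λ a → K ≟ˢ _) ⊎-dec
    (_ ℕ.≟ _) ⊎-dec (_ ℕ.≟ _) ⊎-dec (K ≟ˢ _)} tt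

opaque
  unfolding inverse

  ∣∘perm∣ : ∀ σ → IsPerm σ → ∀ K → ∣ tabulate (λ a → lookup K (lookup σ a)) ∣ ≡ ∣ K ∣
  ∣∘perm∣ = toWitness {a? = perms? λ σ → subsets? λ K → _ ℕ.≟ _} tt

module Faces (c : ChiralColouring) (m : IsModelled c) where
  open ChiralColouring c
  open IsModelled m
  open Coloured α
  open Labelling α

  private
    -- Translations between the colours of `c` and those of the model, which differ by `π`: preimage
    -- and image of a colour set under `π`.
    pull push : Subset 4 → Subset 4
    pull K = tabulate λ a → lookup K (π a)
    push K = tabulate λ a → lookup K (π⁻¹ a)

    lookup-pull : ∀ K a → lookup (pull K) a ≡ lookup K (π a)
    lookup-pull K = Vec.lookup∘tabulate λ a → lookup K (π a)

    pull-push : ∀ K → pull (push K) ≡ K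
    pull-push K = ext λ a → trans (lookup-pull (push K) a)
      (trans (Vec.lookup∘tabulate (λ b → lookup K (π⁻¹ b)) (π a)) (cong (lookup K) (π⁻¹-π a)))

    ∈-pull : ∀ {K a} → π a ∈ˢ K → a ∈ˢ pull K
    ∈-pull {K} {a} p = Vec.lookup⇒[]= a (pull K) (trans (lookup-pull K a) (Vec.[]=⇒lookup p))

    pull-∈ : ∀ {K a} → a ∈ˢ pull K → π a ∈ˢ K
    pull-∈ {K} {a} p = Vec.lookup⇒[]= (π a) K (trans (sym (lookup-pull K a)) (Vec.[]=⇒lookup p))

    ∣pull∣ : ∀ K → ∣ pull K ∣ ≡ ∣ K ∣
    ∣pull∣ K = trans (cong ∣_∣ (Vec.tabulate-cong λ a → cong (lookup K) (sym (Vec.lookup∘tabulate π a))))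
      (∣∘perm∣ (tabulate π) (injective⇒perm (tabulate π) inj) K)
      where
      inj : Injective (tabulate π)
      inj i j p = trans (sym (π⁻¹-π i)) (trans (cong π⁻¹
        (trans (sym (Vec.lookup∘tabulate π i)) (trans p (Vec.lookup∘tabulate π j)))) (π⁻¹-π j))

    ∣push∣ : ∀ K → ∣ push K ∣ ≡ ∣ K ∣
    ∣push∣ K = trans (sym (∣pull∣ (push K))) (cong ∣_∣ (pull-push K))

    colour-∈ : ∀ {K} e → colour e ∈ˢ K → model α e ∈ˢ pull K
    colour-∈ {K} e p = ∈-pull (subst (_∈ˢ K) (colour-model e) p)

    ∈-colour : ∀ {K} e → model α e ∈ˢ pull K → colour e ∈ˢ K
    ∈-colour {K} e p = subst (_∈ˢ K) (sym (colour-model e)) (pull-∈ p)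

    connected⇒near : ∀ {K x y} → Connected c K x y → Near (pull K) x y
    connected⇒near p = conn⇒near
      (Star.map (map₂ λ { (i , q , r) → i , colour-∈ (_ , i) q , r }) p)

    near⇒connected : ∀ {K x y} → Near (pull K) x y → Connected c K x y
    near⇒connected p =
      Star.map (map₂ λ { (i , q , r) → i , ∈-colour (_ , i) q , r }) (near⇒conn p)

    component-comp : ∀ {K S} → IsComponent c K S → ∃ λ x → IsComp x (pull K) S
    component-comp (x , (v , v′) , (e , e′)) = x , isComp
        ((λ t → connected⇒near (v t)) , λ n → v′ (near⇒connected n))
        ((λ {f} t → colour-∈ f (proj₁ (e t)) , connected⇒near (proj₂ (e t)))
        , λ {f} p → e′ (∈-colour f (proj₁ p) , near⇒connected (proj₂ p)))

    comp-component : ∀ {x K S} → IsComp x K S → IsComponent c (push K) S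
    comp-component {x} {K} {S} p with subst (λ L → IsComp x L S) (sym (pull-push K)) p
    ... | isComp (v , v′) (e , e′) = x
      , ((λ t → near⇒connected (v t)) , λ n → v′ (connected⇒near n))
      , ((λ {f} t → ∈-colour f (proj₁ (e t)) , near⇒connected (proj₂ (e t)))
        , λ {f} p → e′ (colour-∈ f (proj₁ p) , connected⇒near (proj₂ p)))

  𝒬-labelled : Labelled (𝒬 c) Subset.⊤
  𝒬-labelled = record { classify = classify ; least-face = λ { (isLeast v e) → least v e }
                      ; comp-face = λ _ → face }
    where
    classify : ∀ {r S} → 𝒬 c r S → (r ≡ -[1+ 0 ] × IsLeast S)
                 ⊎ ∃₂ λ x K → K ⊆ Subset.⊤ × r ≡ + ∣ K ∣ × IsComp x K S
    classify (least v e) = inj₁ (refl , isLeast v e)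
    classify {S = S} (vertex x v e) = inj₂ (x , Subset.⊥ , (λ _ → ∈⊤) , refl , vertex-comp {S = S} v e)
    classify {S = S} (edge (x , i) v e) = inj₂ (x , ⁅ model α (x , i) ⁆ , (λ _ → ∈⊤)
      , cong +_ (sym (∣⁅x⁆∣≡1 (model α (x , i)))) , edge-comp {S = S} v e)
    classify (twoFace K s p) with component-comp p
    ... | x , q = inj₂ (x , pull K , (λ _ → ∈⊤) , cong +_ (sym (trans (∣pull∣ K) s)) , q)
    classify (facet K s p) with component-comp p
    ... | x , q = inj₂ (x , pull K , (λ _ → ∈⊤) , cong +_ (sym (trans (∣pull∣ K) s)) , q)
    classify {S = S} (greatest v e) = inj₂ (x₀ , Subset.⊤ , (λ _ → ∈⊤) , refl , whole-comp {S = S} v e)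

    face : ∀ {x K S} → IsComp x K S → 𝒬 c (+ ∣ K ∣) S
    face {x} {K} {S} p with sizes K
    ... | inj₁ refl = vertex x (proj₁ (comp-vertex p)) (proj₂ (comp-vertex p))
    ... | inj₂ (inj₁ (a , refl)) =
      subst (λ n → 𝒬 c (+ n) S) (sym (∣⁅x⁆∣≡1 a)) (edge (x , dir α x a) (proj₁ q) (proj₂ q))
      where
      q : Vertices S ≐ Endpoint (x , dir α x a) × Edges S ≐ (_∼ᴱ (x , dir α x a))
      q = comp-edge (subst (λ b → IsComp x ⁅ b ⁆ S) (sym (model-dir α x a)) p)
    ... | inj₂ (inj₂ (inj₁ s)) = subst (λ n → 𝒬 c (+ n) S) (sym s)
      (twoFace (push K) (trans (∣push∣ K) s) (comp-component p))
    ... | inj₂ (inj₂ (inj₂ (inj₁ s))) = subst (λ n → 𝒬 c (+ n) S) (sym s)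
      (facet (push K) (trans (∣push∣ K) s) (comp-component p))
    ... | inj₂ (inj₂ (inj₂ (inj₂ refl))) = greatest (proj₁ (comp-whole p)) (proj₂ (comp-whole p))

-- The hemi-hypercube

entry : Bool → Sign → Maybe Sign
entry true  _ = nothing
entry false s = just s

opaque
  -- The face of the 4-cube through `z` with free coordinates `K`.
  word : Subset 4 → Vertex → Vec (Maybe Sign) 4
  word K z = tabulate λ a → entry (lookup K a) (lookup z a)

  lookup-word : ∀ K z a → lookup (word K z) a ≡ entry (lookup K a) (lookup z a)
  lookup-word K z = Vec.lookup∘tabulate λ a → entry (lookup K a) (lookup z a)

vertexOf⇒agree : ∀ K z w → VertexOf (just (word K z)) w → Agree K z w
vertexOf⇒agree K z w p .at a with lookup K a in eq | lookup-word K z a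
... | true  | _ = inj₁ (Vec.lookup⇒[]= a K eq)
... | false | q with p a
...   | inj₁ r = contradiction (trans (sym q) r) λ ()
...   | inj₂ r = inj₂ (just-injective (trans (sym q) r))

agree⇒vertexOf : ∀ K z w → Agree K z w → VertexOf (just (word K z)) w
agree⇒vertexOf K z w p a with lookup K a in eq | lookup-word K z a
... | true  | q = inj₁ q
... | false | q with at p a
...   | inj₁ r = contradiction (trans (sym eq) (Vec.[]=⇒lookup r)) λ ()
...   | inj₂ r = inj₂ (trans q (cong just r))

agree⇒≡ : ∀ {K z w} → Agree K z w → word K z ≡ word K w
agree⇒≡ {K} {z} {w} p = ext λ a →
  trans (lookup-word K z a) (trans (pointwise a (at p a)) (sym (lookup-word K w a)))
  where
  pointwise : ∀ a → a ∈ˢ K ⊎ lookup z a ≡ lookup w a →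
              entry (lookup K a) (lookup z a) ≡ entry (lookup K a) (lookup w a)
  pointwise a (inj₁ r) rewrite Vec.[]=⇒lookup r = refl
  pointwise a (inj₂ r) = cong (entry (lookup K a)) r

antipodal-word : ∀ K z → antipodalFace (just (word K z)) ≡ just (word K (antipode z))
antipodal-word K z = cong just (ext λ a → begin
  lookup (Vec.map (Maybe.map Sign.opposite) (word K z)) a
    ≡⟨ Vec.lookup-map a (Maybe.map Sign.opposite) (word K z) ⟩
  Maybe.map Sign.opposite (lookup (word K z) a)
    ≡⟨ cong (Maybe.map Sign.opposite) (lookup-word K z a) ⟩
  Maybe.map Sign.opposite (entry (lookup K a) (lookup z a))
    ≡⟨ opposite-entry (lookup K a) ⟩
  entry (lookup K a) (Sign.opposite (lookup z a))
    ≡⟨ cong (entry (lookup K a)) (lookup-antipode a z) ⟨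
  entry (lookup K a) (lookup (antipode z) a)
    ≡⟨ lookup-word K (antipode z) a ⟨
  lookup (word K (antipode z)) a ∎)
  where
  open ≡-Reasoning
  opposite-entry : ∀ b {s} → Maybe.map Sign.opposite (entry b s) ≡ entry b (Sign.opposite s)
  opposite-entry true  = refl
  opposite-entry false = refl

-- For `a` in `K` the smaller face contains `z` and `flip a z`, hence so does the larger one, which
-- therefore cannot fix coordinate `a`.
cubeLeq⇒ : ∀ {K z L w} → CubeLeq (just (word K z)) (just (word L w)) → K ⊆ L × Agree L w z
cubeLeq⇒ {K} {z} {L} {w} p = K⊆L , z-agrees
  where
  z-agrees : Agree L w z
  z-agrees = vertexOf⇒agree L w z (p z (agree⇒vertexOf K z z agree-refl))
  K⊆L : K ⊆ L
  K⊆L {a} m with at z-agrees a | at (vertexOf⇒agree L w (flip a z)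
    (p (flip a z) (agree⇒vertexOf K z (flip a z) (agree-flip a z m)))) a
  ... | inj₁ r | _      = r
  ... | inj₂ _ | inj₁ s = s
  ... | inj₂ r | inj₂ s = contradiction
    (trans (sym r) (trans s (Vec.lookup∘updateAt a z))) (Sign.s≢opposite[s] (lookup z a))

⇒cubeLeq : ∀ {K z L w} → K ⊆ L → Agree L w z → CubeLeq (just (word K z)) (just (word L w))
⇒cubeLeq {K} {z} {L} {w} K⊆L p v q =
  agree⇒vertexOf L w v (agree-trans p (agree-mono K⊆L (vertexOf⇒agree K z v q)))

hemiLeq⇒ : ∀ {K z L w} → HemiLeq (just (word K z)) (just (word L w)) → K ⊆ L × Joined L w z
hemiLeq⇒ (inj₁ p) = map₂′ same (cubeLeq⇒ p)
hemiLeq⇒ {K} {z} {L} {w} (inj₂ p) = map₂′ (λ q → joined-sym (opposite (agree-sym q)))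
  (cubeLeq⇒ (subst (CubeLeq (just (word K z))) (antipodal-word L w) p))

⇒hemiLeq : ∀ {K z L w} → K ⊆ L → Joined L w z → HemiLeq (just (word K z)) (just (word L w))
⇒hemiLeq K⊆L (same p) = inj₁ (⇒cubeLeq K⊆L p)
⇒hemiLeq {K} {z} {L} {w} K⊆L (opposite p) = inj₂
  (subst (CubeLeq (just (word K z))) (sym (antipodal-word L w)) (⇒cubeLeq K⊆L (antipode-swap p)))

antipodal-involutive : ∀ F → antipodalFace (antipodalFace F) ≡ F
antipodal-involutive nothing  = refl
antipodal-involutive (just w) = cong just
  (trans (sym (Vec.map-∘ _ _ w)) (trans (Vec.map-cong involutive w) (Vec.map-id w)))
  where
  involutive : ∀ s → Maybe.map Sign.opposite (Maybe.map Sign.opposite s) ≡ s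
  involutive nothing       = refl
  involutive (just Sign.+) = refl
  involutive (just Sign.-) = refl

module HemiHypercube (α : Bool) (P : Polytope) (L : Labelling.Labelled α P Subset.⊤) where
  open Coloured α
  open Labelling α
  open Labelled L

  -- A relation rather than a function, because a component has several base vertices; the lemmas
  -- below hold for whichever one `classify` returns.
  data Reads (S : Subgraph) : CubeFace → Set where
    reads-least : IsLeast S → Reads S nothing
    reads-comp  : ∀ {x K} → IsComp x K S → Reads S (just (word K (φ α x)))

  ⊑⇒leq : ∀ {S S′ F G} → Reads S F → Reads S′ G → S ⊑ S′ → HemiLeq F G
  ⊑⇒leq (reads-least _) _         _ = inj₁ λ _ ()
  ⊑⇒leq (reads-comp p)  (reads-least q) r = contradiction r (comp-⋢-least p q)
  ⊑⇒leq (reads-comp p)  (reads-comp q)  r with ⊑-comp p q r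
  ... | K⊆L , n = ⇒hemiLeq K⊆L n

  leq⇒⊑ : ∀ {S S′ F G} → Reads S F → Reads S′ G → HemiLeq F G → S ⊑ S′
  leq⇒⊑ {S′ = S′} (reads-least p) _ _ = least-⊑ {S′ = S′} p
  leq⇒⊑ (reads-comp {x} {K} p)  (reads-least q) r =
    ⊥-elim ([ (λ s → s (φ α x) v) , (λ s → s (φ α x) v) ]′ r)
    where
    v : VertexOf (just (word K (φ α x))) (φ α x)
    v = agree⇒vertexOf K (φ α x) (φ α x) agree-refl
  leq⇒⊑ (reads-comp p)  (reads-comp q)  r with hemiLeq⇒ r
  ... | K⊆L , n = comp-⊑ p q K⊆L n

  ⊑⊒⇒eq : ∀ {S S′ F G} → Reads S F → Reads S′ G → S ⊑ S′ → S′ ⊑ S → HemiEq F G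
  ⊑⊒⇒eq (reads-least _) (reads-least _) _ _ = inj₁ refl
  ⊑⊒⇒eq (reads-least p) (reads-comp q)  _ s = contradiction s (comp-⋢-least q p)
  ⊑⊒⇒eq (reads-comp p)  (reads-least q) r _ = contradiction r (comp-⋢-least p q)
  ⊑⊒⇒eq (reads-comp {x} {K} p) (reads-comp {y} q) r s with ⊑-comp p q r | ⊑-comp q p s
  ... | K⊆L , _ | L⊆K , n with ⊆-antisym K⊆L L⊆K
  ... | refl with n
  ...   | same m     = inj₁ (cong just (agree⇒≡ m))
  ...   | opposite m = inj₂ (trans (cong just (agree⇒≡ m)) (sym (antipodal-word K (φ α y))))

  read : Face P → CubeFace
  read F with classify (isFace F)
  ... | inj₁ _           = nothing
  ... | inj₂ (x , K , _) = just (word K (φ α x))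

  reads : ∀ F → Reads (graph F) (read F)
  reads F with classify (isFace F)
  ... | inj₁ (_ , p)             = reads-least p
  ... | inj₂ (x , K , _ , _ , p) = reads-comp p

  hemiEq⇒leq : ∀ {F G} → HemiEq F G → HemiLeq F G × HemiLeq G F
  hemiEq⇒leq (inj₁ refl) = inj₁ (λ _ v → v) , inj₁ (λ _ v → v)
  hemiEq⇒leq {G = G} (inj₂ refl) =
    inj₂ (λ _ v → v) , inj₂ λ x → subst (λ H → VertexOf H x) (sym (antipodal-involutive G))

  cover : ∀ F → ∃ λ S → ∃ λ r → P r S × Reads S F
  cover nothing  = empty , _ , least-face empty-isLeast , reads-least empty-isLeast
  cover (just w) = comp (ψ z) K , _ , comp-face (λ _ → ∈⊤) (comp-isComp (ψ z) K)
                 , subst (Reads (comp (ψ z) K)) (cong just word≡w) (reads-comp (comp-isComp (ψ z) K))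
    where
    K : Subset 4
    K = Vec.map Maybe.is-nothing w
    z : Vertex
    -- The sign chosen at a free coordinate is arbitrary, since `entry` discards it.
    z = Vec.map (Maybe.fromMaybe Sign.+) w
    entry-map : ∀ m → entry (Maybe.is-nothing m) (Maybe.fromMaybe Sign.+ m) ≡ m
    entry-map nothing  = refl
    entry-map (just _) = refl
    word≡w : word K (φ α (ψ z)) ≡ w
    word≡w = ext λ a → begin
      lookup (word K (φ α (ψ z))) a               ≡⟨ lookup-word K (φ α (ψ z)) a ⟩
      entry (lookup K a) (lookup (φ α (ψ z)) a)   ≡⟨ cong (λ y → entry (lookup K a) (lookup y a)) (φ-ψ z) ⟩
      entry (lookup K a) (lookup z a)
        ≡⟨ cong₂ entry (Vec.lookup-map a Maybe.is-nothing w) (Vec.lookup-map a _ w) ⟩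
      entry (Maybe.is-nothing (lookup w a)) (Maybe.fromMaybe Sign.+ (lookup w a))
        ≡⟨ entry-map (lookup w a) ⟩
      lookup w a                                  ∎
      where open ≡-Reasoning

  isomorphic : IsomorphicToHemiHypercube P
  isomorphic = read , record
    { isOrderMonomorphism = record
      { isOrderHomomorphism = record
        { cong = λ {F} {G} (p , q) → ⊑⊒⇒eq (reads F) (reads G) p q
        ; mono = λ {F} {G} → ⊑⇒leq (reads F) (reads G)
        }
      ; injective = λ {F} {G} p → leq⇒⊑ (reads F) (reads G) (proj₁ (hemiEq⇒leq p))
                                , leq⇒⊑ (reads G) (reads F) (proj₂ (hemiEq⇒leq p))
      ; cancel = λ {F} {G} → leq⇒⊑ (reads F) (reads G)
      }
    ; surjective = λ F → let (S , r , p , q) = cover F in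
        record { rank = r ; graph = S ; isFace = p } , λ {G} (s , t) → ⊑⊒⇒eq (reads G) q s t
    }

-- Limits of rational sequences

Seq : Set
Seq = ℕ → ℚ

-- The relation _≈_ between the underlying sequences, as a record so that they can be inferred.
infix 4 _≋_

record _≋_ (u v : Seq) : Set where
  constructor limit
  field close : ∀ ε → 0ℚ ℚ.< ε → ∃ λ N → ∀ n → N ℕ.≤ n → ℚ.∣ u n ℚ.- v n ∣ ℚ.< ε

open _≋_ public

≗⇒≋ : ∀ {u v} → (∀ n → u n ≡ v n) → u ≋ v
≗⇒≋ {u} {v} p .close ε ε>0 = 0 , λ n _ →
  subst (λ q → ℚ.∣ u n ℚ.- q ∣ ℚ.< ε) (p n) (∣p-p∣<ε (u n) ε>0)

≋-refl : ∀ {u} → u ≋ u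
≋-refl = ≗⇒≋ λ _ → refl

≋-sym : ∀ {u v} → u ≋ v → v ≋ u
≋-sym {u} {v} p .close ε ε>0 = proj₁ (close p ε ε>0) , λ n N≤n →
  subst (ℚ._< ε) (swap (u n) (v n)) (proj₂ (close p ε ε>0) n N≤n)
  where
  swap : ∀ a b → ℚ.∣ a ℚ.- b ∣ ≡ ℚ.∣ b ℚ.- a ∣
  swap a b = trans (sym (ℚ.∣-p∣≡∣p∣ (a ℚ.- b)))
    (cong ℚ.∣_∣ (solve 2 (λ a b → :- (a :- b) := b :- a) refl a b))
    where open +-*-Solver

sum-close : ∀ ε {p q} r → ℚ.∣ p ∣ ℚ.< ½ ℚ.* ε → ℚ.∣ q ∣ ℚ.< ½ ℚ.* ε → r ≡ p ℚ.+ q → ℚ.∣ r ∣ ℚ.< ε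
sum-close ε {p} {q} _ p< q< refl = begin-strict
  ℚ.∣ p ℚ.+ q ∣              ≤⟨ ℚ.∣p+q∣≤∣p∣+∣q∣ p q ⟩
  ℚ.∣ p ∣ ℚ.+ ℚ.∣ q ∣        <⟨ ℚ.+-mono-< p< q< ⟩
  ½ ℚ.* ε ℚ.+ ½ ℚ.* ε        ≡⟨ half+half ε ⟩
  ε                          ∎
  where open ℚ.≤-Reasoning

≋-trans : ∀ {u v w} → u ≋ v → v ≋ w → u ≋ w
≋-trans {u} {v} {w} p q .close ε ε>0 = M ℕ.⊔ N , λ n b → sum-close ε _
  (proj₂ (close p (½ ℚ.* ε) (half-pos ε>0)) n (ℕ.m⊔n≤o⇒m≤o M N b))
  (proj₂ (close q (½ ℚ.* ε) (half-pos ε>0)) n (ℕ.m⊔n≤o⇒n≤o M N b))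
  (split (u n) (v n) (w n))
  where
  M N : ℕ
  M = proj₁ (close p (½ ℚ.* ε) (half-pos ε>0))
  N = proj₁ (close q (½ ℚ.* ε) (half-pos ε>0))
  split : ∀ a b c → a ℚ.- c ≡ (a ℚ.- b) ℚ.+ (b ℚ.- c)
  split = solve 3 (λ a b c → a :- c := (a :- b) :+ (b :- c)) refl
    where open +-*-Solver

≋-setoid : Setoid 0ℓ 0ℓ
≋-setoid = record { Carrier = Seq ; _≈_ = _≋_
                  ; isEquivalence = record { refl = ≋-refl ; sym = ≋-sym ; trans = ≋-trans } }

module ≋-Reasoning = SetoidReasoning ≋-setoid

const : ℚ → Seq
const r _ = r

infixl 6 _⊹_
infixr 7 _•_

opaque
  _⊹_ : Seq → Seq → Seq
  (u ⊹ v) n = u n ℚ.+ v n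

  _•_ : ℚ → Seq → Seq
  (r • u) n = r ℚ.* u n

  ⊹-cong : ∀ {u u′ v v′} → u ≋ u′ → v ≋ v′ → u ⊹ v ≋ u′ ⊹ v′
  ⊹-cong {u} {u′} {v} {v′} p q .close ε ε>0 = M ℕ.⊔ N , λ n b → sum-close ε _
    (proj₂ (close p (½ ℚ.* ε) (half-pos ε>0)) n (ℕ.m⊔n≤o⇒m≤o M N b))
    (proj₂ (close q (½ ℚ.* ε) (half-pos ε>0)) n (ℕ.m⊔n≤o⇒n≤o M N b))
    (split (u n) (u′ n) (v n) (v′ n))
    where
    M N : ℕ
    M = proj₁ (close p (½ ℚ.* ε) (half-pos ε>0))
    N = proj₁ (close q (½ ℚ.* ε) (half-pos ε>0))
    split : ∀ a a′ b b′ → (a ℚ.+ b) ℚ.- (a′ ℚ.+ b′) ≡ (a ℚ.- a′) ℚ.+ (b ℚ.- b′)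
    split = solve 4 (λ a a′ b b′ → (a :+ b) :- (a′ :+ b′) := (a :- a′) :+ (b :- b′)) refl
      where open +-*-Solver

half< : ∀ {ε} → 0ℚ ℚ.< ε → ½ ℚ.* ε ℚ.< ε
half< {ε} ε>0 = subst₂ ℚ._<_ (ℚ.+-identityʳ (½ ℚ.* ε)) (half+half ε)
  (ℚ.+-monoʳ-< (½ ℚ.* ε) (half-pos ε>0))

product-close : ∀ ε (ε>0 : 0ℚ ℚ.< ε) B (B>0 : 0ℚ ℚ.< B) p q → ℚ.∣ p ∣ ℚ.≤ B →
                ℚ.∣ q ∣ ℚ.< share B B>0 ε ε>0 → ℚ.∣ p ℚ.* q ∣ ℚ.< ½ ℚ.* ε
product-close ε ε>0 B B>0 p q p≤B q<δ = begin-strict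
  ℚ.∣ p ℚ.* q ∣            ≡⟨ ℚ.∣p*q∣≡∣p∣*∣q∣ p q ⟩
  ℚ.∣ p ∣ ℚ.* ℚ.∣ q ∣      ≤⟨ ℚ.*-monoʳ-≤-nonNeg ℚ.∣ q ∣ {{ℚ.∣-∣-nonNeg q}} p≤B ⟩
  B ℚ.* ℚ.∣ q ∣            <⟨ ℚ.*-monoʳ-<-pos B {{ℚ.positive B>0}} q<δ ⟩
  B ℚ.* share B B>0 ε ε>0  ≡⟨ B*share B B>0 ε ε>0 ⟩
  ½ ℚ.* ε                  ∎
  where open ℚ.≤-Reasoning

opaque
  unfolding _•_

  -- A Cauchy sequence is eventually bounded, so multiplying it by the null sequence `u n - r` gives
  -- a null sequence.
  •-mul : ∀ (x : ℝ) {u r} → u ≋ const r → (λ n → u n ℚ.* seq x n) ≋ r • seq x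
  •-mul x {u} {r} p .close ε ε>0 = M ℕ.⊔ N , λ n b → begin-strict
    ℚ.∣ u n ℚ.* seq x n ℚ.- r ℚ.* seq x n ∣  ≡⟨ cong ℚ.∣_∣ (factor (seq x n) (u n) r) ⟩
    ℚ.∣ seq x n ℚ.* (u n ℚ.- r) ∣            <⟨ product-close ε ε>0 B B>0 (seq x n) (u n ℚ.- r)
                                                  (bounded (seq x) (cauchy x) n (ℕ.m⊔n≤o⇒m≤o M N b))
                                                  (proj₂ (close p δ δ>0) n (ℕ.m⊔n≤o⇒n≤o M N b)) ⟩
    ½ ℚ.* ε                                  <⟨ half< ε>0 ⟩
    ε                                        ∎
    where
    open ℚ.≤-Reasoning
    B : ℚ
    B = bound (seq x) (cauchy x)
    B>0 : 0ℚ ℚ.< B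
    B>0 = bound>0 (seq x) (cauchy x)
    δ : ℚ
    δ = share B B>0 ε ε>0
    δ>0 : 0ℚ ℚ.< δ
    δ>0 = share>0 B B>0 ε ε>0
    M N : ℕ
    M = boundedFrom (seq x) (cauchy x)
    N = proj₁ (close p δ δ>0)
    factor : ∀ a b c → b ℚ.* a ℚ.- c ℚ.* a ≡ a ℚ.* (b ℚ.- c)
    factor = solve 3 (λ a b c → b :* a :- c :* a := a :* (b :- c)) refl
      where open +-*-Solver

  •-cong : ∀ r {u v} → u ≋ v → r • u ≋ r • v
  •-cong r {u} {v} p .close ε ε>0 = proj₁ (close p δ δ>0) , λ n b → begin-strict
    ℚ.∣ r ℚ.* u n ℚ.- r ℚ.* v n ∣  ≡⟨ cong ℚ.∣_∣ (factor r (u n) (v n)) ⟩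
    ℚ.∣ r ℚ.* (u n ℚ.- v n) ∣      <⟨ product-close ε ε>0 B B>0 r (u n ℚ.- v n)
                                        (bounded (const r) (cauchy (fromℚ r)) n ℕ.z≤n)
                                        (proj₂ (close p δ δ>0) n b) ⟩
    ½ ℚ.* ε                        <⟨ half< ε>0 ⟩
    ε                              ∎
    where
    open ℚ.≤-Reasoning
    B : ℚ
    -- This bound is `1 + ∣ r ∣`, which is positive, as `share` requires, even for `r = 0`.
    B = bound (const r) (cauchy (fromℚ r))
    B>0 : 0ℚ ℚ.< B
    B>0 = bound>0 (const r) (cauchy (fromℚ r))
    δ : ℚ
    δ = share B B>0 ε ε>0
    δ>0 : 0ℚ ℚ.< δ
    δ>0 = share>0 B B>0 ε ε>0
    factor : ∀ a b c → a ℚ.* b ℚ.- a ℚ.* c ≡ a ℚ.* (b ℚ.- c)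
    factor = solve 3 (λ a b c → a :* b :- a :* c := a :* (b :- c)) refl
      where open +-*-Solver

-- Distinct rationals would have to be closer than their own distance. This is where equality of
-- limits becomes decidable.
const-injective : ∀ {p q} → const p ≋ const q → p ≡ q
const-injective {p} {q} r with p ℚ.≟ q
... | yes p≡q = p≡q
... | no p≢q  = contradiction (proj₂ (close r ℚ.∣ p ℚ.- q ∣ positive) _ ℕ.≤-refl) (ℚ.<-irrefl refl)
  where
  positive : 0ℚ ℚ.< ℚ.∣ p ℚ.- q ∣
  positive with ℚ.<-cmp 0ℚ ℚ.∣ p ℚ.- q ∣
  ... | tri< l _ _ = l
  ... | tri≈ _ e _ = contradiction (x∙y⁻¹≈ε⇒x≈y p q (ℚ.∣p∣≡0⇒p≡0 (p ℚ.- q) (sym e))) p≢q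
  ... | tri> _ _ g = contradiction (ℚ.<-≤-trans g (ℚ.0≤∣p∣ (p ℚ.- q))) (ℚ.<-irrefl refl)

-- Signed permutations and isometries

opaque
  unfolding inverse

  inverse-involutive : ∀ σ → IsPerm σ → inverse (inverse σ) ≡ σ
  inverse-involutive = toWitness {a? = perms? λ σ → _ ≟ᴹ _} tt

  inverse-perm : ∀ σ → IsPerm σ → IsPerm (inverse σ)
  inverse-perm = toWitness {a? = perms? λ σ → isPerm? (inverse σ)} tt

lookup-ι : ∀ i → lookup ι i ≡ i
lookup-ι = Vec.lookup-allFin

record SignedPerm : Set where
  field
    sign   : Vertex
    perm   : Map
    isPerm : IsPerm perm

  to from : Fin 4 → Fin 4
  to   = lookup perm
  from = lookup (inverse perm)

  to-from : ∀ i → to (from i) ≡ i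
  to-from i = trans (sym (lookup-⊙ perm (inverse perm) i))
                (trans (cong (λ v → lookup v i) isPerm) (lookup-ι i))

  from-to : ∀ i → from (to i) ≡ i
  from-to i = trans (sym (lookup-⊙ (inverse perm) perm i))
                (trans (cong (λ v → lookup v i) (inverse-left perm isPerm)) (lookup-ι i))

  to-injective : ∀ {i j} → to i ≡ to j → i ≡ j
  to-injective {i} {j} = perm⇒injective perm isPerm i j

  signAt : Fin 4 → Sign
  signAt j = lookup sign (to j)

open SignedPerm public using (sign; perm; isPerm; to; from; to-from; from-to; to-injective; signAt)

infixr 8 _·_
_·_ : SignedPerm → Vertex → Vertex
h · x = act (sign h) (perm h) x

-- The transposed matrix: the nonzero entry of its row `j` is that of column `j` of `h`, with sign
-- `signAt h j`.
inv : SignedPerm → SignedPerm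
inv h = record
  { sign   = tabulate (signAt h)
  ; perm   = inverse (perm h)
  ; isPerm = inverse-perm (perm h) (isPerm h)
  }

opaque
  unfolding act

  lookup-act : ∀ y τ x i → lookup (act y τ x) i ≡ lookup y i Sign.* lookup x (lookup (inverse τ) i)
  lookup-act y τ x i = trans (Vec.lookup-zipWith Sign._*_ i y _)
    (cong (lookup y i Sign.*_) (Vec.lookup∘tabulate (λ i → lookup x (lookup (inverse τ) i)) i))

-- Reading the image at `to h j` keeps the inverse permutation out of later computations; `ext-to`
-- shows that these coordinates suffice.
·-at : ∀ h x j → lookup (h · x) (to h j) ≡ signAt h j Sign.* lookup x j
·-at h x j = trans (lookup-act (sign h) (perm h) x (to h j))
  (cong (λ i → signAt h j Sign.* lookup x i) (from-to h j))

from-inv : ∀ h j → from (inv h) j ≡ to h j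
from-inv h j = cong (λ σ → lookup σ j) (inverse-involutive (perm h) (isPerm h))

inv-at : ∀ h x j → lookup (inv h · x) j ≡ signAt h j Sign.* lookup x (to h j)
inv-at h x j = trans (lookup-act (sign (inv h)) (perm (inv h)) x j)
  (cong₂ Sign._*_ (Vec.lookup∘tabulate (signAt h) j) (cong (lookup x) (from-inv h j)))

cancel-sign : ∀ s t → s Sign.* (s Sign.* t) ≡ t
cancel-sign Sign.+ t = refl
cancel-sign Sign.- Sign.+ = refl
cancel-sign Sign.- Sign.- = refl

inv-· : ∀ h x → inv h · (h · x) ≡ x
inv-· h x = ext λ j → trans (inv-at h (h · x) j)
  (trans (cong (signAt h j Sign.*_) (·-at h x j)) (cancel-sign (signAt h j) (lookup x j)))

ext-to : ∀ h {x y : Vertex} → (∀ j → lookup x (to h j) ≡ lookup y (to h j)) → x ≡ y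
ext-to h {x} {y} p = ext λ i → subst (λ k → lookup x k ≡ lookup y k) (to-from h i) (p (from h i))

·-inv : ∀ h x → h · (inv h · x) ≡ x
·-inv h x = ext-to h λ j → trans (·-at h (inv h · x) j)
  (trans (cong (signAt h j Sign.*_) (inv-at h x j)) (cancel-sign (signAt h j) (lookup x (to h j))))

*-opposite : ∀ s t → s Sign.* Sign.opposite t ≡ Sign.opposite (s Sign.* t)
*-opposite Sign.+ t = refl
*-opposite Sign.- Sign.+ = refl
*-opposite Sign.- Sign.- = refl

·-flip : ∀ h i x → h · flip i x ≡ flip (to h i) (h · x)
·-flip h i x = ext-to h pointwise
  where
  pointwise : ∀ j → lookup (h · flip i x) (to h j) ≡ lookup (flip (to h i) (h · x)) (to h j)
  pointwise j with j ≟ i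
  ... | yes refl = begin
    lookup (h · flip i x) (to h i)                   ≡⟨ ·-at h (flip i x) i ⟩
    signAt h i Sign.* lookup (flip i x) i            ≡⟨ cong (signAt h i Sign.*_) (Vec.lookup∘updateAt i x) ⟩
    signAt h i Sign.* Sign.opposite (lookup x i)     ≡⟨ *-opposite (signAt h i) (lookup x i) ⟩
    Sign.opposite (signAt h i Sign.* lookup x i)     ≡⟨ cong Sign.opposite (·-at h x i) ⟨
    Sign.opposite (lookup (h · x) (to h i))          ≡⟨ Vec.lookup∘updateAt (to h i) (h · x) ⟨
    lookup (flip (to h i) (h · x)) (to h i)          ∎
    where open ≡-Reasoning
  ... | no j≢i = begin
    lookup (h · flip i x) (to h j)           ≡⟨ ·-at h (flip i x) j ⟩
    signAt h j Sign.* lookup (flip i x) j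
      ≡⟨ cong (signAt h j Sign.*_) (Vec.lookup∘updateAt′ j i j≢i x) ⟩
    signAt h j Sign.* lookup x j             ≡⟨ ·-at h x j ⟨
    lookup (h · x) (to h j)
      ≡⟨ Vec.lookup∘updateAt′ (to h j) (to h i) (λ p → j≢i (to-injective h p)) (h · x) ⟨
    lookup (flip (to h i) (h · x)) (to h j)  ∎
    where open ≡-Reasoning

·-antipode : ∀ h x → h · antipode x ≡ antipode (h · x)
·-antipode h x = ext-to h λ j → begin
  lookup (h · antipode x) (to h j)               ≡⟨ ·-at h (antipode x) j ⟩
  signAt h j Sign.* lookup (antipode x) j        ≡⟨ cong (signAt h j Sign.*_) (Vec.lookup-map j Sign.opposite x) ⟩
  signAt h j Sign.* Sign.opposite (lookup x j)   ≡⟨ *-opposite (signAt h j) (lookup x j) ⟩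
  Sign.opposite (signAt h j Sign.* lookup x j)   ≡⟨ cong Sign.opposite (·-at h x j) ⟨
  Sign.opposite (lookup (h · x) (to h j))        ≡⟨ Vec.lookup-map (to h j) Sign.opposite (h · x) ⟨
  lookup (antipode (h · x)) (to h j)             ∎
  where
  open ≡-Reasoning

·-∼ : ∀ h {x y} → x ∼ y → h · x ∼ h · y
·-∼ h (inj₁ refl) = inj₁ refl
·-∼ h {y = y} (inj₂ refl) = inj₂ (·-antipode h y)

±1 : Sign → ℚ
±1 Sign.+ = 1ℚ
±1 Sign.- = ℚ.- 1ℚ

±1-* : ∀ s t → ±1 s ℚ.* ±1 t ≡ ±1 (s Sign.* t)
±1-* Sign.+ Sign.+ = refl
±1-* Sign.+ Sign.- = refl
±1-* Sign.- Sign.+ = refl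
±1-* Sign.- Sign.- = refl

±1-½ : ∀ s t → ±1 s ℚ.* ±½ t ≡ ±½ (s Sign.* t)
±1-½ Sign.+ Sign.+ = refl
±1-½ Sign.+ Sign.- = refl
±1-½ Sign.- Sign.+ = refl
±1-½ Sign.- Sign.- = refl

infixl 5 _when_
_when_ : ∀ {A : Set} → ℚ → Dec A → ℚ
r when a? = if does a? then r else 0ℚ

∑ℚ : (Fin 4 → ℚ) → ℚ
∑ℚ f = f 0F ℚ.+ (f 1F ℚ.+ (f 2F ℚ.+ (f 3F ℚ.+ 0ℚ)))

∑ℚ-cong : ∀ (f g : Fin 4 → ℚ) → (∀ k → f k ≡ g k) → ∑ℚ f ≡ ∑ℚ g
∑ℚ-cong _ _ p rewrite p 0F | p 1F | p 2F | p 3F = refl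

opaque
  pick : ∀ a r (f : Fin 4 → ℚ) → ∑ℚ (λ k → (r when (a ≟ k)) ℚ.* f k) ≡ r ℚ.* f a
  pick 0F r f = solve 5 (λ r a b c d →
    r :* a :+ (con 0ℚ :* b :+ (con 0ℚ :* c :+ (con 0ℚ :* d :+ con 0ℚ))) := r :* a)
    refl r (f 0F) (f 1F) (f 2F) (f 3F)
    where open +-*-Solver
  pick 1F r f = solve 5 (λ r a b c d →
    con 0ℚ :* a :+ (r :* b :+ (con 0ℚ :* c :+ (con 0ℚ :* d :+ con 0ℚ))) := r :* b)
    refl r (f 0F) (f 1F) (f 2F) (f 3F)
    where open +-*-Solver
  pick 2F r f = solve 5 (λ r a b c d →
    con 0ℚ :* a :+ (con 0ℚ :* b :+ (r :* c :+ (con 0ℚ :* d :+ con 0ℚ))) := r :* c)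
    refl r (f 0F) (f 1F) (f 2F) (f 3F)
    where open +-*-Solver
  pick 3F r f = solve 5 (λ r a b c d →
    con 0ℚ :* a :+ (con 0ℚ :* b :+ (con 0ℚ :* c :+ (r :* d :+ con 0ℚ))) := r :* d)
    refl r (f 0F) (f 1F) (f 2F) (f 3F)
    where open +-*-Solver

coefficient : SignedPerm → Fin 4 → Fin 4 → ℚ
coefficient h i k = ±1 (lookup (sign h) i) when (i ≟ to h k)

coefficient-to : ∀ h j k → coefficient h (to h j) k ≡ (±1 (signAt h j) when (j ≟ k))
coefficient-to h j k = cong (λ b → if b then ±1 (signAt h j) else 0ℚ)
  (does-⇔ (mk⇔ (to-injective h) (cong (to h))) (to h j ≟ to h k) (j ≟ k))

Represents : Isometry → SignedPerm → Set
Represents g h = ∀ i k → seq (matrix g i k) ≋ const (coefficient h i k)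

∑ˢ : (Fin 4 → Seq) → Seq
∑ˢ f = f 0F ⊹ (f 1F ⊹ (f 2F ⊹ (f 3F ⊹ const 0ℚ)))

∑ˢ-cong : ∀ {f g : Fin 4 → Seq} → (∀ k → f k ≋ g k) → ∑ˢ f ≋ ∑ˢ g
∑ˢ-cong p = ⊹-cong (p 0F) (⊹-cong (p 1F) (⊹-cong (p 2F) (⊹-cong (p 3F) ≋-refl)))

opaque
  unfolding _⊹_ _•_

  ∑-∑ˢ : ∀ (u : ℝ⁴) → seq (∑ u) ≋ ∑ˢ (λ k → seq (u k))
  ∑-∑ˢ u = ≗⇒≋ λ _ → refl

  pickˢ : ∀ a r (f : Fin 4 → Seq) → ∑ˢ (λ k → (r when (a ≟ k)) • f k) ≋ r • f a
  pickˢ a r f = ≗⇒≋ λ n → pick a r (λ k → f k n)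

apply-to : ∀ {g h} → Represents g h → ∀ v j → seq (apply g v (to h j)) ≋ ±1 (signAt h j) • seq (v j)
apply-to {g} {h} rep v j = begin
  seq (apply g v (to h j))                                    ≈⟨ ∑-∑ˢ (λ k → matrix g (to h j) k * v k) ⟩
  ∑ˢ (λ k n → seq (matrix g (to h j) k) n ℚ.* seq (v k) n)
    ≈⟨ ∑ˢ-cong (λ k → •-mul (v k) (≋-trans (rep (to h j) k)
         (≗⇒≋ λ _ → coefficient-to h j k))) ⟩
  ∑ˢ (λ k → (±1 (signAt h j) when (j ≟ k)) • seq (v k))       ≈⟨ pickˢ j (±1 (signAt h j)) (λ k → seq (v k)) ⟩
  ±1 (signAt h j) • seq (v j)                                 ∎
  where open ≋-Reasoning

opaque
  -- Column `i` vanishes outside row `to h i`, so only the term of that row survives.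
  column-products : ∀ h i j → ∑ℚ (λ k → coefficient h k i ℚ.* coefficient h k j) ≡ (1ℚ when (i ≟ j))
  column-products h i j = begin
    ∑ℚ (λ k → coefficient h k i ℚ.* coefficient h k j)
      ≡⟨ ∑ℚ-cong (λ k → coefficient h k i ℚ.* coefficient h k j)
           (λ k → (±1 (signAt h i) when (to h i ≟ k)) ℚ.* coefficient h k j)
           (λ k → cong (ℚ._* coefficient h k j) (column k)) ⟩
    ∑ℚ (λ k → (±1 (signAt h i) when (to h i ≟ k)) ℚ.* coefficient h k j)
      ≡⟨ pick (to h i) (±1 (signAt h i)) (λ k → coefficient h k j) ⟩
    ±1 (signAt h i) ℚ.* coefficient h (to h i) j
      ≡⟨ cong (±1 (signAt h i) ℚ.*_) (coefficient-to h i j) ⟩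
    ±1 (signAt h i) ℚ.* (±1 (signAt h i) when (i ≟ j))
      ≡⟨ square (signAt h i) (does (i ≟ j)) ⟩
    (1ℚ when (i ≟ j)) ∎
    where
    open ≡-Reasoning
    square : ∀ s b → ±1 s ℚ.* (if b then ±1 s else 0ℚ) ≡ (if b then 1ℚ else 0ℚ)
    square Sign.+ true = refl
    square Sign.+ false = refl
    square Sign.- true = refl
    square Sign.- false = refl
    column : ∀ k → coefficient h k i ≡ (±1 (signAt h i) when (to h i ≟ k))
    column k with k ≟ to h i | to h i ≟ k
    ... | yes refl | yes _ = refl
    ... | yes p    | no q  = contradiction (sym p) q
    ... | no p     | yes q = contradiction (sym q) p
    ... | no _     | no _  = refl

identity-const : ∀ i j n → seq (identity i j) n ≡ (1ℚ when (i ≟ j))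
identity-const i j n with i ≟ j
... | yes _ = refl
... | no  _ = refl

isometry : SignedPerm → Isometry
isometry h = record
  { matrix     = λ i k → fromℚ (coefficient h i k)
  ; orthogonal = λ i j → close (orth i j)
  }
  where
  orth : ∀ i j → seq (∑ (λ k → fromℚ (coefficient h k i) * fromℚ (coefficient h k j))) ≋ seq (identity i j)
  orth i j = ≗⇒≋ λ n → trans (column-products h i j) (sym (identity-const i j n))

isometry-represents : ∀ h → Represents (isometry h) h
isometry-represents h i k = ≋-refl

-- Realisations

opaque
  unfolding _•_ _⊹_

  •-assoc : ∀ q r u → q • r • u ≋ (q ℚ.* r) • u
  •-assoc q r u = ≗⇒≋ λ n → sym (ℚ.*-assoc q r (u n))

  •-identity : ∀ u → 1ℚ • u ≋ u
  •-identity u = ≗⇒≋ λ n → ℚ.*-identityˡ (u n)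

  •-const : ∀ q r → q • const r ≋ const (q ℚ.* r)
  •-const q r = ≗⇒≋ λ _ → refl

  •-⊹ : ∀ q u v → q • (u ⊹ v) ≋ q • u ⊹ q • v
  •-⊹ q u v = ≗⇒≋ λ n → ℚ.*-distribˡ-+ q (u n) (v n)

  •-neg : ∀ x → seq (- x) ≋ (ℚ.- 1ℚ) • seq x
  •-neg x = ≗⇒≋ λ n → negate (seq x n)
    where
    negate : ∀ a → ℚ.- a ≡ (ℚ.- 1ℚ) ℚ.* a
    negate = solve 1 (λ a → :- a := con (ℚ.- 1ℚ) :* a) refl
      where open +-*-Solver

infixr 7 _◂_
_◂_ : Sign → Seq → Seq
s ◂ u = ±1 s • u

◂-cong : ∀ s {u v} → u ≋ v → s ◂ u ≋ s ◂ v
◂-cong s = •-cong (±1 s)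

◂-* : ∀ s t u → s ◂ t ◂ u ≋ (s Sign.* t) ◂ u
◂-* s t u = subst (λ r → s ◂ t ◂ u ≋ r • u) (±1-* s t) (•-assoc (±1 s) (±1 t) u)

◂-cancel : ∀ s u → s ◂ s ◂ u ≋ u
◂-cancel s u = ≋-trans (◂-* s s u)
  (subst (λ t → t ◂ u ≋ u) (sym (Sign.s*s≡+ s)) (•-identity u))

◂-comm : ∀ s t u → s ◂ t ◂ u ≋ t ◂ s ◂ u
◂-comm s t u = ≋-trans (◂-* s t u)
  (subst (λ r → r ◂ u ≋ t ◂ s ◂ u) (Sign.*-comm t s) (≋-sym (◂-* t s u)))

◂-swap : ∀ s {u v} → u ≋ s ◂ v → s ◂ u ≋ v
◂-swap s {u} {v} p = ≋-trans (◂-cong s p) (◂-cancel s v)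

◂-half : ∀ s t → s ◂ const (±½ t) ≋ const (±½ (s Sign.* t))
◂-half s t = subst (λ r → s ◂ const (±½ t) ≋ const r) (±1-½ s t) (•-const (±1 s) (±½ t))

Seq⁴ : Set
Seq⁴ = Fin 4 → Seq

⌊_⌋ : ℝ⁴ → Seq⁴
⌊ v ⌋ i = seq (v i)

infix 4 _≋±_

record _≋±_ (u v : Seq⁴) : Set where
  constructor upTo
  field
    ε     : Sign
    equal : ∀ i → u i ≋ ε ◂ v i

≋⇒≋± : ∀ {u v} → (∀ i → u i ≋ v i) → u ≋± v
≋⇒≋± {u} {v} p = upTo Sign.+ λ i → ≋-trans (p i) (≋-sym (•-identity (v i)))

≋±-sym : ∀ {u v} → u ≋± v → v ≋± u
≋±-sym (upTo ε p) = upTo ε λ i → ≋-sym (◂-swap ε (p i))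

≋±-trans : ∀ {u v w} → u ≋± v → v ≋± w → u ≋± w
≋±-trans {w = w} (upTo ε p) (upTo δ q) = upTo (ε Sign.* δ) λ i →
  ≋-trans (p i) (≋-trans (◂-cong ε (q i)) (◂-* ε δ (w i)))

≈±⇒≋± : ∀ (u v : ℝ⁴) → u ≈± v → ⌊ u ⌋ ≋± ⌊ v ⌋
≈±⇒≋± u v (inj₁ p) = ≋⇒≋± λ i → limit (p i)
≈±⇒≋± u v (inj₂ p) = upTo Sign.- λ i → ≋-trans (limit (p i)) (•-neg (v i))

≋±⇒≈± : ∀ (u v : ℝ⁴) → ⌊ u ⌋ ≋± ⌊ v ⌋ → u ≈± v
≋±⇒≈± u v (upTo Sign.+ p) = inj₁ λ i → close (≋-trans (p i) (•-identity (seq (v i))))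
≋±⇒≈± u v (upTo Sign.- p) = inj₂ λ i → close (≋-trans (p i) (≋-sym (•-neg (v i))))

-- The transposed, hence inverse, matrix applied to `u`.
pullback : SignedPerm → Seq⁴ → Seq⁴
pullback h u j = signAt h j ◂ u (to h j)

pullback-cong : ∀ h {u v} → u ≋± v → pullback h u ≋± pullback h v
pullback-cong h {u} {v} (upTo ε p) = upTo ε λ j →
  ≋-trans (◂-cong (signAt h j) (p (to h j))) (◂-comm (signAt h j) ε (v (to h j)))

pullback-inv : ∀ h u i → pullback (inv h) (pullback h u) i ≋ u i
pullback-inv h u i = subst₂ (λ s k → s ◂ signAt h (from h i) ◂ u k ≋ u i)
  (sym (Vec.lookup∘tabulate (signAt h) (from h i))) (sym (to-from h i))
  (◂-cancel (signAt h (from h i)) (u i))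

pullback-reflects : ∀ h {u v} → pullback h u ≋± pullback h v → u ≋± v
pullback-reflects h {u} {v} p = ≋±-trans (≋±-sym (≋⇒≋± (pullback-inv h u)))
  (≋±-trans (pullback-cong (inv h) p) (≋⇒≋± (pullback-inv h v)))

Carries : SignedPerm → ℙ³ → ℙ³ → Set
Carries h p q = pullback h ⌊ coords q ⌋ ≋± ⌊ coords p ⌋

carries-inv : ∀ h {p q} → Carries h p q → Carries (inv h) q p
carries-inv h {q = q} c = ≋±-trans (pullback-cong (inv h) (≋±-sym c))
  (≋⇒≋± (pullback-inv h ⌊ coords q ⌋))

module _ {g : Isometry} {h : SignedPerm} (rep : Represents g h) where

  pullback-apply : ∀ v j → pullback h ⌊ apply g v ⌋ j ≋ seq (v j)
  pullback-apply v j = ◂-swap (signAt h j) (apply-to {g} {h} rep v j)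

  sends⇒carries : ∀ p q → Sends g p q → Carries h p q
  sends⇒carries p q s = ≋±-trans (pullback-cong h (≈±⇒≋± (coords q) (apply g (coords p)) s))
    (≋⇒≋± (pullback-apply (coords p)))

  carries⇒sends : ∀ p q → Carries h p q → Sends g p q
  carries⇒sends p q c = ≋±⇒≈± (coords q) (apply g (coords p)) (pullback-reflects h
    (≋±-trans c (≋±-sym (≋⇒≋± (pullback-apply (coords p))))))

opaque
  unfolding _•_ _⊹_

  seq-* : ∀ r x → seq (fromℚ r * x) ≋ r • seq x
  seq-* r x = ≗⇒≋ λ _ → refl

image : SignedPerm → ℙ³ → ℙ³
image h p = record { coords = u ; unit = close u-unit }
  where
  u : ℝ⁴
  u i = fromℚ (±1 (lookup (sign h) i)) * coords p (from h i)
  square : ∀ s a → (±1 s ℚ.* a) ℚ.* (±1 s ℚ.* a) ≡ a ℚ.* a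
  square Sign.+ = solve 1 (λ a → (con 1ℚ :* a) :* (con 1ℚ :* a) := a :* a) refl
    where open +-*-Solver
  square Sign.- = solve 1 (λ a → (con (ℚ.- 1ℚ) :* a) :* (con (ℚ.- 1ℚ) :* a) := a :* a) refl
    where open +-*-Solver
  squares : ℕ → Fin 4 → ℚ
  squares n i = seq (coords p i) n ℚ.* seq (coords p i) n
  sum-squares : ∀ n → ∑ℚ (λ i → seq (u i) n ℚ.* seq (u i) n) ≡ ∑ℚ (squares n)
  sum-squares n = trans
    (∑ℚ-cong (λ i → seq (u i) n ℚ.* seq (u i) n) (λ i → squares n (from h i))
      (λ i → square (lookup (sign h) i) (seq (coords p (from h i)) n)))
    (sym (sum-permute (squares n) (permutation (from h) (to h) (from-to h) (to-from h))))
  u-unit : seq (∑ (λ i → u i * u i)) ≋ const 1ℚ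
  u-unit = ≋-trans (≗⇒≋ {v = seq (∑ (λ i → coords p i * coords p i))} sum-squares) (limit (unit p))

image-carries : ∀ h p → Carries h p (image h p)
image-carries h p = ≋⇒≋± λ j → ≋-trans
  (◂-cong (signAt h j) (seq-* (±1 (signAt h j)) (coords p (from h (to h j)))))
  (subst (λ k → signAt h j ◂ signAt h j ◂ seq (coords p (from h (to h j))) ≋ seq (coords p k))
    (from-to h j) (◂-cancel (signAt h j) (seq (coords p (from h (to h j))))))

pullback-vertex : ∀ h x i → pullback h ⌊ vertexCoords (h · x) ⌋ i ≋ ⌊ vertexCoords x ⌋ i
pullback-vertex h x j = subst (λ s → signAt h j ◂ const (±½ (lookup (h · x) (to h j))) ≋ const (±½ s))
  (trans (cong (signAt h j Sign.*_) (·-at h x j)) (cancel-sign (signAt h j) (lookup x j)))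
  (◂-half (signAt h j) (lookup (h · x) (to h j)))

segment : Vertex → Fin 4 → Seq → Seq → Seq⁴
segment x i s t k = ±½ (lookup x k) • s ⊹ ±½ (lookup (flip i x) k) • t

opaque
  ◂-segment : ∀ r a b s t → r ◂ (±½ a • s ⊹ ±½ b • t) ≋ ±½ (r Sign.* a) • s ⊹ ±½ (r Sign.* b) • t
  ◂-segment r a b s t = ≋-trans (•-⊹ (±1 r) (±½ a • s) (±½ b • t)) (⊹-cong (scale a s) (scale b t))
    where
    scale : ∀ a s → r ◂ ±½ a • s ≋ ±½ (r Sign.* a) • s
    scale a s = subst (λ q → r ◂ ±½ a • s ≋ q • s) (±1-½ r a) (•-assoc (±1 r) (±½ a) s)

pullback-segment : ∀ h x i s t k →
  pullback h (segment (h · x) (to h i) s t) k ≋ segment x i s t k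
pullback-segment h x i s t k = subst₂
  (λ a b → pullback h (segment (h · x) (to h i) s t) k ≋ ±½ a • s ⊹ ±½ b • t)
  (pulled x) (trans (cong (λ y → signAt h k Sign.* lookup y (to h k)) (sym (·-flip h i x))) (pulled (flip i x)))
  (◂-segment (signAt h k) (lookup (h · x) (to h k)) (lookup (flip (to h i) (h · x)) (to h k)) s t)
  where
  pulled : ∀ x → signAt h k Sign.* lookup (h · x) (to h k) ≡ lookup x k
  pulled x = trans (cong (signAt h k Sign.*_) (·-at h x k)) (cancel-sign (signAt h k) (lookup x k))

-- `Realisation` for plain coordinate sequences, so that it can be tested at rational constants and
-- moved by `pullback` without proofs of unit length.
data Lies (S : Subgraph) (p : Seq⁴) : Set where
  on-vertex : ∀ x → Vertices S x → p ≋± ⌊ vertexCoords x ⌋ → Lies S p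
  on-edge   : ∀ x i → Edges S (x , i) → ∀ s t → 0ℝ ≤ s → 0ℝ ≤ t →
              p ≋± segment x i (seq s) (seq t) → Lies S p

segment-coords : ∀ x i s t → (∀ k → seq (s * vertexCoords x k + t * vertexCoords (flip i x) k)
                   ≋ segment x i (seq s) (seq t) k)
segment-coords x i s t k = swap s t (±½ (lookup x k)) (±½ (lookup (flip i x) k))
  where
  opaque
    unfolding _•_ _⊹_

    swap : ∀ s t a b → seq (s * fromℚ a + t * fromℚ b) ≋ a • seq s ⊹ b • seq t
    swap s t a b = ≗⇒≋ λ n → cong₂ ℚ._+_ (ℚ.*-comm (seq s n) a) (ℚ.*-comm (seq t n) b)

combination : Edge → ℝ → ℝ → ℝ⁴
combination (x , i) s t k = s * vertexCoords x k + t * vertexCoords (flip i x) k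

realisation⇒lies : ∀ S p → Realisation S p → Lies S ⌊ coords p ⌋
realisation⇒lies S p (inj₁ (x , v , q)) = on-vertex x v (≈±⇒≋± (coords p) (vertexCoords x) q)
realisation⇒lies S p (inj₂ (e@(x , i) , m , s , t , s≥0 , t≥0 , q)) = on-edge x i m s t s≥0 t≥0
  (≋±-trans (≈±⇒≋± (coords p) (combination e s t) q) (≋⇒≋± (segment-coords x i s t)))

lies⇒realisation : ∀ S p → Lies S ⌊ coords p ⌋ → Realisation S p
lies⇒realisation S p (on-vertex x v q) = inj₁ (x , v , ≋±⇒≈± (coords p) (vertexCoords x) q)
lies⇒realisation S p (on-edge x i m s t s≥0 t≥0 q) = inj₂ ((x , i) , m , s , t , s≥0 , t≥0
  , ≋±⇒≈± (coords p) (combination (x , i) s t)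
      (≋±-trans q (≋±-sym (≋⇒≋± (segment-coords x i s t)))))

-- The combinatorial trace of one half of `MapsOnto`; the other half becomes `Image (inv h) B A`.
record Image (h : SignedPerm) (A B : Subgraph) : Set where
  constructor imageOf
  field
    vertices : ∀ x → Vertices A x → Vertices B (h · x)
    edges    : ∀ x i → Edges A (x , i) → Edges B (h · x , to h i)

transport : ∀ h {p q : Seq⁴} {u w} → pullback h q ≋± p → (∀ i → pullback h w i ≋ u i) →
            p ≋± u → q ≋± w
transport h c d r = pullback-reflects h (≋±-trans c (≋±-trans r (≋±-sym (≋⇒≋± d))))

lies-image : ∀ {h A B p q} → Image h A B → pullback h q ≋± p → Lies A p → Lies B q
lies-image {h} (imageOf v e) c (on-vertex x m r) =
  on-vertex (h · x) (v x m) (transport h c (pullback-vertex h x) r)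
lies-image {h} (imageOf v e) c (on-edge x i m s t s≥0 t≥0 r) =
  on-edge (h · x) (to h i) (e x i m) s t s≥0 t≥0
    (transport h c (pullback-segment h x i (seq s) (seq t)) r)

image⇒mapsOnto : ∀ {g h A B} → Represents g h → Image h A B → Image (inv h) B A →
                 MapsOnto g (Realisation A) (Realisation B)
image⇒mapsOnto {g} {h} {A} {B} rep f b =
    (λ p r → image h p
           , lies⇒realisation B (image h p) (lies-image f (image-carries h p) (realisation⇒lies A p r))
           , carries⇒sends {g} {h} rep p (image h p) (image-carries h p))
  , (λ q r → image (inv h) q
           , lies⇒realisation A (image (inv h) q)
               (lies-image b (image-carries (inv h) q) (realisation⇒lies B q r))
           , carries⇒sends {g} {h} rep (image (inv h) q) q (back q))
  where
  back : ∀ q → Carries h (image (inv h) q) q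
  back q = pullback-reflects (inv h) (≋±-trans (≋⇒≋± (pullback-inv h ⌊ coords q ⌋))
    (≋±-sym (image-carries (inv h) q)))

-- Recovering a subgraph from its realisation

±½-injective : ∀ {s t} → ±½ s ≡ ±½ t → s ≡ t
±½-injective {Sign.+} {Sign.+} _ = refl
±½-injective {Sign.- } {Sign.- } _ = refl

separate : ∀ {r p q} → p ≋± const ∘ r → p ≋± q → ∃ λ ε → ∀ i → q i ≋ ε ◂ const (r i)
separate a b with ≋±-trans (≋±-sym b) a
... | upTo ε p = ε , p

∘const-injective : ∀ {q r : Fin 4 → ℚ} ε → (∀ i → const (q i) ≋ ε ◂ const (r i)) → ∀ i → q i ≡ ±1 ε ℚ.* r i
∘const-injective {r = r} ε p i = const-injective (≋-trans (p i) (•-const (±1 ε) (r i)))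

segment-at : ∀ x i s t k → k ≢ i → segment x i s t k ≋ lookup x k ◂ (½ • s ⊹ ½ • t)
segment-at x i s t k k≢i = ≋-sym (subst₂
  (λ a b → lookup x k ◂ (½ • s ⊹ ½ • t) ≋ ±½ a • s ⊹ ±½ b • t)
  (Sign.*-identityʳ (lookup x k))
  (trans (Sign.*-identityʳ (lookup x k)) (sym (Vec.lookup∘updateAt′ k i k≢i x)))
  (◂-segment (lookup x k) Sign.+ Sign.+ s t))

-- On the line through [x] and [flip i x] the coordinates other than i are proportional to
-- those of x, whatever s and t are.
aligned : ∀ x i (r : Fin 4 → ℚ) {s t p} → p ≋± const ∘ r → p ≋± segment x i s t → ∀ k l → k ≢ i → l ≢ i →
          ±1 (lookup x k) ℚ.* r k ≡ ±1 (lookup x l) ℚ.* r l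
aligned x i r {s} {t} {p} a b k l k≢i l≢i =
  const-injective (≋-trans (≋-sym (common k k≢i)) (common l l≢i))
  where
  open _≋±_ (≋±-trans (≋±-sym b) a) using (ε; equal)
  common : ∀ k → k ≢ i → ε ◂ (½ • s ⊹ ½ • t) ≋ const (±1 (lookup x k) ℚ.* r k)
  common k k≢i = begin
    ε ◂ (½ • s ⊹ ½ • t)                    ≈⟨ ◂-cong ε (◂-swap (lookup x k)
                                                (≋-trans (≋-sym (equal k)) (segment-at x i s t k k≢i))) ⟨
    ε ◂ lookup x k ◂ ε ◂ const (r k)       ≈⟨ ◂-comm ε (lookup x k) (ε ◂ const (r k)) ⟩
    lookup x k ◂ ε ◂ ε ◂ const (r k)       ≈⟨ ◂-cong (lookup x k) (◂-cancel ε (const (r k))) ⟩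
    lookup x k ◂ const (r k)               ≈⟨ •-const (±1 (lookup x k)) (r k) ⟩
    const (±1 (lookup x k) ℚ.* r k)        ∎
    where open ≋-Reasoning

Proportional : Vertex → Fin 4 → Vertex → Set
Proportional x i y = ∀ k l → k ≢ i → l ≢ i → lookup x k Sign.* lookup y k ≡ lookup x l Sign.* lookup y l

opaque
  -- Up to antipode `y` agrees with `x` at the three other coordinates, and its two possible signs
  -- at `i` give the two endpoints.
  proportional⇒endpoint : ∀ x i y → Proportional x i y → Endpoint (x , i) y
  proportional⇒endpoint = toWitness {a? = vertices? λ x → all? λ i → vertices? λ y →
    (all? λ k → all? λ l → ¬? (k ≟ i) →-dec (¬? (l ≟ i) →-dec (_ Sign.≟ _)))
    →-dec ((y ∼? x) ⊎-dec (y ∼? flip i x))} tt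

sign-multiple⇒∼ : ∀ {x y} ε → (∀ i → lookup x i ≡ ε Sign.* lookup y i) → x ∼ y
sign-multiple⇒∼ Sign.+ p = inj₁ (ext p)
sign-multiple⇒∼ {x} {y} Sign.- p = inj₂ (ext λ i → trans (p i)
  (trans (opposite-* (lookup y i)) (sym (Vec.lookup-map i Sign.opposite y))))
  where
  opposite-* : ∀ s → Sign.- Sign.* s ≡ Sign.opposite s
  opposite-* Sign.+ = refl
  opposite-* Sign.- = refl

lies-vertex : ∀ {S p y} → Lies S p → p ≋± ⌊ vertexCoords y ⌋ → Vertices S y
lies-vertex {S} {p} {y} (on-vertex x v q) r with separate {λ i → ±½ (lookup y i)} r q
... | ε , e = subst T (vertex?-cong S (sign-multiple⇒∼ ε λ i → ±½-injective
  (trans (∘const-injective ε e i) (±1-½ ε (lookup y i))))) v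
-- A vertex point on the segment of an edge is one of its ends, and `S` contains the ends of its
-- edges.
lies-vertex {S} {p} {y} (on-edge x i m s t _ _ q) r = endpoints S m
  (proportional⇒endpoint x i y λ k l k≢i l≢i → ±½-injective
    (trans (sym (±1-½ (lookup x k) (lookup y k)))
      (trans (aligned x i (λ k → ±½ (lookup y k)) r q k l k≢i l≢i) (±1-½ (lookup x l) (lookup y l)))))

-- interior y j is the point (3 u + 5 v) / 7 of the edge from u = [y] in direction j: a unit
-- vector with rational coordinates, since u and v have inner product 1/2.
weight : Bool → ℚ
weight true  = -[1+ 0 ] ℚ./ 7
weight false = + 4 ℚ./ 7

interior : Vertex → Fin 4 → Fin 4 → ℚ
interior y j k = ±1 (lookup y k) ℚ.* weight (does (j ≟ k))

opaque
  interior-combination : ∀ y j k →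
    ±½ (lookup y k) ℚ.* (+ 3 ℚ./ 7) ℚ.+ ±½ (lookup (flip j y) k) ℚ.* (+ 5 ℚ./ 7) ≡ interior y j k
  interior-combination = toWitness {a? = vertices? λ y → all? λ j → all? λ k → _ ℚ.≟ _} tt

  interior-unit : ∀ y j → ∑ℚ (λ k → interior y j k ℚ.* interior y j k) ≡ 1ℚ
  interior-unit = toWitness {a? = vertices? λ y → all? λ j → _ ℚ.≟ _} tt

  interior-not-vertex : ∀ s x y b → ±½ x ≢ ±1 s ℚ.* (±1 y ℚ.* weight b)
  interior-not-vertex = toWitness {a? = signs? λ s → signs? λ x → signs? λ y → bools? λ b → ¬? (_ ℚ.≟ _)} tt

  -- The absolute values 1/7 = |3 - 5| / 14 and 4/7 = (3 + 5) / 14 reveal `b`, after which the signs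
  -- can be compared.
  weights-differ : ∀ x y b x′ y′ b′ → ±1 x ℚ.* (±1 y ℚ.* weight b) ≡ ±1 x′ ℚ.* (±1 y′ ℚ.* weight b′) →
                   b ≡ b′ × x Sign.* y ≡ x′ Sign.* y′
  weights-differ = toWitness {a? = signs? λ x → signs? λ y → bools? λ b → signs? λ x′ → signs? λ y′ → bools? λ b′ →
    (_ ℚ.≟ _) →-dec ((b Bool.≟ b′) ×-dec (_ Sign.≟ _))} tt

  -- The three coordinates other than `i` cannot all look alike if `j` is one of them.
  isolated : ∀ (i j : Fin 4) → (∀ k l → k ≢ i → l ≢ i → does (j ≟ k) ≡ does (j ≟ l)) → j ≡ i
  isolated = toWitness {a? = all? λ i → all? λ j →
    (all? λ k → all? λ l → ¬? (k ≟ i) →-dec (¬? (l ≟ i) →-dec (_ Bool.≟ _))) →-dec (j ≟ i)} tt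

-- An edge of Γ may join two vertices of `S` without belonging to `S`, so vertex points do not
-- detect edges. At an interior point `aligned` recovers first the direction of the edge and then
-- its ends.
lies-interior : ∀ {S p y j} → Lies S p → p ≋± const ∘ interior y j → Edges S (y , j)
lies-interior {y = y} {j} (on-vertex x v q) r with separate {interior y j} r q
... | ε , e = contradiction (∘const-injective ε e 0F)
  (interior-not-vertex ε (lookup x 0F) (lookup y 0F) (does (j ≟ 0F)))
lies-interior {S} {p} {y} {j} (on-edge x i m s t _ _ q) r =
  subst T (sym (edge?-cong S (j≡i , ends))) m
  where
  both : ∀ k l → k ≢ i → l ≢ i →
    does (j ≟ k) ≡ does (j ≟ l) × lookup x k Sign.* lookup y k ≡ lookup x l Sign.* lookup y l
  both k l k≢i l≢i = weights-differ (lookup x k) (lookup y k) (does (j ≟ k)) (lookup x l) (lookup y l) (does (j ≟ l))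
    (aligned x i (interior y j) r q k l k≢i l≢i)
  j≡i : j ≡ i
  j≡i = isolated i j λ k l a b → proj₁ (both k l a b)
  ends : Endpoint (x , i) y
  ends = proportional⇒endpoint x i y λ k l a b → proj₂ (both k l a b)

interiorPoint : Vertex → Fin 4 → ℙ³
interiorPoint y j = record
  { coords = λ k → fromℚ (interior y j k)
  ; unit   = close (≗⇒≋ {seq (∑ λ k → fromℚ (interior y j k) * fromℚ (interior y j k))} {const 1ℚ}
      λ _ → interior-unit y j)
  }

0≤const : ∀ r → 0ℚ ℚ.≤ r → 0ℝ ≤ fromℚ r
0≤const r 0≤r ε ε>0 = 0 , λ _ _ → ℚ.+-mono-≤-< 0≤r ε>0

interior-segment : ∀ y j k → const (interior y j k) ≋ segment y j (const (+ 3 ℚ./ 7)) (const (+ 5 ℚ./ 7)) k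
interior-segment y j k = subst (λ r → const r ≋ segment y j (const (+ 3 ℚ./ 7)) (const (+ 5 ℚ./ 7)) k)
  (interior-combination y j k)
  (≋-sym (constants (±½ (lookup y k)) (±½ (lookup (flip j y) k)) (+ 3 ℚ./ 7) (+ 5 ℚ./ 7)))
  where
  opaque
    unfolding _•_ _⊹_

    constants : ∀ a b s t → a • const s ⊹ b • const t ≋ const (a ℚ.* s ℚ.+ b ℚ.* t)
    constants a b s t = ≗⇒≋ λ _ → refl

interior-lies : ∀ {S y j} → Edges S (y , j) → Lies S (const ∘ interior y j)
interior-lies {y = y} {j} m = on-edge y j m (fromℚ (+ 3 ℚ./ 7)) (fromℚ (+ 5 ℚ./ 7))
  (0≤const _ (ℚ.nonNegative⁻¹ _)) (0≤const _ (ℚ.nonNegative⁻¹ _)) (≋⇒≋± (interior-segment y j))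

MapsInto : Isometry → Subgraph → Subgraph → Set
MapsInto g A B = ∀ p → Realisation A p → ∃ λ q → Realisation B q × Sends g p q

-- It suffices to follow the vertex points and the chosen interior points, because signed
-- permutations carry each kind to itself.
mapsInto⇒image : ∀ {g h A B} → Represents g h → MapsInto g A B → Image h A B
mapsInto⇒image {g} {h} {A} {B} rep f = imageOf vertices edges
  where
  vertices : ∀ x → Vertices A x → Vertices B (h · x)
  vertices x m = lies-vertex (realisation⇒lies B q (proj₁ (proj₂ sent)))
    (transport h (sends⇒carries {g} {h} rep (vertexPoint x) q (proj₂ (proj₂ sent)))
      (pullback-vertex h x) (≋⇒≋± λ _ → ≋-refl))
    where
    sent : ∃ λ q → Realisation B q × Sends g (vertexPoint x) q
    sent = f (vertexPoint x) (lies⇒realisation A (vertexPoint x) (on-vertex x m (≋⇒≋± λ _ → ≋-refl)))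
    q : ℙ³
    q = proj₁ sent
  edges : ∀ x i → Edges A (x , i) → Edges B (h · x , to h i)
  edges x i m = lies-interior (realisation⇒lies B q (proj₁ (proj₂ sent)))
    (≋±-trans (transport h (sends⇒carries {g} {h} rep (interiorPoint x i) q (proj₂ (proj₂ sent)))
        (pullback-segment h x i (const (+ 3 ℚ./ 7)) (const (+ 5 ℚ./ 7)))
        (≋⇒≋± (interior-segment x i)))
      (≋±-sym (≋⇒≋± (interior-segment (h · x) (to h i)))))
    where
    sent : ∃ λ q → Realisation B q × Sends g (interiorPoint x i) q
    sent = f (interiorPoint x i) (lies⇒realisation A (interiorPoint x i) (interior-lies m))
    q : ℙ³
    q = proj₁ sent

mapsOnto⇒image : ∀ {g h A B} → Represents g h → MapsOnto g (Realisation A) (Realisation B) →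
                 Image h A B × Image (inv h) B A
mapsOnto⇒image {g} {h} {A} {B} rep (f , b) = mapsInto⇒image {g} {h} {A} {B} rep f
  , mapsInto⇒image {isometry (inv h)} {inv h} {B} {A} (isometry-represents (inv h)) back
  where
  back : MapsInto (isometry (inv h)) B A
  back q l = p , proj₁ (proj₂ (b q l))
    , carries⇒sends {isometry (inv h)} {inv h} (isometry-represents (inv h)) q p
        (carries-inv h {p} {q} (sends⇒carries {g} {h} rep p q (proj₂ (proj₂ (b q l)))))
    where
    p : ℙ³
    p = proj₁ (b q l)

-- Isometries permuting the vertices

difference : Sign → Sign → ℚ
difference s t = ±½ s ℚ.+ (ℚ.- 1ℚ) ℚ.* ±½ t

opaque
  -- The sum counts the coordinates in which `y` and `z` differ.
  adjacent-column : ∀ y z →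
    ∑ℚ (λ k → difference (lookup y k) (lookup z k) ℚ.* difference (lookup y k) (lookup z k)) ≡ 1ℚ →
    ∃ λ a → z ≡ flip a y
  adjacent-column = toWitness {a? = vertices? λ y → vertices? λ z → (_ ℚ.≟ _) →-dec any? λ a → z ≟ⱽ _} tt

  difference-flip : ∀ y a i → difference (lookup y i) (lookup (flip a y) i) ≡ (±1 (lookup y i) when (i ≟ a))
  difference-flip = toWitness {a? = vertices? λ y → all? λ a → all? λ i → _ ℚ.≟ _} tt

opaque
  unfolding _•_ _⊹_

  -- e_j is the difference of the vertex vectors x₀ and flip j x₀.
  entry-difference : ∀ (m : ℝ⁴) j → seq (m j) ≋
    seq (∑ λ k → m k * vertexCoords x₀ k) ⊹ (ℚ.- 1ℚ) • seq (∑ λ k → m k * vertexCoords (flip j x₀) k)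
  entry-difference m j = ≗⇒≋ λ n → column j (λ k → seq (m k) n)
    where
    open +-*-Solver
    column : ∀ j (f : Fin 4 → ℚ) → f j ≡ ∑ℚ (λ k → f k ℚ.* ½) ℚ.+
      (ℚ.- 1ℚ) ℚ.* ∑ℚ (λ k → f k ℚ.* ±½ (lookup (flip j x₀) k))
    column 0F f = solve 4 (λ a b c d → a :=
      (a :* con ½ :+ (b :* con ½ :+ (c :* con ½ :+ (d :* con ½ :+ con 0ℚ)))) :+ con (ℚ.- 1ℚ) :*
      (a :* con (ℚ.- ½) :+ (b :* con ½ :+ (c :* con ½ :+ (d :* con ½ :+ con 0ℚ))))) refl
      (f 0F) (f 1F) (f 2F) (f 3F)
    column 1F f = solve 4 (λ a b c d → b :=
      (a :* con ½ :+ (b :* con ½ :+ (c :* con ½ :+ (d :* con ½ :+ con 0ℚ)))) :+ con (ℚ.- 1ℚ) :*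
      (a :* con ½ :+ (b :* con (ℚ.- ½) :+ (c :* con ½ :+ (d :* con ½ :+ con 0ℚ))))) refl
      (f 0F) (f 1F) (f 2F) (f 3F)
    column 2F f = solve 4 (λ a b c d → c :=
      (a :* con ½ :+ (b :* con ½ :+ (c :* con ½ :+ (d :* con ½ :+ con 0ℚ)))) :+ con (ℚ.- 1ℚ) :*
      (a :* con ½ :+ (b :* con ½ :+ (c :* con (ℚ.- ½) :+ (d :* con ½ :+ con 0ℚ))))) refl
      (f 0F) (f 1F) (f 2F) (f 3F)
    column 3F f = solve 4 (λ a b c d → d :=
      (a :* con ½ :+ (b :* con ½ :+ (c :* con ½ :+ (d :* con ½ :+ con 0ℚ)))) :+ con (ℚ.- 1ℚ) :*
      (a :* con ½ :+ (b :* con ½ :+ (c :* con ½ :+ (d :* con (ℚ.- ½) :+ con 0ℚ))))) refl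
      (f 0F) (f 1F) (f 2F) (f 3F)

  const-⊹ : ∀ p q → const p ⊹ const q ≋ const (p ℚ.+ q)
  const-⊹ p q = ≗⇒≋ λ _ → refl

  ∑ˢ-const : ∀ f → ∑ˢ (λ k → const (f k)) ≋ const (∑ℚ f)
  ∑ˢ-const f = ≗⇒≋ λ _ → refl

Exactly : Isometry → Vertex → Vertex → Set
Exactly g x y = ∀ i → seq (apply g (vertexCoords x) i) ≋ const (±½ (lookup y i))

module Columns (g : Isometry) (y₀ : Vertex) (z : Fin 4 → Vertex)
         (y₀-exact : Exactly g x₀ y₀) (z-exact : ∀ j → Exactly g (flip j x₀) (z j)) where

  private
    δ : Fin 4 → Fin 4 → ℚ
    δ i j = difference (lookup y₀ i) (lookup (z j) i)

    matrix-entry : ∀ i j → seq (matrix g i j) ≋ const (δ i j)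
    matrix-entry i j = ≋-trans (entry-difference (matrix g i) j) (≋-trans
      (⊹-cong (y₀-exact i) (≋-trans (•-cong (ℚ.- 1ℚ) (z-exact j i))
        (•-const (ℚ.- 1ℚ) (±½ (lookup (z j) i)))))
      (const-⊹ (±½ (lookup y₀ i)) ((ℚ.- 1ℚ) ℚ.* ±½ (lookup (z j) i))))

    columns : ∀ i j → ∑ℚ (λ k → δ k i ℚ.* δ k j) ≡ (1ℚ when (i ≟ j))
    columns i j = const-injective (begin
      const (∑ℚ λ k → δ k i ℚ.* δ k j)                    ≈⟨ ∑ˢ-const (λ k → δ k i ℚ.* δ k j) ⟨
      ∑ˢ (λ k → const (δ k i ℚ.* δ k j))
        ≈⟨ ∑ˢ-cong (λ k → ≋-trans (•-mul (matrix g k j) (matrix-entry k i))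
             (≋-trans (•-cong (δ k i) (matrix-entry k j)) (•-const (δ k i) (δ k j)))) ⟨
      ∑ˢ (λ k → seq (matrix g k i * matrix g k j))        ≈⟨ ∑-∑ˢ (λ k → matrix g k i * matrix g k j) ⟨
      seq (∑ λ k → matrix g k i * matrix g k j)           ≈⟨ limit (orthogonal g i j) ⟩
      seq (identity i j)                                  ≈⟨ ≗⇒≋ (identity-const i j) ⟩
      const (1ℚ when (i ≟ j))                             ∎)
      where open ≋-Reasoning

    column-unit : ∀ j → ∑ℚ (λ k → δ k j ℚ.* δ k j) ≡ 1ℚ
    column-unit j = trans (columns j j) (cong (λ b → if b then 1ℚ else 0ℚ) (dec-true (j ≟ j) refl))

    τ : Fin 4 → Fin 4
    τ j = proj₁ (adjacent-column y₀ (z j) (column-unit j))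

    z-flip : ∀ j → z j ≡ flip (τ j) y₀
    z-flip j = proj₂ (adjacent-column y₀ (z j) (column-unit j))

    when-one : ∀ (i j : Fin 4) → (1ℚ when (i ≟ j)) ≡ 1ℚ → i ≡ j
    when-one i j p with i ≟ j
    ... | yes i≡j = i≡j
    ... | no _    = contradiction p λ ()

    -- If `τ i ≡ τ j`, then columns `i` and `j` coincide, so their inner product is 1, which
    -- `orthogonal` permits only for `i ≡ j`.
    τ-injective : ∀ i j → τ i ≡ τ j → i ≡ j
    τ-injective i j p = when-one i j (trans (sym (columns i j)) (trans
      (cong (λ w → ∑ℚ λ k → δ k i ℚ.* difference (lookup y₀ k) (lookup w k))
        (trans (z-flip j) (trans (cong (λ a → flip a y₀) (sym p)) (sym (z-flip i)))))
      (column-unit i)))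

  signedPerm : SignedPerm
  signedPerm = record
    { sign   = y₀
    ; perm   = tabulate τ
    ; isPerm = injective⇒perm (tabulate τ) λ i j p → τ-injective i j
        (trans (sym (Vec.lookup∘tabulate τ i)) (trans p (Vec.lookup∘tabulate τ j)))
    }

  represents : Represents g signedPerm
  represents i k = subst (λ r → seq (matrix g i k) ≋ const r)
    (trans (cong (λ w → difference (lookup y₀ i) (lookup w i)) (z-flip k))
      (trans (difference-flip y₀ (τ k) i)
        (cong (λ a → ±1 (lookup y₀ i) when (i ≟ a)) (sym (Vec.lookup∘tabulate τ k)))))
    (matrix-entry i k)

isometry-signedPerm : ∀ g → (∀ x → ∃ λ y → vertexCoords y ≈± apply g (vertexCoords x)) →
                      ∃ λ h → Represents g h
isometry-signedPerm g permutes =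
    Columns.signedPerm g y₀ z y₀-exact z-exact
  , Columns.represents g y₀ z y₀-exact z-exact
  where
  up : ∀ x → ⌊ vertexCoords (proj₁ (permutes x)) ⌋ ≋± ⌊ apply g (vertexCoords x) ⌋
  up x = ≈±⇒≋± (vertexCoords (proj₁ (permutes x))) (apply g (vertexCoords x)) (proj₂ (permutes x))
  signed : Sign → Vertex → Vertex
  signed ε = Vec.map (ε Sign.*_)
  -- The sign left open by `≈±` is moved into the vertex, so that differences of vertex vectors are
  -- exactly the columns of the matrix.
  exact : ∀ x y → (p : ⌊ vertexCoords y ⌋ ≋± ⌊ apply g (vertexCoords x) ⌋) →
          Exactly g x (signed (_≋±_.ε p) y)
  exact x y (upTo ε q) i =
    subst (λ s → seq (apply g (vertexCoords x) i) ≋ const (±½ s)) (sym (Vec.lookup-map i (ε Sign.*_) y))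
      (≋-trans (≋-sym (◂-swap ε (q i))) (◂-half ε (lookup y i)))
  y₀ : Vertex
  y₀ = signed (_≋±_.ε (up x₀)) (proj₁ (permutes x₀))
  z : Fin 4 → Vertex
  z j = signed (_≋±_.ε (up (flip j x₀))) (proj₁ (permutes (flip j x₀)))
  y₀-exact : Exactly g x₀ y₀
  y₀-exact = exact x₀ (proj₁ (permutes x₀)) (up x₀)
  z-exact : ∀ j → Exactly g (flip j x₀) (z j)
  z-exact j = exact (flip j x₀) (proj₁ (permutes (flip j x₀))) (up (flip j x₀))

-- Action on the colours

opaque
  parity-zipWith : ∀ y v → parity (zipWith Sign._*_ y v) ≡ parity y Sign.* parity v
  parity-zipWith = toWitness {a? = vertices? λ y → vertices? λ v → _ Sign.≟ _} tt

opaque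
  unfolding inverse act

  parity-permute : ∀ σ → IsPerm σ → ∀ x → parity (tabulate λ i → lookup x (lookup (inverse σ) i)) ≡ parity x
  parity-permute = toWitness {a? = perms? λ σ → vertices? λ x → _ Sign.≟ _} tt

  parity-· : ∀ h x → parity (h · x) ≡ parity (sign h) Sign.* parity x
  parity-· h x = trans (parity-zipWith (sign h) _)
    (cong (parity (sign h) Sign.*_) (parity-permute (perm h) (isPerm h) x))

·-x₀ : ∀ h → h · x₀ ≡ sign h
·-x₀ h = ext-to h λ j → trans (·-at h x₀ j)
  (trans (cong (signAt h j Sign.*_) (x₀-at j)) (Sign.*-identityʳ (signAt h j)))
  where
  x₀-at : ∀ j → lookup x₀ j ≡ Sign.+
  x₀-at 0F = refl
  x₀-at 1F = refl
  x₀-at 2F = refl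
  x₀-at 3F = refl

inverse∘ : ∀ ρ → IsPerm ρ → ∀ a → lookup (inverse ρ) (lookup ρ a) ≡ a
inverse∘ ρ p a = trans (sym (lookup-⊙ (inverse ρ) ρ a))
  (trans (cong (λ v → lookup v a) (inverse-left ρ p)) (lookup-ι a))

push : Map → Subset 4 → Subset 4
push ρ K = tabulate λ a → lookup K (lookup (inverse ρ) a)

lookup-push : ∀ ρ K a → lookup (push ρ K) a ≡ lookup K (lookup (inverse ρ) a)
lookup-push ρ K = Vec.lookup∘tabulate λ a → lookup K (lookup (inverse ρ) a)

module _ (ρ : Map) (ρ-perm : IsPerm ρ) where

  ∈-push : ∀ {K a} → a ∈ˢ K → lookup ρ a ∈ˢ push ρ K
  ∈-push {K} {a} m = Vec.lookup⇒[]= (lookup ρ a) (push ρ K) (trans (lookup-push ρ K (lookup ρ a))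
    (trans (cong (lookup K) (inverse∘ ρ ρ-perm a)) (Vec.[]=⇒lookup m)))

  inverse-push : ∀ K → push (inverse ρ) (push ρ K) ≡ K
  inverse-push K = ext λ a → trans (lookup-push (inverse ρ) (push ρ K) a)
    (trans (lookup-push ρ K (lookup (inverse (inverse ρ)) a))
      (cong (lookup K) (trans (cong (λ σ → lookup (inverse ρ) (lookup σ a)) (inverse-involutive ρ ρ-perm))
        (inverse∘ ρ ρ-perm a))))

  ∣push∣ : ∀ K → ∣ push ρ K ∣ ≡ ∣ K ∣
  ∣push∣ = ∣∘perm∣ (inverse ρ) (inverse-perm ρ ρ-perm)

  push-mono : ∀ {K L} → K ⊆ L → push ρ K ⊆ push ρ L
  push-mono {K} {L} K⊆L {a} m = Vec.lookup⇒[]= a (push ρ L) (trans (lookup-push ρ L a)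
    (Vec.[]=⇒lookup (K⊆L (Vec.lookup⇒[]= _ K (trans (sym (lookup-push ρ K a)) (Vec.[]=⇒lookup m))))))

·-∼ᴱ : ∀ h {x i y j} → (x , i) ∼ᴱ (y , j) → (h · x , to h i) ∼ᴱ (h · y , to h j)
·-∼ᴱ h (refl , inj₁ p) = refl , inj₁ (·-∼ h p)
·-∼ᴱ h {x} {i} {y} (refl , inj₂ p) = refl , inj₂ (subst (h · x ∼_) (·-flip h i y) (·-∼ h p))

module Recolouring (α : Bool) where
  open Coloured α

  Recolours : SignedPerm → Map → Set
  Recolours h ρ = ∀ x i → model α (h · x , to h i) ≡ lookup ρ (model α (x , i))

  preserves⇒recolours : ∀ {h ρ} → Preserves α (sign h) (perm h) ρ → Recolours h ρ
  preserves⇒recolours {h} {ρ} p x i with even-cover x i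
  ... | k , e = trans (model-cong α (·-∼ᴱ h e)) (trans (p k i) (cong (lookup ρ) (sym (model-cong α e))))

  recolours-inv : ∀ {h ρ} → IsPerm ρ → Recolours h ρ → Recolours (inv h) (inverse ρ)
  recolours-inv {h} {ρ} ρ-perm r x i = begin
    model α (inv h · x , from h i)
      ≡⟨ inverse∘ ρ ρ-perm _ ⟨
    lookup (inverse ρ) (lookup ρ (model α (inv h · x , from h i)))
      ≡⟨ cong (lookup (inverse ρ)) (r (inv h · x) (from h i)) ⟨
    lookup (inverse ρ) (model α (h · inv h · x , to h (from h i)))
      ≡⟨ cong₂ (λ y j → lookup (inverse ρ) (model α (y , j))) (·-inv h x) (to-from h i) ⟩
    lookup (inverse ρ) (model α (x , i)) ∎
    where open ≡-Reasoning

  near-map : ∀ {h ρ} → IsPerm ρ → Recolours h ρ → ∀ {K x y} →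
             Near K x y → Near (push ρ K) (h · x) (h · y)
  near-map {h} {ρ} ρ-perm r {K} n = conn⇒near (Star.gmap (h ·_) step (near⇒conn n))
    where
    step : ∀ {x y} → x ∼ y ⊎ (∃ λ i → model α (x , i) ∈ˢ K × y ≡ flip i x) →
           h · x ∼ h · y ⊎ (∃ λ i → model α (h · x , i) ∈ˢ push ρ K × h · y ≡ flip i (h · x))
    step (inj₁ p) = inj₁ (·-∼ h p)
    step {x} (inj₂ (i , m , refl)) =
      inj₂ (to h i , subst (_∈ˢ push ρ K) (sym (r x i)) (∈-push ρ ρ-perm m) , ·-flip h i x)

  comp-image : ∀ {h ρ} → IsPerm ρ → Recolours h ρ → ∀ {x K S S′} →
               IsComp x K S → IsComp (h · x) (push ρ K) S′ → Image h S S′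
  comp-image {h} {ρ} ρ-perm r {K = K} (isComp (v , _) (e , _)) (isComp (_ , v′) (_ , e′)) = imageOf
    (λ y t → v′ (near-map {h} {ρ} ρ-perm r (v t)))
    (λ y i t → e′ ( subst (_∈ˢ push ρ K) (sym (r y i)) (∈-push ρ ρ-perm (proj₁ (e t)))
                  , near-map {h} {ρ} ρ-perm r (proj₂ (e t))))

  comp-image-inv : ∀ {h ρ} → IsPerm ρ → Recolours h ρ → ∀ {x K S S′} →
                   IsComp x K S → IsComp (h · x) (push ρ K) S′ → Image (inv h) S′ S
  comp-image-inv {h} {ρ} ρ-perm r {x} {K} {S} c c′ =
    comp-image {inv h} {inverse ρ} (inverse-perm ρ ρ-perm) (recolours-inv {h} {ρ} ρ-perm r) c′
      (subst₂ (λ y L → IsComp y L S) (sym (inv-· h x)) (sym (inverse-push ρ ρ-perm K)) c)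

  image-comp : ∀ {h ρ} → IsPerm ρ → Recolours h ρ → ∀ {x K S S′} → IsComp x K S →
               Image h S S′ → Image (inv h) S′ S → IsComp (h · x) (push ρ K) S′
  image-comp {h} {ρ} ρ-perm r {x} {K} {S} {S′} (isComp (v , v′) (e , e′)) (imageOf f f′) (imageOf b b′) = isComp
    ( (λ {y} t → subst (Near (push ρ K) (h · x)) (·-inv h y) (near-map {h} {ρ} ρ-perm r (v (b y t))))
    , λ {y} n → subst (Vertices S′) (·-inv h y) (f (inv h · y) (v′ (back n))))
    ( (λ { {y , i} t → subst₂ (λ z j → model α (z , j) ∈ˢ push ρ K × Near (push ρ K) (h · x) z)
             (·-inv h y) (to-from h i) (over (inv h · y) (from h i) (e (b′ y i t))) })
    , λ { {y , i} (m , n) → subst₂ (λ z j → Edges S′ (z , j)) (·-inv h y) (to-from h i)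
            (f′ (inv h · y) (from h i) (e′ (below y i m , back n))) })
    where
    back : ∀ {y} → Near (push ρ K) (h · x) y → Near K x (inv h · y)
    back {y} n = subst₂ (λ z L → Near L z (inv h · y)) (inv-· h x) (inverse-push ρ ρ-perm K)
      (near-map {inv h} {inverse ρ} (inverse-perm ρ ρ-perm) (recolours-inv {h} {ρ} ρ-perm r) n)
    over : ∀ y i → model α (y , i) ∈ˢ K × Near K x y →
           model α (h · y , to h i) ∈ˢ push ρ K × Near (push ρ K) (h · x) (h · y)
    over y i (m , n) = subst (_∈ˢ push ρ K) (sym (r y i)) (∈-push ρ ρ-perm m) , near-map {h} {ρ} ρ-perm r n
    below : ∀ y i → model α (y , i) ∈ˢ push ρ K → model α (inv h · y , from h i) ∈ˢ K
    below y i m = subst₂ _∈ˢ_ (sym (recolours-inv {h} {ρ} ρ-perm r y i)) (inverse-push ρ ρ-perm K)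
      (∈-push (inverse ρ) (inverse-perm ρ ρ-perm) m)

  -- Hence every facet contains all vertices: passing to the antipode corrects the only fixed
  -- coordinate.
  joined-∁ : ∀ a {z w} → Joined (Subset.∁ ⁅ a ⁆) z w
  joined-∁ a {z} {w} with lookup z a Sign.≟ lookup w a
  ... | yes p = same (agree at-b)
    where
    at-b : ∀ b → b ∈ˢ Subset.∁ ⁅ a ⁆ ⊎ lookup z b ≡ lookup w b
    at-b b with b ≟ a
    ... | yes refl = inj₂ p
    ... | no b≢a = inj₁ (x∉p⇒x∈∁p λ m → b≢a (x∈⁅y⁆⇒x≡y a m))
  ... | no ¬p = opposite (agree at-b)
    where
    flipped : ∀ s t → s ≢ t → s ≡ Sign.opposite t
    flipped Sign.+ Sign.+ q = contradiction refl q
    flipped Sign.+ Sign.- q = refl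
    flipped Sign.- Sign.+ q = refl
    flipped Sign.- Sign.- q = contradiction refl q
    at-b : ∀ b → b ∈ˢ Subset.∁ ⁅ a ⁆ ⊎ lookup z b ≡ lookup (antipode w) b
    at-b b with b ≟ a
    ... | yes refl = inj₂ (trans (flipped _ _ ¬p) (sym (lookup-antipode a w)))
    ... | no b≢a = inj₁ (x∉p⇒x∈∁p λ m → b≢a (x∈⁅y⁆⇒x≡y a m))

  induced-perm : ∀ h → IsPerm (induced α (sign h) (perm h))
  induced-perm h = injective⇒perm _ λ i j p → to-injective h (begin
    to h i                                   ≡⟨ dir-model α (sign h) (to h i) ⟨
    dir α (sign h) (model α (sign h , to h i))   ≡⟨ cong (dir α (sign h)) (trans (sym (at-i i)) (trans p (at-i j))) ⟩
    dir α (sign h) (model α (sign h , to h j))   ≡⟨ dir-model α (sign h) (to h j) ⟩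
    to h j                                   ∎)
    where
    open ≡-Reasoning
    at-i : ∀ i → lookup (induced α (sign h) (perm h)) i ≡ model α (sign h , to h i)
    at-i = Vec.lookup∘tabulate λ i → model α (sign h , to h i)

  -- The facets A and B determine the colours a and b as those of the edges that they omit.
  rigidity : ∀ h {a b x y A B} → IsComp x (Subset.∁ ⁅ a ⁆) A → IsComp y (Subset.∁ ⁅ b ⁆) B →
             Image (inv h) B A → ∃ λ ρ → IsPerm ρ × Recolours h ρ × sgn ρ ≡ parity (sign h)
  rigidity h {a} {b} {x} {y} {A} {B} (isComp _ (e , _)) (isComp _ (_ , e′)) (imageOf _ f)
    with rigid (perm h) (isPerm h) (sign h) α
  ... | inj₁ (s , p) = induced α (sign h) (perm h) , induced-perm h
    , preserves⇒recolours {h} {induced α (sign h) (perm h)} p , s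
  ... | inj₂ q = contradiction preserves (q a)
    where
    -- With any colour other than `b` the image edge would lie in `B`, and mapping it back would put
    -- an edge of the omitted colour `a` into `A`.
    missed : ∀ z i → model α (z , i) ≡ a → model α (h · z , to h i) ≡ b
    missed z i p with model α (h · z , to h i) ≟ b
    ... | yes q = q
    ... | no q  = contradiction (subst (_∈ˢ ⁅ a ⁆) (sym p) (x∈⁅x⁆ a)) (x∈∁p⇒x∉p (proj₁ (e (subst₂
            (λ w j → Edges A (w , j)) (inv-· h z) (from-to h i)
            (f (h · z) (to h i) (e′ (x∉p⇒x∈∁p (λ m → q (x∈⁅y⁆⇒x≡y b m)) , joined-∁ b)))))))
    induced-a : lookup (induced α (sign h) (perm h)) a ≡ b
    induced-a = begin
      lookup (induced α (sign h) (perm h)) a  ≡⟨ Vec.lookup∘tabulate (λ i → model α (sign h , to h i)) a ⟩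
      model α (sign h , to h a)                   ≡⟨ cong (λ z → model α (z , to h a)) (·-x₀ h) ⟨
      model α (h · x₀ , to h a)                   ≡⟨ missed x₀ a (model-x₀ α a) ⟩
      b                                       ∎
      where open ≡-Reasoning
    preserves : PreservesClass α (sign h) (perm h) (induced α (sign h) (perm h)) a
    preserves k = trans (missed (even k) (dir α (even k) a) (model-dir α (even k) a)) (sym induced-a)

-- Flags

init : Fin 5 → Map → Subset 4
init 0F _ = Subset.⊥
init 1F (a ∷ _) = ⁅ a ⁆
init 2F (a ∷ b ∷ _) = ⁅ a ⁆ Subset.∪ ⁅ b ⁆
init 3F (a ∷ b ∷ c ∷ _) = ⁅ a ⁆ Subset.∪ ⁅ b ⁆ Subset.∪ ⁅ c ⁆
init 4F _ = Subset.⊤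

opaque
  unfolding inverse

  push-init : ∀ ρ → IsPerm ρ → ∀ σ → IsPerm σ → ∀ k → push ρ (init k σ) ≡ init k (ρ ⊙ σ)
  push-init = toWitness {a? = perms? λ ρ → perms? λ σ → all? λ k → _ ≟ˢ _} tt

  ∣init∣ : ∀ σ → IsPerm σ → ∀ k → ∣ init k σ ∣ ≡ Fin.toℕ k
  ∣init∣ = toWitness {a? = perms? λ σ → all? λ k → _ ℕ.≟ _} tt

  init-chain : ∀ σ → IsPerm σ → ∀ k j → init k σ ⊆ init j σ ⊎ init j σ ⊆ init k σ
  init-chain = toWitness {a? = perms? λ σ → all? λ k → all? λ j →
    (init k σ ⊆? init j σ) ⊎-dec (init j σ ⊆? init k σ)} tt

  -- A set comparable with the segments of all sizes up to 3 is the segment of its own size or the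
  -- set of all colours. Only segments within `init 3F` are tested, since these are below `top` for
  -- 𝒬 and for facets alike.
  init-maximal : ∀ σ → IsPerm σ → ∀ K →
    (∀ k → init k σ ⊆ init 3F σ → K ⊆ init k σ ⊎ init k σ ⊆ K) → ∃ λ k → K ≡ init k σ
  init-maximal = toWitness {a? = perms? λ σ → subsets? λ K →
    (all? λ k → (init k σ ⊆? init 3F σ) →-dec ((K ⊆? init k σ) ⊎-dec (init k σ ⊆? K)))
    →-dec any? λ k → K ≟ˢ init k σ} tt

  -- For the least `k` with `K` inside `init k σ`, all colours of `init k σ` have already been
  -- forced into `K`.
  init-greedy : ∀ σ → IsPerm σ → ∀ K → K ⊆ init 0F σ ⊎ lookup σ 0F ∈ˢ K →
    K ⊆ init 1F σ ⊎ lookup σ 1F ∈ˢ K → K ⊆ init 2F σ ⊎ lookup σ 2F ∈ˢ K → ∃ λ k → K ≡ init k σ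
  init-greedy = toWitness {a? = perms? λ σ → subsets? λ K →
    ((K ⊆? init 0F σ) ⊎-dec (lookup σ 0F ∈ˢ? K)) →-dec
    (((K ⊆? init 1F σ) ⊎-dec (lookup σ 1F ∈ˢ? K)) →-dec
    (((K ⊆? init 2F σ) ⊎-dec (lookup σ 2F ∈ˢ? K)) →-dec any? λ k → K ≟ˢ init k σ))} tt

  complete-perm : ∀ a b → b ≢ a → ∀ c → ¬ c ∈ˢ ⁅ a ⁆ Subset.∪ ⁅ b ⁆ →
    ∃ λ d → IsPerm (a ∷ b ∷ c ∷ d ∷ [])
  complete-perm = toWitness {a? = all? λ a → all? λ b → ¬? (b ≟ a) →-dec
    all? λ c → ¬? (c ∈ˢ? (⁅ a ⁆ Subset.∪ ⁅ b ⁆)) →-dec any? λ d → isPerm? (a ∷ b ∷ c ∷ d ∷ [])} tt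

  init-3-least : ∀ σ → IsPerm σ → ∀ a k → Subset.∁ ⁅ a ⁆ ⊆ init k σ → init 3F σ ⊆ init k σ
  init-3-least = toWitness {a? = perms? λ σ → all? λ a → all? λ k →
    (Subset.∁ ⁅ a ⁆ ⊆? init k σ) →-dec (init 3F σ ⊆? init k σ)} tt

  init-3-∁ : ∀ σ → IsPerm σ → ∀ a → init 3F σ ⊆ Subset.∁ ⁅ a ⁆ → init 3F σ ≡ Subset.∁ ⁅ a ⁆
  init-3-∁ = toWitness {a? = perms? λ σ → all? λ a →
    (init 3F σ ⊆? Subset.∁ ⁅ a ⁆) →-dec (_ ≟ˢ _)} tt

  below-3 : ∀ σ → IsPerm σ → ∀ k → k ≢ 4F → init k σ ⊆ init 3F σ
  below-3 = toWitness {a? = perms? λ σ → all? λ k → ¬? (k ≟ 4F) →-dec (init k σ ⊆? init 3F σ)} tt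

  omit : ∀ a → ∃ λ σ → IsPerm σ × init 3F σ ≡ Subset.∁ ⁅ a ⁆
  omit 0F = (1F ∷ 2F ∷ 3F ∷ 0F ∷ []) , refl , refl
  omit 1F = (0F ∷ 2F ∷ 3F ∷ 1F ∷ []) , refl , refl
  omit 2F = (0F ∷ 1F ∷ 3F ∷ 2F ∷ []) , refl , refl
  omit 3F = (0F ∷ 1F ∷ 2F ∷ 3F ∷ []) , refl , refl

opaque
  unfolding inverse sgn

  init-determines : ∀ σ → IsPerm σ → ∀ τ → IsPerm τ →
    (∀ k → k ≢ 0F → init k σ ≡ init k τ) → σ ≡ τ
  init-determines = toWitness {a? = perms? λ σ → perms? λ τ →
    (all? λ k → ¬? (k ≟ 0F) →-dec (_ ≟ˢ _)) →-dec (_ ≟ᴹ _)} tt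

  -- Such orders differ by exchanging two consecutive colours.
  init-adjacent : ∀ σ → IsPerm σ → ∀ τ → IsPerm τ → ∀ k →
    (∀ j → j ≢ k → init j σ ≡ init j τ) → init k σ ≢ init k τ → sgn σ ≢ sgn τ
  init-adjacent = toWitness {a? = perms? λ σ → perms? λ τ → all? λ k →
    (all? λ j → ¬? (j ≟ k) →-dec (_ ≟ˢ _)) →-dec (¬? (_ ≟ˢ _) →-dec ¬? (_ Sign.≟ _))} tt

opaque
  size-0 : ∀ (K : Subset 4) → ∣ K ∣ ≡ 0 → K ≡ Subset.⊥
  size-0 = toWitness {a? = subsets? λ K → (_ ℕ.≟ _) →-dec (K ≟ˢ _)} tt

  size-3 : ∀ (K : Subset 4) → ∣ K ∣ ≡ 3 → ∃ λ a → K ≡ Subset.∁ ⁅ a ⁆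
  size-3 = toWitness {a? = subsets? λ K → (_ ℕ.≟ _) →-dec (any? λ a → K ≟ˢ _)} tt

  ∣∁∣ : ∀ (a : Fin 4) → ∣ Subset.∁ ⁅ a ⁆ ∣ ≡ 3
  ∣∁∣ = toWitness {a? = all? λ a → _ ℕ.≟ _} tt

  parity-flip : ∀ i x → parity (flip i x) ≡ Sign.opposite (parity x)
  parity-flip = toWitness {a? = all? λ i → vertices? λ x → _ Sign.≟ _} tt

  parity-antipode : ∀ x → parity (antipode x) ≡ parity x
  parity-antipode = toWitness {a? = vertices? λ x → _ Sign.≟ _} tt

init-injective : ∀ {σ τ k j} → IsPerm σ → IsPerm τ → init k σ ≡ init j τ → k ≡ j
init-injective {σ} {τ} {k} {j} σp τp p = Fin.toℕ-injective
  (trans (sym (∣init∣ σ σp k)) (trans (cong ∣_∣ p) (∣init∣ τ τp j)))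

parity-∼ : ∀ {x y} → x ∼ y → parity x ≡ parity y
parity-∼ (inj₁ refl) = refl
parity-∼ {y = y} (inj₂ refl) = parity-antipode y

-- A member that misses the point found for the others is contained in all of them.
common : ∀ {I X : Set} (_∋_ : I → X → Set) (Relevant : I → Set) →
  (∀ F x → Dec (F ∋ x)) → (∀ F → Dec (Relevant F)) → (∀ F → Relevant F → ∃ (F ∋_)) → X →
  ∀ Fs → (∀ F G → F ∈ˡ.∈ Fs → G ∈ˡ.∈ Fs → (∀ x → F ∋ x → G ∋ x) ⊎ (∀ x → G ∋ x → F ∋ x)) →
  ∃ λ x → ∀ F → F ∈ˡ.∈ Fs → Relevant F → F ∋ x
common _∋_ Relevant ∋? relevant? inhabited x [] chain = x , λ _ ()
common _∋_ Relevant ∋? relevant? inhabited x₁ (F ∷ Fs) chain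
  with common _∋_ Relevant ∋? relevant? inhabited x₁ Fs (λ G H p q → chain G H (there p) (there q))
... | x , all with relevant? F
...   | no ¬r = x , λ { G (here refl) r → contradiction r ¬r ; G (there p) r → all G p r }
...   | yes r with ∋? F x
...     | yes F∋x = x , λ { G (here refl) _ → F∋x ; G (there p) r → all G p r }
...     | no F∌x with inhabited F r
...       | y , F∋y = y , λ
  { G (here refl) _ → F∋y
  ; G (there p) r → [ (λ F⊆G → F⊆G y F∋y) , (λ G⊆F → contradiction (G⊆F x (all G p r)) F∌x) ]′
                      (chain F G (here refl) (there p)) }

∁⇒∉ : ∀ {K U : Subset 4} → ¬ K ⊆ U → ∃ λ a → a ∈ˢ K × ¬ a ∈ˢ U
∁⇒∉ {K} {U} K⊈U with any? (λ a → (a ∈ˢ? K) ×-dec ¬? (a ∈ˢ? U))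
... | yes p = p
... | no ¬p = contradiction (λ {a} m → decidable-stable (a ∈ˢ? U) λ q → ¬p (a , m , q)) K⊈U

common-colour : ∀ (U : Subset 4) → (∃ λ a → ¬ a ∈ˢ U) → ∀ Ks →
  (∀ K L → K ∈ˡ.∈ Ks → L ∈ˡ.∈ Ks → K ⊆ L ⊎ L ⊆ K) →
  ∃ λ a → ¬ a ∈ˢ U × (∀ K → K ∈ˡ.∈ Ks → K ⊆ U ⊎ a ∈ˢ K)
common-colour U a₁ Ks chain with common {X = ∃ λ a → ¬ a ∈ˢ U} (λ K a → proj₁ a ∈ˢ K) (λ K → ¬ K ⊆ U)
  (λ K a → proj₁ a ∈ˢ? K) (λ K → ¬? (K ⊆? U))
  (λ K r → let (a , m , q) = ∁⇒∉ r in (a , q) , m) a₁ Ks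
  (λ K L p q → [ (λ K⊆L → inj₁ λ _ m → K⊆L m) , (λ L⊆K → inj₂ λ _ m → L⊆K m) ]′ (chain K L p q))
... | (a , a∉U) , all = a , a∉U , λ K p → decide K p (K ⊆? U)
  where
  decide : ∀ K → K ∈ˡ.∈ Ks → Dec (K ⊆ U) → K ⊆ U ⊎ a ∈ˢ K
  decide K p (yes K⊆U) = inj₁ K⊆U
  decide K p (no K⊈U)  = inj₂ (all K p K⊈U)

-- Colours are chosen greedily: each next one lies in all members not exhausted by the previous ones.
sort-chain : ∀ Ks → (∀ K L → K ∈ˡ.∈ Ks → L ∈ˡ.∈ Ks → K ⊆ L ⊎ L ⊆ K) →
  ∃ λ σ → IsPerm σ × (∀ K → K ∈ˡ.∈ Ks → ∃ λ k → K ≡ init k σ)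
sort-chain Ks chain with common-colour Subset.⊥ (0F , ∉⊥) Ks chain
... | a , _ , pa with common-colour ⁅ a ⁆ (outside₁ a) Ks chain
  where
  outside₁ : ∀ a → ∃ λ b → ¬ b ∈ˢ ⁅ a ⁆
  outside₁ = toWitness {a? = all? λ a → any? λ b → ¬? (b ∈ˢ? ⁅ a ⁆)} tt
... | b , b∉ , pb with common-colour (⁅ a ⁆ Subset.∪ ⁅ b ⁆) (outside₂ a b) Ks chain
  where
  outside₂ : ∀ a b → ∃ λ c → ¬ c ∈ˢ ⁅ a ⁆ Subset.∪ ⁅ b ⁆
  outside₂ = toWitness {a? = all? λ a → all? λ b → any? λ c → ¬? (c ∈ˢ? (⁅ a ⁆ Subset.∪ ⁅ b ⁆))} tt
... | c , c∉ , pc with complete-perm a b (λ b≡a → b∉ (subst (_∈ˢ ⁅ a ⁆) (sym b≡a) (x∈⁅x⁆ a))) c c∉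
... | d , perm = (a ∷ b ∷ c ∷ d ∷ []) , perm
               , λ K p → init-greedy (a ∷ b ∷ c ∷ d ∷ []) perm K (pa K p) (pb K p) (pc K p)

module Rebase (α : Bool) where
  open Coloured α

  rebase : ∀ {x y K S} → Near K y x → IsComp x K S → IsComp y K S
  rebase n (isComp (v , v′) (e , e′)) = isComp
    ((λ t → joined-trans n (v t)) , λ m → v′ (joined-trans (joined-sym n) m))
    ((λ t → proj₁ (e t) , joined-trans n (proj₂ (e t)))
    , λ p → e′ (proj₁ p , joined-trans (joined-sym n) (proj₂ p)))

  comp-unique : ∀ {x K S y L S′} → IsComp x K S → IsComp y L S′ → S ⊑ S′ → S′ ⊑ S → K ≡ L × Near K x y
  comp-unique p q r s with ⊑-comp p q r | ⊑-comp q p s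
  ... | K⊆L , _ | L⊆K , n = ⊆-antisym K⊆L L⊆K , n

  ⊑-refl : ∀ {S} → S ⊑ S
  ⊑-refl = (λ _ v → v) , (λ _ e → e)

  comp-cong : ∀ {x K S S′} → S ⊑ S′ → S′ ⊑ S → IsComp x K S → IsComp x K S′
  comp-cong (p , q) (p′ , q′) (isComp (v , v′) (e , e′)) = isComp
    ((λ {y} t → v (p′ y t)) , λ {y} n → p y (v′ n))
    ((λ {f} t → e (q′ f t)) , λ {f} n → q f (e′ n))

  least-cong : ∀ {S S′} → S′ ⊑ S → IsLeast S → IsLeast S′
  least-cong (p′ , q′) (isLeast (v , _) (e , _)) =
    isLeast ((λ {y} t → v (p′ y t)) , λ ()) ((λ {f} t → e (q′ f t)) , λ ())

  comp-not-least : ∀ {x K S} → IsComp x K S → ¬ IsLeast S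
  comp-not-least {S = S} c l = comp-⋢-least c l (⊑-refl {S})

-- In both cases `∁ ⁅ a ⁆` is a set of three colours below `top`: for a facet it is `top` itself,
-- for 𝒬 it is the colour set of some facet.
module Flags (α : Bool) (P : Polytope) (top : Subset 4) (L : Labelling.Labelled α P top)
             (a : Fin 4) (top-cases : top ≡ Subset.⊤ ⊎ top ≡ Subset.∁ ⁅ a ⁆) where
  open Coloured α
  open Labelling α
  open Labelled L
  open Recolouring α
  open Rebase α
  open Flag

  ∁a⊆top : Subset.∁ ⁅ a ⁆ ⊆ top
  ∁a⊆top = below top-cases
    where
    below : ∀ {K} → K ≡ Subset.⊤ ⊎ K ≡ Subset.∁ ⁅ a ⁆ → Subset.∁ ⁅ a ⁆ ⊆ K
    below (inj₁ refl) = ⊆⊤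
    below (inj₂ refl) = λ m → m

  compFace : ∀ x K → K ⊆ top → Face P
  compFace x K K⊆top = record
    { rank = + ∣ K ∣ ; graph = comp x K ; isFace = comp-face K⊆top (comp-isComp x K) }

  leastFace : Face P
  leastFace = record { rank = -[1+ 0 ] ; graph = empty ; isFace = least-face empty-isLeast }

  ≈ꟳ-refl : ∀ {F} → FaceEq P F F
  ≈ꟳ-refl {F} = ⊑-refl {graph F} , ⊑-refl {graph F}

  comps-equal : ∀ {x K y L S S′} → IsComp x K S → IsComp y L S′ → K ≡ L → Near K x y →
                S ⊑ S′ × S′ ⊑ S
  comps-equal p q refl n = comp-⊑ p q (λ m → m) (joined-sym n) , comp-⊑ q p (λ m → m) n

  leasts-equal : ∀ {S S′} → IsLeast S → IsLeast S′ → S ⊑ S′ × S′ ⊑ S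
  leasts-equal {S} {S′} p q = least-⊑ {S′ = S′} p , least-⊑ {S′ = S} q

  data Shape (F : Face P) : Set where
    leastShape : rank F ≡ -[1+ 0 ] → IsLeast (graph F) → Shape F
    compShape  : ∀ x K → K ⊆ top → rank F ≡ + ∣ K ∣ → IsComp x K (graph F) → Shape F

  shape : ∀ F → Shape F
  shape F = [ (λ { (r , l) → leastShape r l })
            , (λ { (x , K , K⊆top , r , c) → compShape x K K⊆top r c }) ]′ (classify (isFace F))

  ⊆top : ∀ {F x K} → IsComp x K (graph F) → K ⊆ top
  ⊆top {F} c with shape F
  ... | leastShape _ l = contradiction l (comp-not-least c)
  ... | compShape y L L⊆top _ c′ = subst (_⊆ top)
    (proj₁ (comp-unique c′ c (⊑-refl {graph F}) (⊑-refl {graph F}))) L⊆top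

  -- The label (x , σ) stands for the flag of the faces at x whose colours are the
  -- initial segments of σ.
  record Label : Set where
    constructor label
    field
      base    : Vertex
      order   : Map
      order-perm : IsPerm order
      allowed : init 3F order ⊆ top

  open Label

  data InChain (ℓ : Label) (S : Subgraph) : Set where
    atLeast : IsLeast S → InChain ℓ S
    atInit  : ∀ k → IsComp (base ℓ) (init k (order ℓ)) S → InChain ℓ S

  inChain-cong : ∀ {ℓ S S′} → S ⊑ S′ → S′ ⊑ S → InChain ℓ S → InChain ℓ S′
  inChain-cong {S = S} {S′} p q (atLeast l) = atLeast (least-cong {S} {S′} q l)
  inChain-cong p q (atInit k c) = atInit k (comp-cong p q c)

  inChain-comparable : ∀ {ℓ S S′} → InChain ℓ S → InChain ℓ S′ → S ⊑ S′ ⊎ S′ ⊑ S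
  inChain-comparable {S′ = S′} (atLeast l) _ = inj₁ (least-⊑ {S′ = S′} l)
  inChain-comparable {S = S} _ (atLeast l) = inj₂ (least-⊑ {S′ = S} l)
  inChain-comparable {ℓ} (atInit k c) (atInit j d) with init-chain (order ℓ) (order-perm ℓ) k j
  ... | inj₁ p = inj₁ (comp-⊑ c d p joined-refl)
  ... | inj₂ p = inj₂ (comp-⊑ d c p joined-refl)

  HasLabel : Flag P → Label → Set
  HasLabel Φ ℓ = ∀ F → (_∈_ P F (faces Φ) → InChain ℓ (graph F))
                     × (InChain ℓ (graph F) → _∈_ P F (faces Φ))

  -- For a facet the segment `init 4F` is not below `top` and contributes no face.
  initFaces : ∀ ℓ k → Dec (init k (order ℓ) ⊆ top) → List (Face P)
  initFaces ℓ k (yes p) = compFace (base ℓ) (init k (order ℓ)) p ∷ []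
  initFaces ℓ k (no _)  = []

  chainFaces : Label → List (Face P)
  chainFaces ℓ = leastFace ∷ List.concatMap (λ k → initFaces ℓ k (init k (order ℓ) ⊆? top)) (List.allFin 5)

  ∈chain⇒inChain : ∀ {ℓ F} → _∈_ P F (chainFaces ℓ) → InChain ℓ (graph F)
  ∈chain⇒inChain {F = F} (here (p , q)) = atLeast (least-cong {empty} {graph F} p empty-isLeast)
  ∈chain⇒inChain {ℓ} {F} (there m) with Any.tabulate⁻ {f = λ k → k}
    (Any.concatMap⁻ (λ k → initFaces ℓ k (init k (order ℓ) ⊆? top)) {xs = List.allFin 5} m)
  ... | k , n = at-k (init k (order ℓ) ⊆? top) n
    where
    at-k : ∀ d → _∈_ P F (initFaces ℓ k d) → InChain ℓ (graph F)
    at-k (yes p) (here (q , r)) = atInit k (comp-cong r q (comp-isComp (base ℓ) (init k (order ℓ))))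

  inChain⇒∈chain : ∀ {ℓ F} → InChain ℓ (graph F) → _∈_ P F (chainFaces ℓ)
  inChain⇒∈chain {F = F} (atLeast l) = here (leasts-equal l empty-isLeast)
  inChain⇒∈chain {ℓ} {F} (atInit k c) = there (Any.concatMap⁺
    (λ k → initFaces ℓ k (init k (order ℓ) ⊆? top)) {xs = List.allFin 5}
    (Any.tabulate⁺ {f = λ k → k} k (at-k (init k (order ℓ) ⊆? top))))
    where
    at-k : ∀ d → _∈_ P F (initFaces ℓ k d)
    at-k (yes p) = here (comps-equal c (comp-isComp (base ℓ) (init k (order ℓ))) refl joined-refl)
    at-k (no ¬p) = contradiction (λ {a} → ⊆top {F} c {a}) ¬p

  flag : Label → Flag P
  flag ℓ = record
    { faces   = chainFaces ℓ
    ; chain   = λ F G p q → inChain-comparable (∈chain⇒inChain {ℓ} {F} p) (∈chain⇒inChain {ℓ} {G} q)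
    ; maximal = λ F c → inChain⇒∈chain {ℓ} {F} (isMaximal F c)
    }
    where
    member : ∀ k (p : init k (order ℓ) ⊆ top) → _∈_ P (compFace (base ℓ) (init k (order ℓ)) p) (chainFaces ℓ)
    member k p = inChain⇒∈chain {ℓ} {compFace (base ℓ) (init k (order ℓ)) p}
      (atInit k (comp-isComp (base ℓ) (init k (order ℓ))))
    isMaximal : ∀ F → (∀ G → _∈_ P G (chainFaces ℓ) → Comparable P F G) → InChain ℓ (graph F)
    isMaximal F c with shape F
    ... | leastShape _ l = atLeast l
    ... | compShape x K K⊆top _ d = found (init-maximal (order ℓ) (order-perm ℓ) K nested)
      where
      compared : ∀ k (p : init k (order ℓ) ⊆ top) →
        (K ⊆ init k (order ℓ) × Near (init k (order ℓ)) (base ℓ) x) ⊎ (init k (order ℓ) ⊆ K × Near K x (base ℓ))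
      compared k p with c (compFace (base ℓ) (init k (order ℓ)) p) (member k p)
      ... | inj₁ q = inj₁ (⊑-comp d (comp-isComp (base ℓ) (init k (order ℓ))) q)
      ... | inj₂ q = inj₂ (⊑-comp (comp-isComp (base ℓ) (init k (order ℓ))) d q)
      nested : ∀ k → init k (order ℓ) ⊆ init 3F (order ℓ) → K ⊆ init k (order ℓ) ⊎ init k (order ℓ) ⊆ K
      nested k p with compared k (λ m → allowed ℓ (p m))
      ... | inj₁ (q , _) = inj₁ q
      ... | inj₂ (q , _) = inj₂ q
      -- Comparability with the vertex face `init 0F` puts the base of the label on `F`.
      here-x : Near K (base ℓ) x
      here-x with compared 0F (λ m → contradiction m ∉⊥)
      ... | inj₁ (_ , n) = joined-mono ⊥⊆ n
      ... | inj₂ (_ , n) = joined-sym n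
      found : (∃ λ k → K ≡ init k (order ℓ)) → InChain ℓ (graph F)
      found (k , refl) = atInit k (rebase here-x d)

  flag-label : ∀ ℓ → HasLabel (flag ℓ) ℓ
  flag-label ℓ F = ∈chain⇒inChain {ℓ} {F} , inChain⇒∈chain {ℓ} {F}

  colours : ∀ {F} → Shape F → Subset 4
  colours (leastShape _ _)      = Subset.⊥
  colours (compShape x K _ _ _) = K

  colours-mono : ∀ {F G} (s : Shape F) (t : Shape G) → FaceLeq P F G → colours s ⊆ colours t
  colours-mono (leastShape _ _) _ _ = ⊥⊆
  colours-mono {G = G} (compShape x K _ _ c) (leastShape _ l) p = contradiction p (comp-⋢-least c l)
  colours-mono (compShape x K _ _ c) (compShape y L _ _ d) p = proj₁ (⊑-comp c d p)

  colours⊆top : ∀ {F} (s : Shape F) → colours s ⊆ top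
  colours⊆top (leastShape _ _)          = ⊥⊆
  colours⊆top (compShape _ _ K⊆top _ _) = K⊆top

  module _ (Φ : Flag P) where

    private
      member : ∀ {F} → F ∈ˡ.∈ faces Φ → _∈_ P F (faces Φ)
      member {F} = Any.map λ { refl → ≈ꟳ-refl {F} }

      comparable : ∀ F G → F ∈ˡ.∈ faces Φ → G ∈ˡ.∈ faces Φ → Comparable P F G
      comparable F G p q = chain Φ F G (member p) (member q)

      relevant? : ∀ F → Dec (¬ IsLeast (graph F))
      relevant? F with shape F
      ... | leastShape _ l      = no λ ¬l → ¬l l
      ... | compShape _ _ _ _ c = yes (comp-not-least c)

      inhabited : ∀ F → ¬ IsLeast (graph F) → ∃ (Vertices (graph F))
      inhabited F ¬l with shape F
      ... | leastShape _ l = contradiction l ¬l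
      ... | compShape x _ _ _ (isComp (_ , v) _) = x , v joined-refl

      base-vertex : ∃ λ x → ∀ F → F ∈ˡ.∈ faces Φ → ¬ IsLeast (graph F) → Vertices (graph F) x
      base-vertex = common (λ F → Vertices (graph F)) (λ F → ¬ IsLeast (graph F))
        (λ F x → T? (vertex? (graph F) x)) relevant? inhabited x₀ (faces Φ)
        (λ F G p q → [ (λ r → inj₁ (proj₁ r)) , (λ r → inj₂ (proj₁ r)) ]′ (comparable F G p q))

      colourSet : Face P → Subset 4
      colourSet F = colours (shape F)

      colourSets : List (Subset 4)
      -- Including `top` makes it an initial segment of the sorted order, which yields `allowed`.
      colourSets = top ∷ List.map colourSet (faces Φ)

      nested : ∀ K L → K ∈ˡ.∈ colourSets → L ∈ˡ.∈ colourSets → K ⊆ L ⊎ L ⊆ K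
      nested K L (here refl) (here refl) = inj₁ λ m → m
      nested K L (here refl) (there q) with List.∈-map⁻ colourSet q
      ... | G , _ , refl = inj₂ (colours⊆top (shape G))
      nested K L (there p) (here refl) with List.∈-map⁻ colourSet p
      ... | F , _ , refl = inj₁ (colours⊆top (shape F))
      nested K L (there p) (there q) with List.∈-map⁻ colourSet p | List.∈-map⁻ colourSet q
      ... | F , p′ , refl | G , q′ , refl with comparable F G p′ q′
      ...   | inj₁ r = inj₁ (colours-mono (shape F) (shape G) r)
      ...   | inj₂ r = inj₂ (colours-mono (shape G) (shape F) r)

      Sorted : Map → Set
      Sorted σ = ∀ K → K ∈ˡ.∈ colourSets → ∃ λ k → K ≡ init k σ

      top-large : ∀ {σ} → IsPerm σ → (∃ λ k → top ≡ init k σ) → init 3F σ ⊆ top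
      top-large {σ} p (k , eq) = subst (init 3F σ ⊆_) (sym eq)
        (init-3-least σ p a k (subst (Subset.∁ ⁅ a ⁆ ⊆_) eq ∁a⊆top))

      module _ (σ : Map) (σ-perm : IsPerm σ) (sorted : Sorted σ) where

        sortedLabel : Label
        sortedLabel = label (proj₁ base-vertex) σ σ-perm (top-large σ-perm (sorted top (here refl)))

        listed : ∀ F → F ∈ˡ.∈ faces Φ → InChain sortedLabel (graph F)
        listed F p = cases (shape F) (sorted (colourSet F) (there (List.∈-map⁺ colourSet p)))
          where
          cases : ∀ s → (∃ λ k → colours s ≡ init k σ) → InChain sortedLabel (graph F)
          cases (leastShape _ l) _ = atLeast l
          cases (compShape x K _ _ c@(isComp (v , _) _)) (k , eq) = atInit k
            (subst (λ L → IsComp (proj₁ base-vertex) L (graph F)) eq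
              (rebase (joined-sym (v (proj₂ base-vertex F p (comp-not-least c)))) c))

        to-chain : ∀ F → _∈_ P F (faces Φ) → InChain sortedLabel (graph F)
        to-chain F m with ∈ˡ.find m
        ... | G , p , (q , r) = inChain-cong r q (listed G p)

        -- Conversely, a face in the chain of the label is comparable with all faces of `Φ`, so
        -- maximality puts it into `Φ`.
        sorted-hasLabel : HasLabel Φ sortedLabel
        sorted-hasLabel F = to-chain F
          , λ c → maximal Φ F λ G m → inChain-comparable c (to-chain G m)

      assemble : (∃ λ σ → IsPerm σ × Sorted σ) → ∃ λ ℓ → HasLabel Φ ℓ
      assemble (σ , p , sorted) = sortedLabel σ p sorted , sorted-hasLabel σ p sorted

    flagLabel : ∃ λ ℓ → HasLabel Φ ℓ
    flagLabel = assemble (sort-chain colourSets nested)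

-- Orbits of flags

sign-≢ : ∀ s {t u} → t ≢ u → t Sign.* s ≢ u Sign.* s
sign-≢ s t≢u p = t≢u (Sign.*-cancelʳ-≡ _ _ _ p)

module Orbits (α : Bool) (P : Polytope) (top : Subset 4) (L : Labelling.Labelled α P top)
              (a : Fin 4) (top-cases : top ≡ Subset.⊤ ⊎ top ≡ Subset.∁ ⁅ a ⁆) where
  open Coloured α
  open Labelling α
  open Labelled L
  open Recolouring α
  open Rebase α
  open Flags α P top L a top-cases
  open Label
  open Flag

  labelParity : Label → Sign
  labelParity ℓ = parity (base ℓ) Sign.* sgn (order ℓ)

  Shared : Label → Label → Fin 5 → Set
  Shared ℓ ℓ′ k = init k (order ℓ) ≡ init k (order ℓ′) × Near (init k (order ℓ)) (base ℓ) (base ℓ′)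

  neighbours-parity : ∀ {c x y} → Near ⁅ c ⁆ x y → ¬ x ∼ y → parity y ≡ Sign.opposite (parity x)
  neighbours-parity {c} {x} {y} n x≁y with joined-⁅⁆ n
  ... | inj₁ p = contradiction (∼-sym (φ-injective α p)) x≁y
  ... | inj₂ p = begin
    parity y                        ≡⟨ parity-φ α y ⟨
    parity (φ α y)                  ≡⟨ parity-∼ p ⟩
    parity (flip c (φ α x))         ≡⟨ parity-flip c (φ α x) ⟩
    Sign.opposite (parity (φ α x))  ≡⟨ cong Sign.opposite (parity-φ α x) ⟩
    Sign.opposite (parity x)        ∎
    where open ≡-Reasoning

  -- For `k = 0F` the orders agree and the bases are the two ends of an edge, of opposite parity.
  -- Otherwise the bases agree up to antipode and the orders differ by a transposition.
  one-face-parity : ∀ ℓ ℓ′ k → (∀ j → j ≢ k → Shared ℓ ℓ′ j) → ¬ Shared ℓ ℓ′ k →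
                    labelParity ℓ ≢ labelParity ℓ′
  one-face-parity (label x σ@(c ∷ _) σ-perm _) (label y τ τ-perm _) 0F shared ¬shared
    with init-determines σ σ-perm τ τ-perm (λ k k≢0 → proj₁ (shared k k≢0))
  ... | refl = sign-≢ (sgn σ) λ p → Sign.s≢opposite[s] (parity x) (trans p
    (neighbours-parity (proj₂ (shared 1F λ ())) λ x∼y → ¬shared (refl , ∼⇒near x∼y)))
  one-face-parity (label x σ σ-perm _) (label y τ τ-perm _) k@(suc _) shared ¬shared p =
    init-adjacent σ σ-perm τ τ-perm k (λ j j≢k → proj₁ (shared j j≢k))
      (λ q → ¬shared (q , joined-mono ⊥⊆ at-0))
      (Sign.*-cancelˡ-≡ (parity x) (sgn σ) (sgn τ)
        (trans p (cong (Sign._* sgn τ) (sym (parity-∼ (φ-injective α (joined-⊥⇒∼ at-0)))))))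
    where
    at-0 : Near Subset.⊥ x y
    at-0 = proj₂ (shared 0F λ ())

  inChain-init : ∀ {σ ℓ k x S} → IsPerm σ → InChain ℓ S → IsComp x (init k σ) S →
                 init k σ ≡ init k (order ℓ) × Near (init k σ) x (base ℓ)
  inChain-init σ-perm (atLeast l) c = contradiction l (comp-not-least c)
  inChain-init {ℓ = ℓ} {k} {S = S} σ-perm (atInit j d) c with comp-unique c d (⊑-refl {S}) (⊑-refl {S})
  ... | p , n with init-injective {k = k} {j} σ-perm (order-perm ℓ) p
  ... | refl = p , n

  adjacent-parity : ∀ {Φ Ψ ℓ ℓ′} → HasLabel Φ ℓ → HasLabel Ψ ℓ′ → Adjacent P Φ Ψ →
                    labelParity ℓ ≢ labelParity ℓ′
  adjacent-parity {Φ} {Ψ} {ℓ} {ℓ′} hΦ hΨ (F , _ , (F∈Φ , F∉Ψ) , _ , replace , _) =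
    apart (proj₁ (hΦ F) F∈Φ)
    where
    apart : InChain ℓ (graph F) → labelParity ℓ ≢ labelParity ℓ′
    apart (atLeast l) = contradiction (proj₂ (hΨ F) (atLeast l)) F∉Ψ
    apart (atInit k c) = one-face-parity ℓ ℓ′ k shared ¬shared
      where
      ¬shared : ¬ Shared ℓ ℓ′ k
      ¬shared (p , n) = F∉Ψ (proj₂ (hΨ F) (atInit k
        (subst (λ K → IsComp (base ℓ′) K (graph F)) p (rebase (joined-sym n) c))))
      shared : ∀ j → j ≢ k → Shared ℓ ℓ′ j
      shared j j≢k with j ≟ 4F
      -- `init 4F` consists of all colours for every order, and it need not be the colour set of a
      -- face when `P` is a facet.
      ... | yes refl = refl , joined-⊤
      ... | no j≢4   = kept (replace H (proj₂ (hΦ H) (atInit j H-comp)))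
        where
        H : Face P
        H = compFace (base ℓ) (init j (order ℓ)) λ m → allowed ℓ (below-3 (order ℓ) (order-perm ℓ) j j≢4 m)
        H-comp : IsComp (base ℓ) (init j (order ℓ)) (graph H)
        H-comp = comp-isComp (base ℓ) (init j (order ℓ))
        kept : FaceEq P H F ⊎ _∈_ P H (faces Ψ) → Shared ℓ ℓ′ j
        kept (inj₁ (p , q)) = contradiction (init-injective {k = j} {k} (order-perm ℓ) (order-perm ℓ)
          (proj₁ (comp-unique H-comp c p q))) j≢k
        kept (inj₂ m) = inChain-init {k = j} (order-perm ℓ) (proj₁ (hΨ H) m) H-comp

  record Rigid (g : Isometry) : Set where
    field
      motion     : SignedPerm
      motion-represents : Represents g motion
      recolour   : Map
      is-perm    : IsPerm recolour
      recolours  : Recolours motion recolour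
      sgn-parity : sgn recolour ≡ parity (sign motion)

  private
    vertexFace : Vertex → Face P
    vertexFace x = compFace x Subset.⊥ ⊥⊆

    vertex-in : ∀ x → Realisation (graph (vertexFace x)) (vertexPoint x)
    vertex-in x = lies⇒realisation (graph (vertexFace x)) (vertexPoint x)
      (on-vertex x (proj₂ (IsComp.vertices (comp-isComp x Subset.⊥)) joined-refl) (≋⇒≋± λ _ → ≋-refl))

  -- A vertex point is sent into the realisation of a face of rank 0, which has no edges.
  permutes-vertices : ∀ g → IsSymmetry P g → ∀ x → ∃ λ y → vertexCoords y ≈± apply g (vertexCoords x)
  permutes-vertices g (s , _) x = from-lies (shape G) (realisation⇒lies (graph G) q (proj₁ (proj₂ sent)))
    where
    G : Face P
    G = proj₁ (s (vertexFace x))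
    same-rank : rank G ≡ + 0
    same-rank = proj₁ (proj₂ (s (vertexFace x)))
    sent : ∃ λ q → Realisation (graph G) q × Sends g (vertexPoint x) q
    sent = proj₁ (proj₂ (proj₂ (s (vertexFace x)))) (vertexPoint x) (vertex-in x)
    q : ℙ³
    q = proj₁ sent
    from-lies : Shape G → Lies (graph G) ⌊ coords q ⌋ → ∃ λ y → vertexCoords y ≈± apply g (vertexCoords x)
    from-lies _ (on-vertex y _ p) = y , ≋±⇒≈± (vertexCoords y) (apply g (vertexCoords x))
      (≋±-trans (≋±-sym p) (≈±⇒≋± (coords q) (apply g (vertexCoords x)) (proj₂ (proj₂ sent))))
    from-lies (leastShape r _) (on-edge _ _ _ _ _ _ _ _) = contradiction (trans (sym r) same-rank) λ ()
    from-lies (compShape y K _ r (isComp _ (e , _))) (on-edge z i m _ _ _ _ _) =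
      contradiction (subst (model α (z , i) ∈ˢ_)
        (size-0 K (ℤ.+-injective (trans (sym r) same-rank))) (proj₁ (e m))) ∉⊥

  -- Ranks force the image of a face with colours `∁ ⁅ a ⁆` to omit a single colour as well, so
  -- `rigidity` applies to this one face.
  symmetry-rigid : ∀ g → IsSymmetry P g → Rigid g
  symmetry-rigid g s = from-shape (shape G)
    where
    h : SignedPerm
    h = proj₁ (isometry-signedPerm g (permutes-vertices g s))
    rep : Represents g h
    rep = proj₂ (isometry-signedPerm g (permutes-vertices g s))
    F G : Face P
    F = compFace x₀ (Subset.∁ ⁅ a ⁆) ∁a⊆top
    G = proj₁ (proj₁ s F)
    same-rank : rank G ≡ + ∣ Subset.∁ ⁅ a ⁆ ∣
    same-rank = proj₁ (proj₂ (proj₁ s F))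
    back : Image (inv h) (graph G) (graph F)
    back = proj₂ (mapsOnto⇒image {g} {h} {graph F} {graph G} rep (proj₂ (proj₂ (proj₁ s F))))
    from-shape : Shape G → Rigid g
    from-shape (leastShape r _) = contradiction (trans (sym r) same-rank) λ ()
    from-shape (compShape y K _ r c) = result (size-3 K (ℤ.+-injective
      (trans (sym r) (trans same-rank (cong +_ (∣∁∣ a))))))
      where
      result : (∃ λ b → K ≡ Subset.∁ ⁅ b ⁆) → Rigid g
      result (b , eq) = build (rigidity h {a} {b} (comp-isComp x₀ (Subset.∁ ⁅ a ⁆))
        (subst (λ J → IsComp y J (graph G)) eq c) back)
        where
        build : (∃ λ ρ → IsPerm ρ × Recolours h ρ × sgn ρ ≡ parity (sign h)) → Rigid g
        build (ρ , p , r , q) = record { motion = h ; motion-represents = rep ; recolour = ρ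
                                       ; is-perm = p ; recolours = r ; sgn-parity = q }

  -- The motion multiplies the parity of the base by `parity (sign h)` and the sign of the order by
  -- `sgn ρ`; these factors are equal and cancel.
  rigid-parity : ∀ {Φ Ψ ℓ ℓ′} → HasLabel Φ ℓ → HasLabel Ψ ℓ′ → ∀ g → Rigid g → MapsFlag P g Φ Ψ →
                 labelParity ℓ ≡ labelParity ℓ′
  rigid-parity {Φ} {Ψ} {ℓ} {ℓ′} hΦ hΨ g R (f , _) = begin
    parity x Sign.* sgn σ
      ≡⟨ double (parity (sign h)) (parity x) (sgn σ) ⟨
    (parity (sign h) Sign.* parity x) Sign.* (parity (sign h) Sign.* sgn σ)
      ≡⟨ cong₂ Sign._*_ (parity-· h x) (cong (Sign._* sgn σ) sgn-parity) ⟨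
    parity (h · x) Sign.* (sgn ρ Sign.* sgn σ)
      ≡⟨ cong (parity (h · x) Sign.*_) (sgn-⊙ ρ is-perm σ (order-perm ℓ)) ⟨
    parity (h · x) Sign.* sgn (ρ ⊙ σ)
      ≡⟨ cong₂ Sign._*_ (parity-∼ (φ-injective α (joined-⊥⇒∼ (proj₂ (moved 0F)))))
           (cong sgn (init-determines (ρ ⊙ σ) ρσ-perm (order ℓ′) (order-perm ℓ′) λ k _ → proj₁ (moved k))) ⟩
    parity (base ℓ′) Sign.* sgn (order ℓ′) ∎
    where
    open ≡-Reasoning
    open Rigid R renaming (motion to h; recolour to ρ; motion-represents to rep)
    x : Vertex
    x = base ℓ
    σ : Map
    σ = order ℓ
    ρσ-perm : IsPerm (ρ ⊙ σ)
    ρσ-perm = ⊙-perm ρ is-perm σ (order-perm ℓ)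
    double : ∀ r s t → (r Sign.* s) Sign.* (r Sign.* t) ≡ s Sign.* t
    double Sign.+ s      t      = refl
    double Sign.- Sign.+ Sign.+ = refl
    double Sign.- Sign.+ Sign.- = refl
    double Sign.- Sign.- Sign.+ = refl
    double Sign.- Sign.- Sign.- = refl
    -- The image of the face of `Φ` with colours `init k σ` belongs to `Ψ` and has equally many
    -- colours, so it is the corresponding face there.
    moved : ∀ k → init k (ρ ⊙ σ) ≡ init k (order ℓ′) × Near (init k (ρ ⊙ σ)) (h · x) (base ℓ′)
    moved k = by-cases (k ≟ 4F)
      where
      module _ (k≢4 : k ≢ 4F) where
        F G : Face P
        F = compFace x (init k σ) λ m → allowed ℓ (below-3 σ (order-perm ℓ) k k≢4 m)
        sent : ∃ λ G → _∈_ P G (faces Ψ) × MapsFace P g F G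
        sent = f F (proj₂ (hΦ F) (atInit k (comp-isComp x (init k σ))))
        G = proj₁ sent
        images : Image h (graph F) (graph G) × Image (inv h) (graph G) (graph F)
        images = mapsOnto⇒image {g} {h} {graph F} {graph G} rep (proj₂ (proj₂ sent))
        G-comp : IsComp (h · x) (push ρ (init k σ)) (graph G)
        G-comp = image-comp {h} {ρ} is-perm recolours (comp-isComp x (init k σ)) (proj₁ images) (proj₂ images)
        G-init : IsComp (h · x) (init k (ρ ⊙ σ)) (graph G)
        G-init = subst (λ K → IsComp (h · x) K (graph G)) (push-init ρ is-perm σ (order-perm ℓ) k) G-comp
        G-chain : InChain ℓ′ (graph G)
        G-chain = proj₁ (hΨ G) (proj₁ (proj₂ sent))
      by-cases : Dec (k ≡ 4F) → init k (ρ ⊙ σ) ≡ init k (order ℓ′) × Near (init k (ρ ⊙ σ)) (h · x) (base ℓ′)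
      by-cases (yes refl) = refl , joined-⊤
      by-cases (no k≢4)   = inChain-init {k = k} {S = graph (G k≢4)} ρσ-perm (G-chain k≢4) (G-init k≢4)

  orbit-parity : ∀ {Φ Ψ ℓ ℓ′} → HasLabel Φ ℓ → HasLabel Ψ ℓ′ → SameOrbit P Φ Ψ →
                 labelParity ℓ ≡ labelParity ℓ′
  orbit-parity {Φ} {Ψ} {ℓ} {ℓ′} hΦ hΨ (g , s , f) =
    rigid-parity {Φ} {Ψ} {ℓ} {ℓ′} hΦ hΨ g (symmetry-rigid g s) f

-- Transitivity on flags of equal parity

inv-inv-· : ∀ h x → inv (inv h) · x ≡ h · x
inv-inv-· h x = trans (cong (inv (inv h) ·_) (sym (inv-· h x))) (inv-· (inv h) (h · x))

-- `inv (inv h)` acts as `h` without being definitionally equal to it.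
image-inv-inv : ∀ {h A B} → Image h A B → Image (inv (inv h)) A B
image-inv-inv {h} {A} {B} (imageOf v e) = imageOf
  (λ x t → subst (Vertices B) (sym (inv-inv-· h x)) (v x t))
  (λ x i t → subst₂ (λ y j → Edges B (y , j)) (sym (inv-inv-· h x)) (sym (from-inv h i)) (e x i t))

inv-inv-image : ∀ {h A B} → Image (inv (inv h)) A B → Image h A B
inv-inv-image {h} {A} {B} (imageOf v e) = imageOf
  (λ x t → subst (Vertices B) (inv-inv-· h x) (v x t))
  (λ x i t → subst₂ (λ y j → Edges B (y , j)) (inv-inv-· h x) (from-inv h i) (e x i t))

module Transitivity (α : Bool) (P : Polytope) (top : Subset 4) (L : Labelling.Labelled α P top)
                    (a : Fin 4) (top-cases : top ≡ Subset.⊤ ⊎ top ≡ Subset.∁ ⁅ a ⁆) where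
  open Coloured α
  open Labelling α
  open Labelled L
  open Recolouring α
  open Rebase α
  open Flags α P top L a top-cases
  open Orbits α P top L a top-cases
  open Label
  open Flag

  -- Keeps moved faces inside the polytope: for a facet, a permutation `ρ` has to fix the omitted
  -- colour.
  Stable : Map → Set
  Stable ρ = ∀ {K} → K ⊆ top → push ρ K ⊆ top

  record Moves (h : SignedPerm) (F G : Face P) : Set where
    field
      same-rank : rank G ≡ rank F
      forth     : Image h (graph F) (graph G)
      back      : Image (inv h) (graph G) (graph F)

  open Moves

  moveFace : ∀ {h ρ} → IsPerm ρ → Recolours h ρ → Stable ρ → ∀ F → ∃ (Moves h F)
  moveFace {h} {ρ} ρ-perm r stable F = from-shape (shape F)
    where
    from-shape : Shape F → ∃ (Moves h F)
    from-shape (leastShape k (isLeast (v , _) (e , _))) = leastFace , record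
      { same-rank = sym k
      ; forth = imageOf (λ x t → ⊥-elim (v t)) (λ x i t → ⊥-elim (e t))
      ; back = imageOf (λ _ ()) (λ _ _ ())
      }
    from-shape (compShape x K K⊆top k c) = compFace (h · x) (push ρ K) (stable {K} K⊆top) , record
      { same-rank = trans (cong +_ (∣push∣ ρ ρ-perm K)) (sym k)
      ; forth = comp-image {h} {ρ} ρ-perm r c (comp-isComp (h · x) (push ρ K))
      ; back = comp-image-inv {h} {ρ} ρ-perm r c (comp-isComp (h · x) (push ρ K))
      }

  move-chain : ∀ {h ρ ℓ ℓ′ F G} → IsPerm ρ → Recolours h ρ → h · base ℓ ∼ base ℓ′ →
               ρ ⊙ order ℓ ≡ order ℓ′ → Moves h F G → InChain ℓ (graph F) → InChain ℓ′ (graph G)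
  move-chain {G = G} ρ-perm r at-base at-order m (atLeast (isLeast (v , _) (e , _))) = atLeast (isLeast
    ((λ {y} t → v (Image.vertices (back m) y t)) , λ ())
    ((λ { {y , i} t → e (Image.edges (back m) y i t) }) , λ ()))
  move-chain {h} {ρ} {ℓ} {ℓ′} {F} {G} ρ-perm r at-base at-order m (atInit k c) = atInit k
    (rebase (∼⇒near (∼-sym at-base)) (subst (λ K → IsComp (h · base ℓ) K (graph G))
      (trans (push-init ρ ρ-perm (order ℓ) (order-perm ℓ) k) (cong (init k) at-order))
      (image-comp {h} {ρ} ρ-perm r c (forth m) (back m))))

  same-orbit : ∀ {Φ Ψ ℓ ℓ′} → HasLabel Φ ℓ → HasLabel Ψ ℓ′ → ∀ h ρ → IsPerm ρ → Recolours h ρ →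
               Stable ρ → Stable (inverse ρ) → h · base ℓ ∼ base ℓ′ → ρ ⊙ order ℓ ≡ order ℓ′ →
               SameOrbit P Φ Ψ
  same-orbit {Φ} {Ψ} {ℓ} {ℓ′} hΦ hΨ h ρ ρ-perm r stable stable′ at-base at-order =
    isometry h
    , ( (λ F → let (G , m) = move F in G , same-rank m , maps m)
      , (λ G → let (F , m) = unmove G in F , sym (same-rank m) , maps m))
    , ( (λ F p → let (G , m) = move F in
          G , proj₂ (hΨ G)
                (move-chain {h} {ρ} {ℓ} {ℓ′} {F} {G} ρ-perm r at-base at-order m (proj₁ (hΦ F) p)) , maps m)
      , (λ G p → let (F , m) = unmove G in
          F , proj₂ (hΦ F) (move-chain {inv h} {inverse ρ} {ℓ′} {ℓ} {G} {F} (inverse-perm ρ ρ-perm) r′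
                at-base′ at-order′ (reverse m) (proj₁ (hΨ G) p)) , maps m))
    where
    r′ : Recolours (inv h) (inverse ρ)
    r′ = recolours-inv {h} {ρ} ρ-perm r
    at-base′ : inv h · base ℓ′ ∼ base ℓ
    at-base′ = subst (inv h · base ℓ′ ∼_) (inv-· h (base ℓ)) (·-∼ (inv h) (∼-sym at-base))
    at-order′ : inverse ρ ⊙ order ℓ′ ≡ order ℓ
    at-order′ = ext λ i → trans (lookup-⊙ (inverse ρ) (order ℓ′) i)
      (trans (cong (λ σ → lookup (inverse ρ) (lookup σ i)) (sym at-order))
        (trans (cong (lookup (inverse ρ)) (lookup-⊙ ρ (order ℓ) i)) (inverse∘ ρ ρ-perm (lookup (order ℓ) i))))
    maps : ∀ {F G} → Moves h F G → MapsFace P (isometry h) F G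
    maps {F} {G} m = image⇒mapsOnto {isometry h} {h} {graph F} {graph G} (isometry-represents h) (forth m) (back m)
    move : ∀ F → ∃ (Moves h F)
    move = moveFace {h} {ρ} ρ-perm r stable
    reverse : ∀ {F G} → Moves h F G → Moves (inv h) G F
    reverse m = record { same-rank = sym (same-rank m) ; forth = back m ; back = image-inv-inv {h} (forth m) }
    unmove : ∀ G → ∃ λ F → Moves h F G
    unmove G with moveFace {inv h} {inverse ρ} (inverse-perm ρ ρ-perm) r′ stable′ G
    ... | F , m = F , record { same-rank = sym (same-rank m) ; forth = inv-inv-image {h} (back m) ; back = forth m }

  -- For a facet both orders end with the omitted colour, so `top` is `init 3F` of either, and `ρ`
  -- carries one to the other.
  stable-between : ∀ ℓ ℓ′ ρ → IsPerm ρ → ρ ⊙ order ℓ ≡ order ℓ′ → Stable ρ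
  stable-between ℓ ℓ′ ρ ρ-perm eq {K} K⊆top {b} m =
    subst (b ∈ˢ_) (top-fixed top-cases (allowed ℓ) (allowed ℓ′)) (push-mono ρ ρ-perm {K} {top} K⊆top m)
    where
    fixed : ∀ k → init k (order ℓ) ≡ init k (order ℓ′) → push ρ (init k (order ℓ)) ≡ init k (order ℓ)
    fixed k p = trans (push-init ρ ρ-perm (order ℓ) (order-perm ℓ) k) (trans (cong (init k) eq) (sym p))
    top-fixed : ∀ {K} → K ≡ Subset.⊤ ⊎ K ≡ Subset.∁ ⁅ a ⁆ → init 3F (order ℓ) ⊆ K → init 3F (order ℓ′) ⊆ K →
                push ρ K ≡ K
    top-fixed (inj₁ refl) _ _ = fixed 4F refl
    top-fixed (inj₂ refl) p q = subst (λ J → push ρ J ≡ J) here-a (fixed 3F (trans here-a (sym there-a)))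
      where
      here-a : init 3F (order ℓ) ≡ Subset.∁ ⁅ a ⁆
      here-a = init-3-∁ (order ℓ) (order-perm ℓ) a p
      there-a : init 3F (order ℓ′) ≡ Subset.∁ ⁅ a ⁆
      there-a = init-3-∁ (order ℓ′) (order-perm ℓ′) a q

  -- The flags labelled by (x₀ , baseOrder) and (x₁ , baseOrder) represent the two orbits.
  baseOrder : Map
  baseOrder = proj₁ (omit a)

  baseLabel : Vertex → Label
  baseLabel x = label x baseOrder (proj₁ (proj₂ (omit a)))
    λ {b} m → ∁a⊆top (subst (b ∈ˢ_) (proj₂ (proj₂ (omit a))) m)

  x₁ : Vertex
  x₁ = flip 0F x₀

  directions-perm : ∀ y ρ → IsPerm ρ → IsPerm (directions α y ρ)
  directions-perm y ρ p = injective⇒perm _ λ i j q → perm⇒injective ρ p i j (begin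
    lookup ρ i                            ≡⟨ model-dir α y (lookup ρ i) ⟨
    model α (y , dir α y (lookup ρ i))        ≡⟨ cong (λ d → model α (y , d)) (trans (sym (at-i i)) (trans q (at-i j))) ⟩
    model α (y , dir α y (lookup ρ j))        ≡⟨ model-dir α y (lookup ρ j) ⟩
    lookup ρ j                            ∎)
    where
    open ≡-Reasoning
    at-i : ∀ i → lookup (directions α y ρ) i ≡ dir α y (lookup ρ i)
    at-i = Vec.lookup∘tabulate λ i → dir α y (lookup ρ i)

  realise : ∀ y ρ → IsPerm ρ → SignedPerm
  realise y ρ p = record { sign = y ; perm = directions α y ρ ; isPerm = directions-perm y ρ p }

  realise-recolours : ∀ y ρ (p : IsPerm ρ) → parity y ≡ sgn ρ → Recolours (realise y ρ p) ρ
  realise-recolours y ρ p q = preserves⇒recolours {realise y ρ p} {ρ} (realisable ρ p y α q)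

  module Reach (ℓ : Label) where

    -- The only recolouring that takes `baseOrder` to the order of `ℓ`.
    ρ : Map
    ρ = order ℓ ⊙ inverse baseOrder

    base-perm : IsPerm baseOrder
    base-perm = proj₁ (proj₂ (omit a))

    ρ-perm : IsPerm ρ
    ρ-perm = ⊙-perm (order ℓ) (order-perm ℓ) (inverse baseOrder) (inverse-perm baseOrder base-perm)

    ρ-base : ρ ⊙ baseOrder ≡ order ℓ
    ρ-base = ext λ i → trans (lookup-⊙ ρ baseOrder i)
      (trans (lookup-⊙ (order ℓ) (inverse baseOrder) (lookup baseOrder i))
        (cong (lookup (order ℓ)) (inverse∘ baseOrder base-perm i)))

    base-ρ : inverse ρ ⊙ order ℓ ≡ baseOrder
    base-ρ = ext λ i → trans (lookup-⊙ (inverse ρ) (order ℓ) i)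
      (trans (cong (λ σ → lookup (inverse ρ) (lookup σ i)) (sym ρ-base))
        (trans (cong (lookup (inverse ρ)) (lookup-⊙ ρ baseOrder i)) (inverse∘ ρ ρ-perm (lookup baseOrder i))))

    reach : ∀ x {Ω} → HasLabel Ω ℓ → ∀ y → parity y ≡ sgn ρ →
            (∀ p → realise y ρ p · x ∼ base ℓ) → SameOrbit P (flag (baseLabel x)) Ω
    reach x {Ω} hΩ y q at-base = same-orbit {flag (baseLabel x)} {Ω} {baseLabel x} {ℓ}
      (flag-label (baseLabel x)) hΩ (realise y ρ ρ-perm) ρ ρ-perm
      (realise-recolours y ρ ρ-perm q)
      (λ {K} → stable-between (baseLabel x) ℓ ρ ρ-perm ρ-base {K})
      (λ {K} → stable-between ℓ (baseLabel x) (inverse ρ) (inverse-perm ρ ρ-perm) base-ρ {K})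
      (at-base ρ-perm) ρ-base

    sign-cases : ∀ s t → s ≡ t ⊎ Sign.opposite s ≡ t
    sign-cases Sign.+ Sign.+ = inj₁ refl
    sign-cases Sign.+ Sign.- = inj₂ refl
    sign-cases Sign.- Sign.+ = inj₂ refl
    sign-cases Sign.- Sign.- = inj₁ refl

    -- ρ sends the colour 0F of the edge x₀ x₁ to the colour of the edge at base ℓ in direction d.
    d : Fin 4
    d = dir α (base ℓ) (lookup ρ 0F)

    y₁ : Vertex
    y₁ = flip d (base ℓ)

    -- `y₁` and `base ℓ` are the ends of a single edge, so its colour can be read off at either of
    -- them.
    to-0 : ∀ p → to (realise y₁ ρ p) 0F ≡ d
    to-0 p = begin
      dir α y₁ (lookup ρ 0F)            ≡⟨ cong (dir α y₁) (model-dir α (base ℓ) (lookup ρ 0F)) ⟨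
      dir α y₁ (model α (base ℓ , d))       ≡⟨ cong (dir α y₁) (model-flip α (base ℓ) d) ⟨
      dir α y₁ (model α (y₁ , d))           ≡⟨ dir-model α y₁ d ⟩
      d                                 ∎
      where open ≡-Reasoning

    -- The motion takes `x₀` to `y₁`, and the edge from `x₀` to `x₁` to the edge at `y₁` in
    -- direction `d`, which leads to `base ℓ`.
    x₁-to-base : ∀ p → realise y₁ ρ p · x₁ ≡ base ℓ
    x₁-to-base p = begin
      realise y₁ ρ p · flip 0F x₀                         ≡⟨ ·-flip (realise y₁ ρ p) 0F x₀ ⟩
      flip (to (realise y₁ ρ p) 0F) (realise y₁ ρ p · x₀) ≡⟨ cong₂ flip (to-0 p) (·-x₀ (realise y₁ ρ p)) ⟩
      flip d (flip d (base ℓ))                            ≡⟨ flip-flip d (base ℓ) ⟩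
      base ℓ                                              ∎
      where open ≡-Reasoning

    orbit : ∀ {Ω} → HasLabel Ω ℓ → SameOrbit P (flag (baseLabel x₀)) Ω ⊎ SameOrbit P (flag (baseLabel x₁)) Ω
    orbit {Ω} hΩ = by-cases (sign-cases (parity (base ℓ)) (sgn ρ))
      where
      by-cases : parity (base ℓ) ≡ sgn ρ ⊎ Sign.opposite (parity (base ℓ)) ≡ sgn ρ →
                 SameOrbit P (flag (baseLabel x₀)) Ω ⊎ SameOrbit P (flag (baseLabel x₁)) Ω
      by-cases (inj₁ q) = inj₁ (reach x₀ {Ω} hΩ (base ℓ) q λ p → inj₁ (·-x₀ (realise (base ℓ) ρ p)))
      -- Starting from the neighbour `x₁` reverses the parity required of the motion.
      by-cases (inj₂ q) = inj₂ (reach x₁ {Ω} hΩ y₁ (trans (parity-flip d (base ℓ)) q) λ p → inj₁ (x₁-to-base p))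

  geometricallyChiral : GeometricallyChiral P
  geometricallyChiral =
      ( flag (baseLabel x₀) , flag (baseLabel x₁)
      , (λ s → sign-≢ (sgn baseOrder) {Sign.+} {Sign.-} (λ ())
          (orbit-parity {flag (baseLabel x₀)} {flag (baseLabel x₁)} {baseLabel x₀} {baseLabel x₁}
            (flag-label (baseLabel x₀)) (flag-label (baseLabel x₁)) s))
      , λ Ω → let (ℓ , hΩ) = flagLabel Ω in Reach.orbit ℓ {Ω} hΩ)
    , λ Φ Ψ adjacent s → let (ℓ , hΦ) = flagLabel Φ ; (ℓ′ , hΨ) = flagLabel Ψ in
        adjacent-parity {Φ} {Ψ} {ℓ} {ℓ′} hΦ hΨ adjacent (orbit-parity {Φ} {Ψ} {ℓ} {ℓ′} hΦ hΨ s)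

facet-comp : ∀ {c} (m : IsModelled c) {F} → 𝒬 c (+ 3) F →
             ∃₂ λ x a → Coloured.IsComp (IsModelled.α m) x (Subset.∁ ⁅ a ⁆) F
facet-comp {c} m {F} f = from-class (classify f)
  where
  open IsModelled m using (α)
  open Labelling α
  open Labelled (Faces.𝒬-labelled c m)
  open Coloured α
  from-class : (+ 3 ≡ -[1+ 0 ] × IsLeast F) ⊎ (∃₂ λ x K → K ⊆ Subset.⊤ × + 3 ≡ + ∣ K ∣ × IsComp x K F) →
               ∃₂ λ x a → IsComp x (Subset.∁ ⁅ a ⁆) F
  from-class (inj₁ (() , _))
  from-class (inj₂ (x , K , _ , r , c)) with size-3 K (sym (ℤ.+-injective r))
  ... | a , refl = x , a , c

-- `F` contains all vertices of Γ, so a component lies in `F` as soon as its colours are among those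
-- of `F`.
facet-labelled : ∀ {c} (m : IsModelled c) {F x a} → Coloured.IsComp (IsModelled.α m) x (Subset.∁ ⁅ a ⁆) F →
                 Labelling.Labelled (IsModelled.α m) (facetPolytope (𝒬 c) F) (Subset.∁ ⁅ a ⁆)
facet-labelled {c} m {F} {x} {a} F-comp = record
  { classify   = λ { (f , S⊑F) → map₂ (λ { (y , K , _ , r , k) →
                     y , K , proj₁ (⊑-comp k F-comp S⊑F) , r , k }) (classify f) }
  ; least-face = λ {S} l → least-face l , least-⊑ {S′ = F} l
  ; comp-face  = λ K⊆ k → comp-face (λ _ → ∈⊤) k , comp-⊑ k F-comp K⊆ (joined-∁ a)
  }
  where
  open IsModelled m using (α)
  open Labelling α
  open Labelled (Faces.𝒬-labelled c m)
  open Coloured α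
  open Recolouring α

theorem1 : (c : ChiralColouring) →
    IsomorphicToHemiHypercube (𝒬 c)
    × GeometricallyChiral (𝒬 c)
    × (∀ F → 𝒬 c (+ 3) F → GeometricallyChiral (facetPolytope (𝒬 c) F))
theorem1 c =
    HemiHypercube.isomorphic α (𝒬 c) (Faces.𝒬-labelled c m)
  -- For 𝒬 the colour `0F` selects the facet on which rigidity is tested and the last colour of the
  -- two base flags.
  , Transitivity.geometricallyChiral α (𝒬 c) Subset.⊤ (Faces.𝒬-labelled c m) 0F (inj₁ refl)
  , λ F f → let (x , a , F-comp) = facet-comp m f in
      Transitivity.geometricallyChiral α (facetPolytope (𝒬 c) F) (Subset.∁ ⁅ a ⁆)
        (facet-labelled m F-comp) a (inj₂ refl)
  where
  m : IsModelled c
  m = Classification.isModelled c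
  open IsModelled m using (α)
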